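{- There exist $c>0$ and $n_0\in\mathbb{N}$ such that for every $n>n_0$ the following holds. If $T_1,\dots,T_n$ are trees such that each $T_s$ has exactly $n+1$ vertices and maximum degree $\Delta(T_s)\le\frac{cn}{\log n}$, then the family $(T_s)_{s\in[n]}$ packs into the complete graph $K_{2n+1}$.
   Context: A family of graphs $G_1,\dots,G_t$ packs into a graph $H$ if there are pairwise edge-disjoint subgraphs of $H$ isomorphic to $G_1,\dots,G_t$ respectively. -}

module Defs where

open import Data.Nat using (ℕ; zero; suc; _+_; _*_; _≤_; _<_)
open import Data.Bool using (Bool; true; false; if_then_else_; not)
open import Data.Fin using (Fin; zero; suc; inject₁; fromℕ; _≟_)
open import Data.List using (List; map; allFin)
open import Data.Nat.ListAction using (sum)
open import Data.Empty using (⊥-elim)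
open import Data.Sum using (_⊎_)
open import Data.Product using (Σ; _×_; _,_)
open import Relation.Nullary using (¬_; does)
open import Relation.Binary.PropositionalEquality using (_≡_; refl) renaming (sym to ≡-sym)
open import Function.Definitions using (Injective)

record Graph (k : ℕ) : Set where
  field
    adj   : Fin k → Fin k → Bool
    sym   : ∀ u v → adj u v ≡ adj v u
    irref : ∀ v → adj v v ≡ false

open Graph public

Edge : ∀ {k} → Graph k → Fin k → Fin k → Set
Edge G u v = adj G u v ≡ true

degree : ∀ {k} → Graph k → Fin k → ℕ
degree {k} G v = sum (map (λ u → if adj G v u then 1 else 0) (allFin k))

data Walk {k : ℕ} (G : Graph k) : Fin k → Fin k → Set where
  [] : ∀ {v} → Walk G v v
  _∷_ : ∀ {u v w} → Edge G u v → Walk G v w → Walk G u w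

Connected : ∀ {k} → Graph k → Set
Connected G = ∀ u v → Walk G u v

record Cycle {k : ℕ} (G : Graph k) : Set where
  field
    m     : ℕ
    c     : Fin (suc (suc (suc m))) → Fin k
    inj   : Injective _≡_ _≡_ c
    step  : ∀ (i : Fin (suc (suc m))) → Edge G (c (inject₁ i)) (c (suc i))
    close : Edge G (c (fromℕ (suc (suc m)))) (c zero)

Acyclic : ∀ {k} → Graph k → Set
Acyclic G = ¬ Cycle G

IsTree : ∀ {k} → Graph k → Set
IsTree G = Connected G × Acyclic G

K : (k : ℕ) → Graph k
K k = record
  { adj = λ u v → not (does (u ≟ v))
  ; sym = symK
  ; irref = irrK }
  where
  open import Relation.Nullary using (yes; no)
  symK : ∀ u v → not (does (u ≟ v)) ≡ not (does (v ≟ u))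
  symK u v with u ≟ v | v ≟ u
  ... | yes _ | yes _ = refl
  ... | no _  | no _  = refl
  ... | yes p | no q  = ⊥-elim (q (≡-sym p))
  ... | no p  | yes q = ⊥-elim (p (≡-sym q))
  irrK : ∀ v → not (does (v ≟ v)) ≡ false
  irrK v with v ≟ v
  ... | yes _ = refl
  ... | no p  = ⊥-elim (p refl)

record Embedding {a b : ℕ} (G : Graph a) (H : Graph b) : Set where
  field
    f       : Fin a → Fin b
    inj     : Injective _≡_ _≡_ f
    edgeMap : ∀ u v → Edge G u v → Edge H (f u) (f v)

open Embedding public

Packs : ∀ {t a b : ℕ} → (Fin t → Graph a) → Graph b → Set
Packs {t} {a} G H =
  Σ ((s : Fin t) → Embedding (G s) H) λ φ →
    ∀ s s' → ¬ s ≡ s' → ∀ u v x y → Edge (G s) u v → Edge (G s') x y →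
      ¬ ((f (φ s) u ≡ f (φ s') x × f (φ s) v ≡ f (φ s') y) ⊎
         (f (φ s) u ≡ f (φ s') y × f (φ s) v ≡ f (φ s') x))

module Submission where

-- The trees are embedded one at a time, avoiding the edges used before, and only numbers of edges have to be controlled.
-- Let M = n / C for a large constant C, and reserve a set Z of 8 M host vertices.  Cutting a tree bottom-up at each vertex
-- whose remaining subtree has at least M vertices leaves pieces with at most M vertices, joined by boundedly many single
-- vertices.  The single vertices are placed in Z; since degrees are far below M, hardly any edge at Z is ever used, so the
-- pieces can be placed independently of each other.
--
-- The pieces go to the set R of free vertices outside Z.  Initially R has about 2 n vertices and about 2 n² or more ordered
-- unused pairs, and a lower bound g(r) for the number E of these pairs in terms of r = |R| is maintained until r is about n.
-- Round degrees in R to multiples of n / L, let I be the least level whose vertices are incident with many unused edges,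
-- and J ≥ I the least level such that many of these edges go to vertices of level at most J.  The dense bipartite graph
-- between the two levels contains a core of large minimum degree, where a piece is embedded greedily with its larger colour
-- class in level I; each of its vertices then costs (I + J) n / L pairs on average.  If I + J is small, this respects the
-- bound g.  If I + J is large, the minimality of I and J forces E to exceed g(r) so clearly that losing a piece is harmless.

-- Taking a vertex of degree d out of R costs 2 d ordered pairs, so the question is whether E can
-- stay positive while r falls from 2 n to n, starting from about 2 n² pairs. Prices I n / L and J n
-- / L for the two colour classes mean at most (I + J) n / L per vertex, which is affordable up to
-- g′(r). Beyond that price the greedy step loses too much. What helps is that a typical vertex of
-- level I then has nearly all its neighbours in level J or above, and a typical one of these has
-- few neighbours below level I, so that many vertices of large degree exist. One function g has to
-- serve both cases, and there is little room: g(2 n) = 1.98 n² against the 2 n² pairs at hand.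
--
-- The thresholds are ordered by size: a core of minimum degree 2 M needs about M n pairs (τ′), a
-- populated level needs many more (τ), and both are negligible against n² / 100 < E. M = n / C is
-- chosen after all of them.

open import Defs hiding (sym; f; inj; K)
import Defs
open import Data.Nat hiding (_≟_)
open import Data.Nat.Properties hiding (_≟_)
open import Data.Nat.DivMod using (m≡m%n+[m/n]*n; m%n<n; m/n*n≤m)
open import Data.Nat.Logarithm using (⌊log₂_⌋; ⌊log₂⌋-mono-≤)
open import Data.Nat.Tactic.RingSolver using (solve-∀)
import Data.Nat.ListAction as ListAction
open import Data.Bool using (Bool; true; false; _∧_; not; if_then_else_; T)
import Data.Bool.Properties as Bool
open import Data.Empty using (⊥; ⊥-elim)
open import Data.Fin using (Fin; zero; suc; _≟_; inject₁; fromℕ)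
open import Data.Fin.Properties using (any?)
open import Data.List using (List; []; _∷_; _++_; _ʳ++_; length; lookup; tabulate; allFin)
open import Data.List.Membership.DecPropositional using (_∈?_)
open import Data.List.Membership.Propositional using (_∈_; _∉_)
open import Data.List.Membership.Propositional.Properties using (∈-++⁻; ∈-++⁺ˡ; ∈-++⁺ʳ; ∈-lookup; ∈-allFin)
open import Data.List.Properties using (length-++; length-ʳ++; map-tabulate)
open import Data.List.Relation.Unary.Any using (here; there)
open import Data.Product using (Σ; ∃; _×_; _,_; proj₁; proj₂)
open import Data.Sum using (_⊎_; inj₁; inj₂)
open import Data.Unit using (⊤; tt)
open import Relation.Binary.PropositionalEquality hiding ([_]; J)
open import Relation.Nullary using (¬_; Dec; does; yes; no)
open import Relation.Nullary.Decidable using (_×-dec_)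
open import Algebra.Properties.Semiring.Sum +-*-semiring using (sum; sum-cong-≗; ∑-distrib-+; ∑-comm; *-distribˡ-sum; *-distribʳ-sum)

-- Sums and subsets

[_] : Bool → ℕ
[ true ] = 1
[ false ] = 0

[]≤1 : ∀ b → [ b ] ≤ 1
[]≤1 true = ≤-refl
[]≤1 false = z≤n

sum-mono : ∀ {k} {f g : Fin k → ℕ} → (∀ i → f i ≤ g i) → sum f ≤ sum g
sum-mono {zero} h = z≤n
sum-mono {suc k} h = +-mono-≤ (h zero) (sum-mono (λ i → h (suc i)))

sum-≤ : ∀ {k} {f : Fin k → ℕ} c → (∀ i → f i ≤ c) → sum f ≤ k * c
sum-≤ {zero} c h = z≤n
sum-≤ {suc k} c h = +-mono-≤ (h zero) (sum-≤ c (λ i → h (suc i)))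

sum-one : ∀ k → sum {k} (λ _ → 1) ≡ k
sum-one zero = refl
sum-one (suc k) = cong suc (sum-one k)

sum-< : ∀ {k} {f g : Fin k → ℕ} → sum f < sum g → ∃ λ i → f i < g i
sum-< {suc k} {f} {g} h with f zero <? g zero
... | yes p = zero , p
... | no p with sum-< {k} {λ i → f (suc i)} {λ i → g (suc i)} (+-cancelˡ-< (g zero) _ _ (≤-<-trans (+-monoˡ-≤ _ (≮⇒≥ p)) h))
... | i , q = suc i , q

sum-≥ : ∀ {k} (f : Fin k → ℕ) i → f i ≤ sum f
sum-≥ f zero = m≤m+n _ _
sum-≥ f (suc i) = ≤-trans (sum-≥ (λ j → f (suc j)) i) (m≤n+m _ _)

sum-0 : ∀ k → sum {k} (λ _ → 0) ≡ 0
sum-0 zero = refl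
sum-0 (suc k) = sum-0 k

≟-suc : ∀ {k} (i j : Fin k) → does (suc i ≟ suc j) ≡ does (i ≟ j)
≟-suc i j with i ≟ j
... | yes _ = refl
... | no _ = refl

sum-δ : ∀ {k} (i : Fin k) (g : Fin k → ℕ) → sum (λ j → [ does (j ≟ i) ] * g j) ≡ g i
sum-δ {suc k} zero g = trans (cong₂ _+_ (+-identityʳ (g zero)) (sum-0 k)) (+-identityʳ _)
sum-δ {suc k} (suc i) g = trans (sum-cong-≗ (λ j → cong (λ b → [ b ] * g (suc j)) (≟-suc j i))) (sum-δ i (λ j → g (suc j)))

does-refl : ∀ {k} (i : Fin k) → does (i ≟ i) ≡ true
does-refl i with i ≟ i
... | yes _ = refl
... | no q = ⊥-elim (q refl)

∧-split : ∀ {a b} → a ∧ b ≡ true → a ≡ true × b ≡ true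
∧-split {true} {true} e = refl , refl

∧-intro : ∀ {a b} → a ≡ true → b ≡ true → a ∧ b ≡ true
∧-intro refl refl = refl

Sub : ℕ → Set
Sub N = Fin N → Bool

_∋_ : ∀ {N} → Sub N → Fin N → Set
S ∋ x = S x ≡ true

count : ∀ {N} → Sub N → ℕ
count S = sum (λ x → [ S x ])

count-≤ : ∀ {N} (S : Sub N) → count S ≤ N
count-≤ {N} S = subst (count S ≤_) (*-identityʳ N) (sum-≤ 1 (λ i → []≤1 (S i)))

[]-mono : ∀ {a b} → (a ≡ true → b ≡ true) → [ a ] ≤ [ b ]
[]-mono {false} h = z≤n
[]-mono {true} {true} h = ≤-refl
[]-mono {true} {false} h with h refl
... | ()

count-mono : ∀ {N} {S T : Sub N} → (∀ x → S ∋ x → T ∋ x) → count S ≤ count T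
count-mono h = sum-mono (λ x → []-mono (h x))

1≤[] : ∀ {b} → 0 < [ b ] → b ≡ true
1≤[] {true} _ = refl

count-∃ : ∀ {N} (S : Sub N) → 0 < count S → ∃ λ x → S ∋ x
count-∃ {N} S h with sum-< {N} {λ _ → 0} {λ x → [ S x ]} (subst (_< count S) (sym (sum-0 N)) h)
... | x , p = x , 1≤[] p

infixl 6 _∖_
_∖_ : ∀ {N} → Sub N → Fin N → Sub N
(S ∖ y) x = S x ∧ not (does (x ≟ y))

∖-⊆ : ∀ {N} (S : Sub N) y x → (S ∖ y) ∋ x → S ∋ x
∖-⊆ S y x p = proj₁ (∧-split p)

∖-≢ : ∀ {N} (S : Sub N) y x → (S ∖ y) ∋ x → x ≢ y
∖-≢ S y x p refl with ∧-split {S x} p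
... | _ , q rewrite does-refl x with q
... | ()

count-∖ : ∀ {N} (S : Sub N) y → count S ≤ count (S ∖ y) + 1
count-∖ S y = ≤-trans (sum-mono pt) (≤-reflexive (trans (∑-distrib-+ (λ x → [ (S ∖ y) x ]) (λ x → [ does (x ≟ y) ] * 1)) (cong (count (S ∖ y) +_) (sum-δ y (λ _ → 1)))))
  where
  pt : ∀ x → [ S x ] ≤ [ (S ∖ y) x ] + [ does (x ≟ y) ] * 1
  pt x with S x | does (x ≟ y)
  ... | false | _ = z≤n
  ... | true | true = ≤-refl
  ... | true | false = ≤-refl

count-∖-∈ : ∀ {N} (S : Sub N) y → S ∋ y → count (S ∖ y) < count S
count-∖-∈ S y h = ≤-trans (≤-reflexive (trans (+-comm 1 _) (trans (cong (count (S ∖ y) +_) (sym (sum-δ y (λ _ → 1)))) (sym (∑-distrib-+ (λ x → [ (S ∖ y) x ]) (λ x → [ does (x ≟ y) ] * 1)))))) (sum-mono pt)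
  where
  pt : ∀ x → [ (S ∖ y) x ] + [ does (x ≟ y) ] * 1 ≤ [ S x ]
  pt x with x ≟ y
  ... | yes refl rewrite h = ≤-refl
  ... | no _ with S x
  ... | true = ≤-refl
  ... | false = ≤-refl

count-split : ∀ {N} (S T : Sub N) → count S ≡ count (λ x → S x ∧ T x) + count (λ x → S x ∧ not (T x))
count-split S T = trans (sum-cong-≗ pt) (∑-distrib-+ (λ x → [ S x ∧ T x ]) (λ x → [ S x ∧ not (T x) ]))
  where
  pt : ∀ x → [ S x ] ≡ [ S x ∧ T x ] + [ S x ∧ not (T x) ]
  pt x with S x | T x
  ... | false | _ = refl
  ... | true | true = refl
  ... | true | false = refl

sum-scaleˡ : ∀ {k} c (f : Fin k → ℕ) → c * sum f ≡ sum (λ i → c * f i)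
sum-scaleˡ c f = *-distribˡ-sum c f

markov : ∀ {N} (S : Sub N) (f : Fin N → ℕ) c → (∀ x → S ∋ x → c ≤ f x) → c * count S ≤ sum f
markov S f c h = ≤-trans (≤-reflexive (sum-scaleˡ c (λ x → [ S x ]))) (sum-mono pt)
  where
  pt : ∀ x → c * [ S x ] ≤ f x
  pt x with S x in eq
  ... | true = ≤-trans (≤-reflexive (*-identityʳ c)) (h x eq)
  ... | false = ≤-trans (≤-reflexive (*-zeroʳ c)) z≤n

-- Edge counts and dense cores

module Host {N : ℕ} (H : Fin N → Fin N → Bool) (H-sym : ∀ x y → H x y ≡ H y x) where

  dg : Sub N → Fin N → ℕ
  dg B x = count (λ y → B y ∧ H x y)

  -- Ordered pairs are counted: an edge inside both A and B counts twice, and a pair (x, x) in H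
  -- counts once.
  e : Sub N → Sub N → ℕ
  e A B = sum (λ x → [ A x ] * dg B x)

  dg-mono : ∀ {A B : Sub N} → (∀ y → A ∋ y → B ∋ y) → ∀ x → dg A x ≤ dg B x
  dg-mono h x = count-mono (λ y p → ∧-intro (h y (proj₁ (∧-split p))) (proj₂ (∧-split p)))

  e-sym : ∀ A B → e A B ≡ e B A
  e-sym A B = trans (sum-cong-≗ (λ x → sum-scaleˡ [ A x ] (λ y → [ B y ∧ H x y ])))
    (trans (∑-comm (λ x y → [ A x ] * [ B y ∧ H x y ]))
    (trans (sum-cong-≗ (λ y → sum-cong-≗ (λ x → pt x y)))
      (sym (sum-cong-≗ (λ y → sum-scaleˡ [ B y ] (λ x → [ A x ∧ H y x ]))))))
    where
    pt : ∀ x y → [ A x ] * [ B y ∧ H x y ] ≡ [ B y ] * [ A x ∧ H y x ]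
    pt x y rewrite H-sym y x with A x | B y | H x y
    ... | true | true | true = refl
    ... | true | true | false = refl
    ... | true | false | _ = refl
    ... | false | true | _ = refl
    ... | false | false | _ = refl

  e-monoˡ : ∀ {A A′} B → (∀ x → A ∋ x → A′ ∋ x) → e A B ≤ e A′ B
  e-monoˡ B h = sum-mono (λ x → *-monoˡ-≤ (dg B x) ([]-mono (h x)))

  e-monoʳ : ∀ A {B B′} → (∀ x → B ∋ x → B′ ∋ x) → e A B ≤ e A B′
  e-monoʳ A h = sum-mono (λ x → *-monoʳ-≤ [ A x ] (dg-mono h x))

  e-split : ∀ A B (T : Sub N) → e A B ≡ e (λ x → A x ∧ T x) B + e (λ x → A x ∧ not (T x)) B
  e-split A B T = trans (sum-cong-≗ pt) (∑-distrib-+ (λ x → [ A x ∧ T x ] * dg B x) (λ x → [ A x ∧ not (T x) ] * dg B x))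
    where
    pt : ∀ x → [ A x ] * dg B x ≡ [ A x ∧ T x ] * dg B x + [ A x ∧ not (T x) ] * dg B x
    pt x with A x | T x
    ... | false | _ = refl
    ... | true | true = sym (+-identityʳ _)
    ... | true | false = refl

  e-≤ : ∀ A B c → (∀ x → A ∋ x → dg B x ≤ c) → e A B ≤ count A * c
  e-≤ A B c h = ≤-trans (sum-mono pt) (≤-reflexive (sym (*-distribʳ-sum c (λ x → [ A x ]))))
    where
    pt : ∀ x → [ A x ] * dg B x ≤ [ A x ] * c
    pt x with A x in eq
    ... | false = z≤n
    ... | true = *-monoʳ-≤ 1 (h x eq)

  e-∖ : ∀ A B x → e A B ≤ e (A ∖ x) B + dg B x
  e-∖ A B x = ≤-trans (sum-mono pt) (≤-reflexive (trans (∑-distrib-+ (λ z → [ (A ∖ x) z ] * dg B z) (λ z → [ does (z ≟ x) ] * dg B z)) (cong (e (A ∖ x) B +_) (sum-δ x (dg B)))))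
    where
    pt : ∀ z → [ A z ] * dg B z ≤ [ (A ∖ x) z ] * dg B z + [ does (z ≟ x) ] * dg B z
    pt z with A z | does (z ≟ x)
    ... | false | _ = z≤n
    ... | true | true = ≤-refl
    ... | true | false = m≤m+n _ _

  e-∖-both : ∀ R y → e R R ≤ e (R ∖ y) (R ∖ y) + 2 * dg R y
  e-∖-both R y = begin
    e R R ≤⟨ e-∖ R R y ⟩
    e (R ∖ y) R + dg R y ≡⟨ cong (_+ dg R y) (e-sym (R ∖ y) R) ⟩
    e R (R ∖ y) + dg R y ≤⟨ +-monoˡ-≤ (dg R y) (e-∖ R (R ∖ y) y) ⟩
    e (R ∖ y) (R ∖ y) + dg (R ∖ y) y + dg R y ≤⟨ +-monoˡ-≤ (dg R y) (+-monoʳ-≤ (e (R ∖ y) (R ∖ y)) (dg-mono (∖-⊆ R y) y)) ⟩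
    e (R ∖ y) (R ∖ y) + dg R y + dg R y ≡⟨ +-assoc (e (R ∖ y) (R ∖ y)) _ _ ⟩
    e (R ∖ y) (R ∖ y) + (dg R y + dg R y) ≡⟨ cong (λ z → e (R ∖ y) (R ∖ y) + (dg R y + z)) (sym (+-identityʳ _)) ⟩
    e (R ∖ y) (R ∖ y) + 2 * dg R y ∎
    where open ≤-Reasoning

  record Core (t : ℕ) (A B : Sub N) : Set where
    field
      A′ B′ : Sub N
      A⊆ : ∀ x → A′ ∋ x → A ∋ x
      B⊆ : ∀ x → B′ ∋ x → B ∋ x
      A-deg : ∀ x → A′ ∋ x → t < dg B′ x
      B-deg : ∀ x → B′ ∋ x → t < dg A′ x
      A-∃ : ∃ (A′ ∋_)

  -- Deleting a vertex of degree at most t from either side lowers the left of the hypothesis by t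
  -- and the right by at most t, so the strict inequality survives all deletions and keeps both
  -- sides nonempty. A and B may overlap: a common vertex has one copy on each side.
  core : ∀ t A B → t * (count A + count B) < e A B → Core t A B
  core t A B = go (count A + count B) A B ≤-refl
    where
    peel : ∀ a a′ b d E E′ → a < a′ → t * (a′ + b) < E′ → E′ ≤ E + d → d ≤ t → t * (a + b) < E
    peel a a′ b d E E′ p q r s = +-cancelʳ-< t _ _ (≤-trans (s≤s (≤-trans (≤-reflexive (trans (+-comm _ t) (sym (*-suc t (a + b))))) (*-monoʳ-≤ t (+-monoˡ-≤ b p)))) (≤-trans q (≤-trans r (+-monoʳ-≤ E s))))
    go : ∀ fuel A B → count A + count B ≤ fuel → t * (count A + count B) < e A B → Core t A B
    go fuel A B hf h with any? (λ x → (A x Bool.≟ true) ×-dec (dg B x ≤? t))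
    go zero A B hf h | yes (x , px , _) with count A | count-∖-∈ A x px
    ... | suc _ | _ = ⊥-elim (n≮0 hf)
    go (suc fuel) A B hf h | yes (x , px , dx) with go fuel (A ∖ x) B (≤-pred (≤-trans (+-monoˡ-≤ (count B) (count-∖-∈ A x px)) hf)) (peel _ _ (count B) (dg B x) _ _ (count-∖-∈ A x px) h (e-∖ A B x) dx)
    ... | c = record { Core c ; A⊆ = λ z p → ∖-⊆ A x z (Core.A⊆ c z p) }
    go fuel A B hf h | no ¬x with any? (λ y → (B y Bool.≟ true) ×-dec (dg A y ≤? t))
    go zero A B hf h | no ¬x | yes (y , py , dy) with count A + count B | +-monoʳ-≤ (count A) (count-∖-∈ B y py)
    ... | zero | q = ⊥-elim (n≮0 (≤-trans (≤-reflexive (sym (+-suc (count A) _))) q))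
    ... | suc _ | _ = ⊥-elim (n≮0 hf)
    go (suc fuel) A B hf h | no ¬x | yes (y , py , dy) with go fuel A (B ∖ y)
        (≤-pred (≤-trans (≤-reflexive (sym (+-suc (count A) _))) (≤-trans (+-monoʳ-≤ (count A) (count-∖-∈ B y py)) hf)))
        (subst₂ (λ u v → t * u < v) (+-comm (count (B ∖ y)) _) (e-sym (B ∖ y) A)
          (peel _ _ (count A) (dg A y) _ _ (count-∖-∈ B y py) (subst₂ (λ u v → t * u < v) (+-comm (count A) _) (e-sym A B) h) (e-∖ B A y) dy))
    ... | c = record { Core c ; B⊆ = λ z p → ∖-⊆ B y z (Core.B⊆ c z p) }
    go fuel A B hf h | no ¬x | no ¬y = record
      { A′ = A ; B′ = B ; A⊆ = λ _ p → p ; B⊆ = λ _ p → p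
      ; A-deg = λ x p → ≰⇒> (λ q → ¬x (x , p , q))
      ; B-deg = λ x p → ≰⇒> (λ q → ¬y (x , p , q))
      ; A-∃ = nonempty }
      where
      nonempty : ∃ (A ∋_)
      nonempty with sum-< {N} {λ _ → 0} {λ x → [ A x ] * dg B x} (subst (_< e A B) (sym (sum-0 N)) (≤-<-trans z≤n h))
      ... | x , p with A x in eq
      ... | true = x , eq

-- Degree levels

does-true : ∀ {P : Set} (d : Dec P) → does d ≡ true → P
does-true (yes p) _ = p

true-does : ∀ {P : Set} (d : Dec P) → P → does d ≡ true
true-does (yes _) _ = refl
true-does (no ¬p) p = ⊥-elim (¬p p)

not-does : ∀ {P : Set} (d : Dec P) → not (does d) ≡ true → ¬ P
not-does (no ¬p) _ = ¬p

does-not : ∀ {P : Set} (d : Dec P) → ¬ P → not (does d) ≡ true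
does-not (no ¬p) _ = refl
does-not (yes p) q = ⊥-elim (q p)

not-true : ∀ {b} → not b ≡ true → b ≡ true → ⊥
not-true {true} () _
not-true {false} _ ()

true-not : ∀ {b} → (b ≡ true → ⊥) → not b ≡ true
true-not {true} h = ⊥-elim (h refl)
true-not {false} h = refl

-- Minimality of a level is only used as failure of the condition one step earlier, so a change from
-- false to true is enough.
crossing : (P : ℕ → Set) → (∀ i → Dec (P i)) → ∀ k b → ¬ P b → P (k + b) →
  ∃ λ i → b ≤ i × i < k + b × ¬ P i × P (suc i)
crossing P P? zero b ¬p p = ⊥-elim (¬p p)
crossing P P? (suc k) b ¬p p with P? (suc b)
... | yes q = b , ≤-refl , s≤s (m≤n+m b k) , ¬p , q
... | no ¬q with crossing P P? k (suc b) ¬q (subst P (sym (+-suc k b)) p)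
... | i , b≤i , i<k , r = i , <⇒≤ b≤i , subst (i <_) (+-suc k b) i<k , r

module Buckets {N : ℕ} (H : Fin N → Fin N → Bool) (H-sym : ∀ x y → H x y ≡ H y x)
  (R : Sub N) (n L : ℕ) where

  open Host H H-sym

  -- Degrees in R are measured in units of n / L; `slice i` below is the band from i to i + 1 units.
  low : ℕ → Sub N
  low i x = R x ∧ does (L * dg R x ≤? i * n)

  high : ℕ → Sub N
  high i x = R x ∧ not (low i x)

  low⊆ : ∀ i x → low i ∋ x → R ∋ x
  low⊆ i x p = proj₁ (∧-split p)

  high⊆ : ∀ i x → high i ∋ x → R ∋ x
  high⊆ i x p = proj₁ (∧-split p)

  low-deg : ∀ i x → low i ∋ x → L * dg R x ≤ i * n
  low-deg i x p = does-true (L * dg R x ≤? i * n) (proj₂ (∧-split p))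

  high-deg : ∀ i x → high i ∋ x → i * n < L * dg R x
  high-deg i x p = ≰⇒> (λ q → not-true (proj₂ (∧-split {R x} p)) (∧-intro (high⊆ i x p) (true-does (L * dg R x ≤? i * n) q)))

  deg-high : ∀ i x → R ∋ x → i * n < L * dg R x → high i ∋ x
  deg-high i x r p = ∧-intro r (true-not (λ q → <⇒≱ p (low-deg i x q)))

  slice : ℕ → Sub N
  slice i x = low (suc i) x ∧ not (low i x)

  slice⊆low : ∀ i x → slice i ∋ x → low (suc i) ∋ x
  slice⊆low i x p = proj₁ (∧-split p)

  slice-high : ∀ i x → slice i ∋ x → high i ∋ x
  slice-high i x p = ∧-intro (low⊆ (suc i) x (proj₁ (∧-split p))) (proj₂ (∧-split p))

  dg-split : ∀ i x → dg R x ≤ dg (low i) x + dg (high i) x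
  dg-split i x = ≤-trans (sum-mono pt) (≤-reflexive (∑-distrib-+ (λ y → [ low i y ∧ H x y ]) (λ y → [ high i y ∧ H x y ])))
    where
    pt : ∀ y → [ R y ∧ H x y ] ≤ [ low i y ∧ H x y ] + [ high i y ∧ H x y ]
    pt y with R y | does (L * dg R y ≤? i * n) | H x y
    ... | false | _ | _ = z≤n
    ... | true | true | true = ≤-refl
    ... | true | true | false = z≤n
    ... | true | false | true = ≤-refl
    ... | true | false | false = z≤n

  -- The one unit n / L lost here is the source of the summand J in `degree-sum`.
  many-high : ∀ i x b → i * n < L * dg R x → L * dg (low b) x ≤ n → i * n < L * dg (high b) x + n
  many-high i x b p q = begin-strict
    i * n <⟨ p ⟩
    L * dg R x ≤⟨ *-monoʳ-≤ L (dg-split b x) ⟩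
    L * (dg (low b) x + dg (high b) x) ≡⟨ *-distribˡ-+ L (dg (low b) x) _ ⟩
    L * dg (low b) x + L * dg (high b) x ≤⟨ +-monoˡ-≤ _ q ⟩
    n + L * dg (high b) x ≡⟨ +-comm n _ ⟩
    L * dg (high b) x + n ∎
    where open ≤-Reasoning

  few : ∀ S B → L * e S B < count S * n → ∃ λ x → S ∋ x × L * dg B x ≤ n
  few S B h with sum-< {N} {λ x → L * ([ S x ] * dg B x)} {λ x → [ S x ] * n}
    (subst₂ _<_ (sum-scaleˡ L (λ x → [ S x ] * dg B x)) (*-distribʳ-sum n (λ x → [ S x ])) h)
  ... | x , p with S x in eq
  ... | true = x , eq , <⇒≤ (subst₂ _<_ (cong (L *_) (+-identityʳ _)) (+-identityʳ n) p)
  ... | false = ⊥-elim (n≮0 p)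

  dg≤count : ∀ B x → dg B x ≤ count B
  dg≤count B x = count-mono {S = λ y → B y ∧ H x y} {T = B} (λ y p → proj₁ (∧-split p))

  -- T is the top level, τ the number of pairs that a band must carry to be taken as I, τ′ the
  -- number that forces a core. By `τ-big` the pairs below J are negligible against such a band; by
  -- `E-big` and `τ-small` the pairs below I are negligible against all of E and against a
  -- neighbourhood of n / L vertices.
  module Search (T τ τ′ : ℕ) (L>0 : 0 < L) (n>0 : 0 < n) (N≤3n : N ≤ 3 * n)
    (deg≤T : ∀ x → R ∋ x → L * dg R x ≤ T * n)
    (E-big : T * τ * (1 + 3 * L) < e R R)
    (τ-big : 3 * (L * (T * τ′)) ≤ τ)
    (τ-small : L * (L * (T * τ)) ≤ n * n) where

    Tτ<E : T * τ < e R R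
    Tτ<E = ≤-<-trans (≤-trans (≤-reflexive (sym (*-identityʳ (T * τ)))) (*-monoʳ-≤ (T * τ) (s≤s z≤n))) E-big

    low-T : ∀ x → R ∋ x → low T ∋ x
    low-T x p = ∧-intro p (true-does (L * dg R x ≤? T * n) (deg≤T x p))

    -- `lowI` and `sparse` express the minimality of I and J. For J = I nothing is known about pairs
    -- going down to `low J` from `slice I` alone; `lowI` takes over there.
    record Levels : Set where
      field
        I J : ℕ
        I≤J : I ≤ J
        I<T : I < T
        J<T : J < T
        lowI : e (low I) R ≤ I * τ
        sliceI : τ < e (slice I) R
        dense : suc J * τ′ < e (slice I) (low (suc J))
        sparse : J ≡ I ⊎ (I < J × e (slice I) (low J) ≤ J * τ′)

    -- The threshold i τ grows with the level, so the crossing at I leaves more than τ pairs to the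
    -- band `slice I` itself. The search for J starts at I + 1 when J = I fails, which gives I ≤ J.
    levels : Levels
    levels with crossing (λ i → i * τ < e (low i) R) (λ i → i * τ <? e (low i) R) T 0
      (λ p → n≮0 (subst (0 <_) (n≤0⇒n≡0 (≤-trans (e-≤ (low 0) R 0 deg0) (≤-reflexive (*-zeroʳ (count (low 0)))))) p))
      (subst (λ k → k * τ < e (low k) R) (sym (+-identityʳ T)) (<-≤-trans Tτ<E (e-monoˡ R low-T)))
      where
      deg0 : ∀ x → low 0 ∋ x → dg R x ≤ 0
      deg0 x p with dg R x | low-deg 0 x p
      ... | zero | _ = z≤n
      ... | suc k | q = ⊥-elim (<⇒≱ L>0 (≤-trans (≤-trans (m≤m*n L (suc k)) q) z≤n))
    ... | I , _ , I<T′ , ¬pI , pI = finish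
      where
      I<T : I < T
      I<T = subst (I <_) (+-identityʳ T) I<T′
      lowI : e (low I) R ≤ I * τ
      lowI = ≮⇒≥ ¬pI
      sliceI : τ < e (slice I) R
      sliceI = +-cancelʳ-< (I * τ) _ _ (<-≤-trans pI (≤-trans (≤-reflexive (trans (e-split (low (suc I)) R (low I)) (+-comm _ (e (slice I) R))))
        (+-monoʳ-≤ (e (slice I) R) (≤-trans (e-monoˡ R (λ x p → proj₂ (∧-split {low (suc I) x} p))) lowI))))
      Tτ′≤τ : T * τ′ ≤ τ
      Tτ′≤τ = ≤-trans (≤-trans (m≤n*m (T * τ′) L ⦃ >-nonZero L>0 ⦄) (m≤n*m (L * (T * τ′)) 3)) τ-big
      pT : T * τ′ < e (slice I) (low T)
      pT = ≤-<-trans Tτ′≤τ (<-≤-trans sliceI (e-monoʳ (slice I) low-T))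
      finish : Levels
      finish with suc I * τ′ <? e (slice I) (low (suc I))
      ... | yes q = record { I = I ; J = I ; I≤J = ≤-refl ; I<T = I<T ; J<T = I<T ; lowI = lowI ; sliceI = sliceI ; dense = q ; sparse = inj₁ refl }
      ... | no ¬q with crossing (λ j → j * τ′ < e (slice I) (low j)) (λ j → j * τ′ <? e (slice I) (low j)) (T ∸ suc I) (suc I) ¬q (subst (λ k → k * τ′ < e (slice I) (low k)) (sym (m∸n+n≡m I<T)) pT)
      ... | J , I<J , J<T , ¬pJ , pJ = record { I = I ; J = J ; I≤J = <⇒≤ I<J ; I<T = I<T ; J<T = subst (J <_) (m∸n+n≡m I<T) J<T ; lowI = lowI ; sliceI = sliceI ; dense = pJ ; sparse = inj₂ (I<J , ≮⇒≥ ¬pJ) }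

    module _ (lv : Levels) where
      open Levels lv

      lowI≤Tτ : e (low I) R ≤ T * τ
      lowI≤Tτ = ≤-trans lowI (*-monoˡ-≤ τ (<⇒≤ I<T))

      e-≤-N : ∀ S → e S R ≤ count S * (3 * n)
      e-≤-N S = e-≤ S R (3 * n) (λ x _ → ≤-trans (count-≤ (λ y → R y ∧ H x y)) N≤3n)

      -- Otherwise `low J` is all of R. For J = I the populated `slice I` would be empty, and for J
      -- > I the pairs first found at J + 1 would have been found at J.
      J-deg : J * n < L * count R
      J-deg with any? (λ y → high J y Bool.≟ true)
      ... | yes (y , p) = <-≤-trans (high-deg J y p) (*-monoʳ-≤ L (dg≤count R y))
      ... | no none = ⊥-elim (contra sparse)
        where
        all-low : ∀ x → R ∋ x → low J ∋ x
        all-low x r with low J x in eq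
        ... | true = refl
        ... | false = ⊥-elim (none (x , ∧-intro r (cong not eq)))
        contra : J ≡ I ⊎ (I < J × e (slice I) (low J) ≤ J * τ′) → ⊥
        contra (inj₂ (_ , s)) = <⇒≱ dense (≤-trans (e-monoʳ (slice I) (λ x p → all-low x (low⊆ (suc J) x p))) (≤-trans s (*-monoˡ-≤ τ′ (n≤1+n J))))
        contra (inj₁ refl) = <⇒≱ sliceI (≤-trans (sum-mono zeros) (≤-trans (≤-reflexive (sum-0 N)) z≤n))
          where
          zeros : ∀ x → [ slice I x ] * dg R x ≤ 0
          zeros x with slice I x in eq
          ... | false = z≤n
          ... | true = ⊥-elim (none (x , slice-high I x eq))

      -- Every vertex of `high I` contributes I units to the degree sum, and those of `high J`
      -- contribute J - I further ones.
      edge-count : ∀ K → J ≡ I + K → (count (high I) * (I * n) + count (high J) * (K * n)) ≤ L * e R R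
      edge-count K refl = subst₂ _≤_
        (trans (∑-distrib-+ (λ x → [ high I x ] * (I * n)) (λ x → [ high J x ] * (K * n)))
          (cong₂ _+_ (sym (*-distribʳ-sum (I * n) (λ x → [ high I x ]))) (sym (*-distribʳ-sum (K * n) (λ x → [ high J x ])))))
        (sym (sum-scaleˡ L (λ x → [ R x ] * dg R x))) (sum-mono pt)
        where
        scale : ∀ x → R ∋ x → L * dg R x ≡ L * ([ R x ] * dg R x)
        scale x h = cong (L *_) (trans (sym (+-identityʳ _)) (cong (λ b → [ b ] * dg R x) (sym h)))
        pt : ∀ x → [ high I x ] * (I * n) + [ high (I + K) x ] * (K * n) ≤ L * ([ R x ] * dg R x)
        pt x with high I x in hI | high (I + K) x in hJ
        ... | false | false = z≤n
        ... | false | true = ⊥-elim (not-true (cong not hI) (deg-high I x (high⊆ (I + K) x hJ) (≤-<-trans (*-monoˡ-≤ n (m≤m+n I K)) (high-deg (I + K) x hJ))))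
        ... | true | false = ≤-trans (≤-reflexive (trans (+-identityʳ _) (+-identityʳ _))) (≤-trans (<⇒≤ (high-deg I x hI)) (≤-reflexive (scale x (high⊆ I x hI))))
        ... | true | true = ≤-trans (≤-reflexive (trans (cong₂ _+_ (+-identityʳ (I * n)) (+-identityʳ (K * n))) (sym (*-distribʳ-+ n I K)))) (≤-trans (<⇒≤ (high-deg (I + K) x hJ)) (≤-reflexive (scale x (high⊆ I x hI))))

      -- With b and c at least J - 1 and I - 1 units, this is (J - 1) I + (I - 1) (J - I) = 2 I J -
      -- I² - J.
      combine : ∀ K b c → J ≡ I + K → b * (I * n) + c * (K * n) ≤ L * e R R → J * n ≤ L * b + n → I * n ≤ L * c + n →
        n * n * (2 * (I * J)) ≤ L * L * e R R + n * n * (I * I + J)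
      combine K b c refl h hb hc = +-cancelʳ-≤ (n * n * (I * K)) _ _ (begin
        n * n * (2 * (I * (I + K))) + n * n * (I * K) ≡⟨ id₁ n I K ⟩
        (I + K) * n * (I * n) + I * n * (K * n) + n * n * (I * I + I * K) ≤⟨ +-monoˡ-≤ _ (+-mono-≤ (*-monoˡ-≤ (I * n) hb) (*-monoˡ-≤ (K * n) hc)) ⟩
        (L * b + n) * (I * n) + (L * c + n) * (K * n) + n * n * (I * I + I * K) ≡⟨ id₂ n I K L b c ⟩
        L * (b * (I * n) + c * (K * n)) + (n * n * (I * I + (I + K)) + n * n * (I * K)) ≤⟨ +-monoˡ-≤ _ (*-monoʳ-≤ L h) ⟩
        L * (L * e R R) + (n * n * (I * I + (I + K)) + n * n * (I * K)) ≡⟨ cong (_+ (n * n * (I * I + (I + K)) + n * n * (I * K))) (sym (*-assoc L L (e R R))) ⟩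
        L * L * e R R + (n * n * (I * I + (I + K)) + n * n * (I * K)) ≡⟨ sym (+-assoc (L * L * e R R) _ _) ⟩
        L * L * e R R + n * n * (I * I + (I + K)) + n * n * (I * K) ∎)
        where
        open ≤-Reasoning
        id₁ : ∀ n I K → n * n * (2 * (I * (I + K))) + n * n * (I * K) ≡ (I + K) * n * (I * n) + I * n * (K * n) + n * n * (I * I + I * K)
        id₁ = solve-∀
        id₂ : ∀ n I K L b c → (L * b + n) * (I * n) + (L * c + n) * (K * n) + n * n * (I * I + I * K) ≡ L * (b * (I * n) + c * (K * n)) + (n * n * (I * I + (I + K)) + n * n * (I * K))
        id₂ = solve-∀

      -- If every edge xy of a graph has d(x) + d(y) ≥ s, then a vertex x of least degree δ has δ neighbours of degree
      -- at least s - δ, and each of those has s - δ neighbours of degree at least δ, so the degree sum is at least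
      -- δ (s - δ) + (s - 2 δ) δ.  Here δ and s - δ are I n / L and J n / L up to a rounding of n / L.
      degree-sum : 2 ≤ I → n * n * (2 * (I * J)) ≤ L * L * e R R + n * n * (I * I + J)
      degree-sum 2≤I = go sparse
        where
        open ≤-Reasoning
        sym-bound : ∀ S → (∀ x → S ∋ x → R ∋ x) → e S (low I) ≤ T * τ
        sym-bound S S⊆ = ≤-trans (≤-reflexive (e-sym S (low I))) (≤-trans (e-monoʳ (low I) S⊆) lowI≤Tτ)
        go : J ≡ I ⊎ (I < J × e (slice I) (low J) ≤ J * τ′) → n * n * (2 * (I * J)) ≤ L * L * e R R + n * n * (I * I + J)
        -- For J = I the factor J - I vanishes, and one vertex of `high I` with few neighbours in
        -- `low I` suffices.
        go (inj₁ refl) with few (high I) (low I) (≤-<-trans (*-monoʳ-≤ L (sym-bound (high I) (high⊆ I))) (*-cancelˡ-< 3 _ _ bigB))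
          where
          bigB : 3 * (L * (T * τ)) < 3 * (count (high I) * n)
          bigB = +-cancelˡ-< (T * τ) _ _ (begin-strict
            T * τ + 3 * (L * (T * τ)) ≡⟨ id₃ (T * τ) L ⟩
            T * τ * (1 + 3 * L) <⟨ E-big ⟩
            e R R ≡⟨ e-split R R (low I) ⟩
            e (λ x → R x ∧ low I x) R + e (high I) R ≤⟨ +-mono-≤ (≤-trans (e-monoˡ R (λ x p → proj₂ (∧-split {R x} p))) lowI≤Tτ) (e-≤-N (high I)) ⟩
            T * τ + count (high I) * (3 * n) ≡⟨ cong (T * τ +_) (id₄ (count (high I)) n) ⟩
            T * τ + 3 * (count (high I) * n) ∎)
            where
            id₃ : ∀ a L → a + 3 * (L * a) ≡ a * (1 + 3 * L)
            id₃ = solve-∀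
            id₄ : ∀ c n → c * (3 * n) ≡ 3 * (c * n)
            id₄ = solve-∀
        ... | y , yB , yf = combine 0 (count (high I)) (count (high I)) (sym (+-identityʳ I)) (edge-count 0 (sym (+-identityʳ I))) big big
          where
          big : I * n ≤ L * count (high I) + n
          big = <⇒≤ (<-≤-trans (many-high I y I (high-deg I y yB) yf) (+-monoˡ-≤ n (*-monoʳ-≤ L (dg≤count (high I) y))))
        go (inj₂ (I<J , sp)) with few (slice I) (low J) (≤-<-trans (*-monoʳ-≤ L (≤-trans sp (*-monoˡ-≤ τ′ (<⇒≤ J<T)))) bigA)
          where
          bigA : L * (T * τ′) < count (slice I) * n
          bigA = *-cancelˡ-< 3 _ _ (≤-<-trans τ-big (<-≤-trans sliceI (≤-trans (e-≤-N (slice I)) (≤-reflexive (id₄ (count (slice I)) n)))))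
            where
            id₄ : ∀ c n → c * (3 * n) ≡ 3 * (c * n)
            id₄ = solve-∀
        -- The second vertex is sought among the neighbours of x in `high J`. By 2 ≤ I there are
        -- more than n / L of them, enough to outweigh all pairs at `low I`.
        ... | x , xA , xf with few (λ y → high J y ∧ H x y) (low I) (≤-<-trans (*-monoʳ-≤ L (sym-bound _ (λ y p → high⊆ J y (proj₁ (∧-split p))))) (*-cancelˡ-< L _ _ bigS))
          where
          bigS : L * (L * (T * τ)) < L * (dg (high J) x * n)
          bigS = ≤-<-trans τ-small (subst (n * n <_) (*-assoc L (dg (high J) x) n) (*-monoˡ-< n ⦃ >-nonZero n>0 ⦄
            (+-cancelʳ-< n n _ (≤-<-trans (≤-trans (≤-reflexive (cong (n +_) (sym (+-identityʳ n)))) (*-monoˡ-≤ n 2≤I)) (many-high I x J (high-deg I x (slice-high I x xA)) xf)))))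
        ... | y , yC , yf = combine (J ∸ I) (count (high I)) (count (high J)) (sym (m+[n∸m]≡n (<⇒≤ I<J))) (edge-count (J ∸ I) (sym (m+[n∸m]≡n (<⇒≤ I<J))))
          (<⇒≤ (<-≤-trans (many-high J y I (high-deg J y (proj₁ (∧-split yC))) yf) (+-monoˡ-≤ n (*-monoʳ-≤ L (dg≤count (high I) y)))))
          (<⇒≤ (<-≤-trans (many-high I x J (high-deg I x (slice-high I x xA)) xf) (+-monoˡ-≤ n (*-monoʳ-≤ L (dg≤count (high J) x)))))

-- Numerical inequalities

cancel : ∀ {x y} c → c * x ≤ c * y → 0 < c → x ≤ y
cancel c h c>0 = *-cancelˡ-≤ c ⦃ >-nonZero c>0 ⦄ h

square-diff : ∀ p s t → p + s ≡ t → p * p + 2 * (s * t) ≡ t * t + s * s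
square-diff p s _ refl = go p s
  where
  go : ∀ p s → p * p + 2 * (s * (p + s)) ≡ (p + s) * (p + s) + s * s
  go = solve-∀

-- This is (p - u) (v - p) ≥ 0.
between : ∀ {u p v} → u ≤ p → p ≤ v → p * p + u * v ≤ p * (u + v)
between {u} {p} {v} h k with m≤n⇒∃[o]m+o≡n h | m≤n⇒∃[o]m+o≡n k
... | c , refl | d , refl = ≤-trans (m≤m+n _ (c * d)) (≤-reflexive (go u c d))
  where
  go : ∀ u c d → (u + c) * (u + c) + u * (u + c + d) + c * d ≡ (u + c) * (u + (u + c + d))
  go = solve-∀

-- The right side increases with r, so r = (a / b) n decides. The coefficients stay variables: the
-- identities hold for all of them, and only a comparison of literals depends on their values.
quad-low : ∀ a b α β γ r n → 0 < b → b * b * γ ≤ a * (a * α + b * β) → a * n ≤ b * r → γ * (n * n) ≤ α * (r * r) + β * (r * n)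
quad-low a b α β γ r n b>0 h k = cancel (b * b) (begin
  b * b * (γ * (n * n)) ≡⟨ sym (*-assoc (b * b) γ (n * n)) ⟩
  b * b * γ * (n * n) ≤⟨ *-monoˡ-≤ (n * n) h ⟩
  a * (a * α + b * β) * (n * n) ≡⟨ id₁ α β n a b ⟩
  α * ((a * n) * (a * n)) + β * ((a * n) * (b * n)) ≤⟨ +-mono-≤ (*-monoʳ-≤ α (*-mono-≤ k k)) (*-monoʳ-≤ β (*-monoˡ-≤ (b * n) k)) ⟩
  α * ((b * r) * (b * r)) + β * ((b * r) * (b * n)) ≡⟨ id₂ α β r n b ⟩
  b * b * (α * (r * r) + β * (r * n)) ∎) (*-mono-≤ b>0 b>0)
  where
  open ≤-Reasoning
  id₁ : ∀ α β n c d → c * (c * α + d * β) * (n * n) ≡ α * ((c * n) * (c * n)) + β * ((c * n) * (d * n))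
  id₁ = solve-∀
  id₂ : ∀ α β r n d → α * ((d * r) * (d * r)) + β * ((d * r) * (d * n)) ≡ d * d * (α * (r * r) + β * (r * n))
  id₂ = solve-∀

-- From r ≤ 2.001 n follows α r - β n ≤ (δ / 1000) n, and then the remaining factor r is bounded in
-- the same way.
quad-high : ∀ α β γ δ r n → α * 2001 ≡ 1000 * β + δ → δ * 2001 ≤ 1000 * 1000 * γ → 1000 * r ≤ 2001 * n →
  α * (r * r) ≤ β * (r * n) + γ * (n * n)
quad-high α β γ δ r n hα hδ k = cancel (1000 * 1000) (begin
  1000 * 1000 * (α * (r * r)) ≡⟨ id₁ α r 1000 ⟩
  1000 * (α * r * (1000 * r)) ≤⟨ *-monoʳ-≤ 1000 (*-monoʳ-≤ (α * r) k) ⟩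
  1000 * (α * r * (2001 * n)) ≡⟨ id₂ α r n 1000 2001 ⟩
  1000 * (α * 2001 * (r * n)) ≡⟨ cong (λ z → 1000 * (z * (r * n))) hα ⟩
  1000 * ((1000 * β + δ) * (r * n)) ≡⟨ id₃ β δ r n 1000 ⟩
  1000 * 1000 * (β * (r * n)) + δ * (1000 * r) * n ≤⟨ +-monoʳ-≤ (1000 * 1000 * (β * (r * n))) (*-monoˡ-≤ n (*-monoʳ-≤ δ k)) ⟩
  1000 * 1000 * (β * (r * n)) + δ * (2001 * n) * n ≡⟨ cong (1000 * 1000 * (β * (r * n)) +_) (id₄ δ n 2001) ⟩
  1000 * 1000 * (β * (r * n)) + δ * 2001 * (n * n) ≤⟨ +-monoʳ-≤ (1000 * 1000 * (β * (r * n))) (*-monoˡ-≤ (n * n) hδ) ⟩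
  1000 * 1000 * (β * (r * n)) + 1000 * 1000 * γ * (n * n) ≡⟨ id₅ (1000 * 1000) (β * (r * n)) γ (n * n) ⟩
  1000 * 1000 * (β * (r * n) + γ * (n * n)) ∎) (s≤s z≤n)
  where
  open ≤-Reasoning
  id₁ : ∀ α r c → c * c * (α * (r * r)) ≡ c * (α * r * (c * r))
  id₁ = solve-∀
  id₂ : ∀ α r n c d → c * (α * r * (d * n)) ≡ c * (α * d * (r * n))
  id₂ = solve-∀
  id₃ : ∀ β δ r n c → c * ((c * β + δ) * (r * n)) ≡ c * c * (β * (r * n)) + δ * (c * r) * n
  id₃ = solve-∀
  id₄ : ∀ δ n d → δ * (d * n) * n ≡ δ * d * (n * n)
  id₄ = solve-∀
  id₅ : ∀ c x γ y → c * x + c * γ * y ≡ c * (x + γ * y)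
  id₅ = solve-∀

-- Expanding p = a r - b n and comparing coefficients leaves the inequality in α, β, γ; `x-product`
-- does the same for the product (a₀ r - b n) (w₁ r + b n).
p-square : ∀ {a b A B C α β γ r n p} → p + b * n ≡ a * r → A ≡ a * a + α → B ≡ 2 * (a * b) + β → γ ≡ b * b + C →
  α * (r * r) ≤ β * (r * n) + γ * (n * n) → A * (r * r) ≤ p * p + (B * (r * n) + C * (n * n))
p-square {a} {b} {_} {_} {C} {α} {β} {_} {r} {n} {p} hp refl refl refl h = +-cancelʳ-≤ (2 * (b * n * (a * r))) _ _ (begin
  (a * a + α) * (r * r) + 2 * (b * n * (a * r)) ≡⟨ id₁ a b α r n ⟩
  α * (r * r) + (a * a * (r * r) + 2 * (b * n * (a * r))) ≤⟨ +-monoˡ-≤ _ h ⟩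
  β * (r * n) + (b * b + C) * (n * n) + (a * a * (r * r) + 2 * (b * n * (a * r))) ≡⟨ id₂ a b β C r n ⟩
  (a * r * (a * r) + b * n * (b * n)) + ((2 * (a * b) + β) * (r * n) + C * (n * n)) ≡⟨ cong (_+ ((2 * (a * b) + β) * (r * n) + C * (n * n))) (sym (square-diff p (b * n) (a * r) hp)) ⟩
  p * p + 2 * (b * n * (a * r)) + ((2 * (a * b) + β) * (r * n) + C * (n * n)) ≡⟨ id₃ (p * p) (2 * (b * n * (a * r))) ((2 * (a * b) + β) * (r * n) + C * (n * n)) ⟩
  p * p + ((2 * (a * b) + β) * (r * n) + C * (n * n)) + 2 * (b * n * (a * r)) ∎)
  where
  open ≤-Reasoning
  id₁ : ∀ a b α r n → (a * a + α) * (r * r) + 2 * (b * n * (a * r)) ≡ α * (r * r) + (a * a * (r * r) + 2 * (b * n * (a * r)))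
  id₁ = solve-∀
  id₂ : ∀ a b β C r n → β * (r * n) + (b * b + C) * (n * n) + (a * a * (r * r) + 2 * (b * n * (a * r))) ≡ (a * r * (a * r) + b * n * (b * n)) + ((2 * (a * b) + β) * (r * n) + C * (n * n))
  id₂ = solve-∀
  id₃ : ∀ x y z → x + y + z ≡ x + z + y
  id₃ = solve-∀

x-product : ∀ {a₀ b w₁ F K₁ K₀ α β γ r n x₀} → x₀ + b * n ≡ a₀ * r → F + α ≡ a₀ * w₁ → a₀ * b + K₁ ≡ b * w₁ + β → b * b ≡ γ + K₀ →
  γ * (n * n) ≤ α * (r * r) + β * (r * n) → F * (r * r) ≤ x₀ * (w₁ * r + b * n) + (K₁ * (r * n) + K₀ * (n * n))
x-product {a₀} {b} {w₁} {F} {K₁} {K₀} {α} {β} {γ} {r} {n} {x₀} hx h₁ h₂ h₃ h = +-cancelʳ-≤ (b * n * (w₁ * r + b * n)) _ _ (begin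
  F * (r * r) + b * n * (w₁ * r + b * n) ≡⟨ id₁ F b w₁ r n ⟩
  F * (r * r) + b * w₁ * (r * n) + b * b * (n * n) ≡⟨ cong (λ z → F * (r * r) + b * w₁ * (r * n) + z * (n * n)) h₃ ⟩
  F * (r * r) + b * w₁ * (r * n) + (γ + K₀) * (n * n) ≡⟨ id₂ (F * (r * r) + b * w₁ * (r * n)) γ K₀ (n * n) ⟩
  F * (r * r) + b * w₁ * (r * n) + K₀ * (n * n) + γ * (n * n) ≤⟨ +-monoʳ-≤ (F * (r * r) + b * w₁ * (r * n) + K₀ * (n * n)) h ⟩
  F * (r * r) + b * w₁ * (r * n) + K₀ * (n * n) + (α * (r * r) + β * (r * n)) ≡⟨ id₃ F α (b * w₁) β K₀ (r * r) (r * n) (n * n) ⟩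
  (F + α) * (r * r) + (b * w₁ + β) * (r * n) + K₀ * (n * n) ≡⟨ cong₂ (λ y z → y * (r * r) + z * (r * n) + K₀ * (n * n)) h₁ (sym h₂) ⟩
  a₀ * w₁ * (r * r) + (a₀ * b + K₁) * (r * n) + K₀ * (n * n) ≡⟨ id₄ a₀ w₁ b K₁ K₀ r n ⟩
  a₀ * r * (w₁ * r + b * n) + (K₁ * (r * n) + K₀ * (n * n)) ≡⟨ cong (λ z → z * (w₁ * r + b * n) + (K₁ * (r * n) + K₀ * (n * n))) (sym hx) ⟩
  (x₀ + b * n) * (w₁ * r + b * n) + (K₁ * (r * n) + K₀ * (n * n)) ≡⟨ id₅ x₀ (b * n) (w₁ * r + b * n) (K₁ * (r * n) + K₀ * (n * n)) ⟩
  x₀ * (w₁ * r + b * n) + (K₁ * (r * n) + K₀ * (n * n)) + b * n * (w₁ * r + b * n) ∎)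
  where
  open ≤-Reasoning
  id₁ : ∀ F b w r n → F * (r * r) + b * n * (w * r + b * n) ≡ F * (r * r) + b * w * (r * n) + b * b * (n * n)
  id₁ = solve-∀
  id₂ : ∀ x γ k y → x + (γ + k) * y ≡ x + k * y + γ * y
  id₂ = solve-∀
  id₃ : ∀ F α c β k x y z → F * x + c * y + k * z + (α * x + β * y) ≡ (F + α) * x + (c + β) * y + k * z
  id₃ = solve-∀
  id₄ : ∀ a w b k₁ k₀ r n → a * w * (r * r) + (a * b + k₁) * (r * n) + k₀ * (n * n) ≡ a * r * (w * r + b * n) + (k₁ * (r * n) + k₀ * (n * n))
  id₄ = solve-∀
  id₅ : ∀ x y w k → (x + y) * w + k ≡ x * w + k + y * w
  id₅ = solve-∀

-- 2 X Y - X² is at least min (p² / 4) (x₀ w), its values at X = p / 2 and at X = x₀; for X in between it is a concave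
-- function of X once Y is replaced by p - X.
minimise : ∀ {X Y p Y₁ x₀ w F K} → X ≤ Y → p ≤ X + Y → Y ≤ Y₁ → x₀ + Y₁ ≡ p → 2 * p ≡ 3 * x₀ + w →
  4 * F ≤ p * p + 4 * K → F ≤ x₀ * w + K → F + X * X ≤ 2 * (X * Y) + K
minimise {X} {Y} {p} {Y₁} {x₀} {w} {F} {K} XY pXY YY₁ hx hw hS hT with p ≤? 2 * X | p ≤? 6 * X
... | yes a | _ = cancel 4 (begin
  4 * (F + X * X) ≡⟨ *-distribˡ-+ 4 F (X * X) ⟩
  4 * F + 4 * (X * X) ≤⟨ +-monoˡ-≤ _ hS ⟩
  p * p + 4 * K + 4 * (X * X) ≤⟨ +-monoˡ-≤ (4 * (X * X)) (+-monoˡ-≤ (4 * K) (*-mono-≤ a a)) ⟩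
  2 * X * (2 * X) + 4 * K + 4 * (X * X) ≡⟨ id₁ X K ⟩
  8 * (X * X) + 4 * K ≤⟨ +-monoˡ-≤ (4 * K) (*-monoʳ-≤ 8 (*-monoʳ-≤ X XY)) ⟩
  8 * (X * Y) + 4 * K ≡⟨ id₂ (X * Y) K ⟩
  4 * (2 * (X * Y) + K) ∎) (s≤s z≤n)
  where
  open ≤-Reasoning
  id₁ : ∀ X K → 2 * X * (2 * X) + 4 * K + 4 * (X * X) ≡ 8 * (X * X) + 4 * K
  id₁ = solve-∀
  id₂ : ∀ x K → 8 * x + 4 * K ≡ 4 * (2 * x + K)
  id₂ = solve-∀
-- The concave function 2 p X - 3 X² equals p² / 4 both at X = p / 6 and at X = p / 2. Below p / 6
-- it increases, so the last case compares with x₀.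
... | no a | yes b = cancel 4 (+-cancelʳ-≤ (8 * (X * X)) _ _ (begin
  4 * (F + X * X) + 8 * (X * X) ≡⟨ id₁ F X ⟩
  4 * F + 12 * (X * X) ≤⟨ +-monoˡ-≤ _ hS ⟩
  p * p + 4 * K + 12 * (X * X) ≡⟨ id₂ p X K ⟩
  p * p + 2 * X * (6 * X) + 4 * K ≤⟨ +-monoˡ-≤ (4 * K) (between (<⇒≤ (≰⇒> a)) b) ⟩
  p * (2 * X + 6 * X) + 4 * K ≤⟨ +-monoˡ-≤ (4 * K) (*-monoˡ-≤ (2 * X + 6 * X) pXY) ⟩
  (X + Y) * (2 * X + 6 * X) + 4 * K ≡⟨ id₃ X Y K ⟩
  4 * (2 * (X * Y) + K) + 8 * (X * X) ∎)) (s≤s z≤n)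
  where
  open ≤-Reasoning
  id₁ : ∀ F X → 4 * (F + X * X) + 8 * (X * X) ≡ 4 * F + 12 * (X * X)
  id₁ = solve-∀
  id₂ : ∀ p X K → p * p + 4 * K + 12 * (X * X) ≡ p * p + 2 * X * (6 * X) + 4 * K
  id₂ = solve-∀
  id₃ : ∀ X Y K → (X + Y) * (2 * X + 6 * X) + 4 * K ≡ 4 * (2 * (X * Y) + K) + 8 * (X * X)
  id₃ = solve-∀
... | no a | no b with m≤n⇒∃[o]m+o≡n (+-cancelʳ-≤ Y₁ x₀ X (≤-trans (≤-reflexive hx) (≤-trans pXY (+-monoʳ-≤ X YY₁))))
... | c , refl = +-cancelʳ-≤ (2 * (x₀ + c) * (x₀ + c)) _ _ (begin
  F + (x₀ + c) * (x₀ + c) + 2 * (x₀ + c) * (x₀ + c) ≤⟨ +-monoˡ-≤ (2 * (x₀ + c) * (x₀ + c)) (+-monoˡ-≤ ((x₀ + c) * (x₀ + c)) hT) ⟩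
  x₀ * w + K + (x₀ + c) * (x₀ + c) + 2 * (x₀ + c) * (x₀ + c) ≡⟨ id₁ x₀ w K c ⟩
  x₀ * (3 * x₀ + w) + c * (3 * x₀ + 3 * (x₀ + c)) + K ≡⟨ cong (λ z → x₀ * z + c * (3 * x₀ + 3 * (x₀ + c)) + K) (sym hw) ⟩
  x₀ * (2 * p) + c * (3 * x₀ + 3 * (x₀ + c)) + K ≤⟨ +-monoˡ-≤ K (+-monoʳ-≤ (x₀ * (2 * p)) (*-monoʳ-≤ c below)) ⟩
  x₀ * (2 * p) + c * (2 * p) + K ≡⟨ id₂ x₀ c p K ⟩
  2 * (x₀ + c) * p + K ≤⟨ +-monoˡ-≤ K (*-monoʳ-≤ (2 * (x₀ + c)) pXY) ⟩
  2 * (x₀ + c) * (x₀ + c + Y) + K ≡⟨ id₃ (x₀ + c) Y K ⟩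
  2 * ((x₀ + c) * Y) + K + 2 * (x₀ + c) * (x₀ + c) ∎)
  where
  open ≤-Reasoning
  id₁ : ∀ x w K c → x * w + K + (x + c) * (x + c) + 2 * (x + c) * (x + c) ≡ x * (3 * x + w) + c * (3 * x + 3 * (x + c)) + K
  id₁ = solve-∀
  id₂ : ∀ x c p K → x * (2 * p) + c * (2 * p) + K ≡ 2 * (x + c) * p + K
  id₂ = solve-∀
  id₃ : ∀ x Y K → 2 * x * (x + Y) + K ≡ 2 * (x * Y) + K + 2 * x * x
  id₃ = solve-∀
  below : 3 * x₀ + 3 * (x₀ + c) ≤ 2 * p
  below = ≤-trans (+-monoˡ-≤ (3 * (x₀ + c)) (*-monoʳ-≤ 3 (m≤m+n x₀ c))) (≤-trans (≤-reflexive (six (x₀ + c))) (≤-trans (<⇒≤ (≰⇒> b)) (m≤n*m p 2)))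
    where
    six : ∀ x → 3 * x + 3 * x ≡ 6 * x
    six = solve-∀

num : ∀ {u v} {_ : (u ≤ᵇ v) ≡ true} → u ≤ v
num {u} {v} {h} = ≤ᵇ⇒≤ u v (subst T (sym h) tt)

num* : ∀ u v c → (u ≤ᵇ v) ≡ true → u * c ≤ v * c
num* u v c h = *-monoˡ-≤ c (num {u} {v} {h})

scale-≡ : ∀ u v c → u ≡ v → u * c ≡ v * c
scale-≡ u v c refl = refl

-- `big` is the failure of the light case: (I + J + 2) n / 10000 exceeds g′(r) - 0.89 M, where g′(r)
-- = 1.78 r - 0.74 n. The conclusion `heavy` is E ≥ g(r) + 6 M n, the surplus being the most that
-- one piece can cost.
module Heavy (n r M I J E : ℕ) (n>0 : 0 < n) (r-low : 98 * n ≤ 100 * r) (r-high : 1000 * r ≤ 2001 * n)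
  (M-small : 1000000 * M ≤ n) (I≤J : I ≤ J) (J-deg : J * n < 10000 * r)
  (big : 10000 * (178 * r) < 100 * ((2 + I + J) * n) + 10000 * (74 * n + 89 * M))
  (degree-sum : 2 ≤ I → n * n * (2 * (I * J)) ≤ 10000 * 10000 * E + n * n * (I * I + J)) where

  private
    X = I * n
    Y = J * n

    lin : ∀ u v → 100 * u ≤ v * 98 → u * n ≤ v * r
    lin u v h = cancel 100 (begin
      100 * (u * n) ≡⟨ sym (*-assoc 100 u n) ⟩
      100 * u * n ≤⟨ *-monoˡ-≤ n h ⟩
      v * 98 * n ≡⟨ *-assoc v 98 n ⟩
      v * (98 * n) ≤⟨ *-monoʳ-≤ v r-low ⟩
      v * (100 * r) ≡⟨ id₁ v 100 r ⟩
      100 * (v * r) ∎) (s≤s z≤n)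
      where
      open ≤-Reasoning
      id₁ : ∀ v c r → v * (c * r) ≡ c * (v * r)
      id₁ = solve-∀

    -- 7403 consists of 7400 for 0.74 n, 2 for rounding both levels up, and less than 1 for the term
    -- in M.
    XY-low : 17800 * r ≤ X + Y + 7403 * n
    XY-low = cancel 100 (begin
      100 * (17800 * r) ≡⟨ sym (*-assoc 100 17800 r) ⟩
      100 * 17800 * r ≡⟨ scale-≡ (100 * 17800) (10000 * 178) r c₁ ⟩
      10000 * 178 * r ≡⟨ *-assoc 10000 178 r ⟩
      10000 * (178 * r) ≤⟨ <⇒≤ big ⟩
      100 * ((2 + I + J) * n) + 10000 * (74 * n + 89 * M) ≡⟨ id₁ 100 10000 74 89 n I J M ⟩
      100 * (X + Y) + (2 * 100 + 10000 * 74) * n + 10000 * 89 * M ≤⟨ +-monoʳ-≤ (100 * (X + Y) + (2 * 100 + 10000 * 74) * n) (≤-trans (num* (10000 * 89) 1000000 M refl) M-small) ⟩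
      100 * (X + Y) + (2 * 100 + 10000 * 74) * n + n ≡⟨ id₂ (100 * (X + Y)) (2 * 100 + 10000 * 74) n ⟩
      100 * (X + Y) + (1 + (2 * 100 + 10000 * 74)) * n ≤⟨ +-monoʳ-≤ (100 * (X + Y)) (num* (1 + (2 * 100 + 10000 * 74)) (100 * 7403) n refl) ⟩
      100 * (X + Y) + 100 * 7403 * n ≡⟨ id₃ 100 (X + Y) 7403 n ⟩
      100 * (X + Y + 7403 * n) ∎) (s≤s z≤n)
      where
      open ≤-Reasoning
      c₁ : 100 * 17800 ≡ 10000 * 178
      c₁ = refl
      id₁ : ∀ c d e f n I J M → c * ((2 + I + J) * n) + d * (e * n + f * M) ≡ c * (I * n + J * n) + (2 * c + d * e) * n + d * f * M
      id₁ = solve-∀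
      id₂ : ∀ x c n → x + c * n + n ≡ x + (1 + c) * n
      id₂ = solve-∀
      id₃ : ∀ c x d n → c * x + c * d * n ≡ c * (x + d * n)
      id₃ = solve-∀

    X-low : 7800 * r ≤ X + 7403 * n
    X-low = +-cancelʳ-≤ (10000 * r) _ _ (begin
      7800 * r + 10000 * r ≡⟨ sym (*-distribʳ-+ r 7800 10000) ⟩
      17800 * r ≤⟨ XY-low ⟩
      X + Y + 7403 * n ≤⟨ +-monoˡ-≤ (7403 * n) (+-monoʳ-≤ X (<⇒≤ J-deg)) ⟩
      X + 10000 * r + 7403 * n ≡⟨ id₁ X (10000 * r) (7403 * n) ⟩
      X + 7403 * n + 10000 * r ∎)
      where
      open ≤-Reasoning
      id₁ : ∀ x y z → x + y + z ≡ x + z + y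
      id₁ = solve-∀

  -- 7800 r is at least 7644 n when r is at least 0.98 n, and 7644 - 7403 = 241.
  2≤I : 2 ≤ I
  2≤I = *-cancelʳ-≤ 2 I n ⦃ >-nonZero n>0 ⦄ (≤-trans (num* 2 241 n refl) (+-cancelʳ-≤ (7403 * n) _ _
    (≤-trans (≤-reflexive (sym (*-distribʳ-+ n 241 7403))) (≤-trans (lin 7644 7800 (num {764400} {7800 * 98} {refl})) X-low))))

  private
    -- p bounds X + Y from below, x₀ bounds X because Y is below 10000 r, and w = 2 p - 3 x₀. F - K
    -- is 10^8 g(r), except that both coefficients of K are smaller by 10000: one pays for the
    -- rounding loss in `degree-sum`, the other for the surplus.
    p x₀ w F K : ℕ
    p = 17800 * r ∸ 7403 * n
    x₀ = 7800 * r ∸ 7403 * n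
    w = 12200 * r + 7403 * n
    F = 89000000 * (r * r)
    K = 73990000 * (r * n) + 9990000 * (n * n)

    p-eq : p + 7403 * n ≡ 17800 * r
    p-eq = m∸n+n≡m (lin 7403 17800 (num {740300} {17800 * 98} {refl}))

    x₀-eq : x₀ + 7403 * n ≡ 7800 * r
    x₀-eq = m∸n+n≡m (lin 7403 7800 (num {740300} {7800 * 98} {refl}))

    x₀-p : x₀ + 10000 * r ≡ p
    x₀-p = +-cancelʳ-≡ (7403 * n) _ _ (begin
      x₀ + 10000 * r + 7403 * n ≡⟨ id₁ x₀ (10000 * r) (7403 * n) ⟩
      x₀ + 7403 * n + 10000 * r ≡⟨ cong (_+ 10000 * r) x₀-eq ⟩
      7800 * r + 10000 * r ≡⟨ sym (*-distribʳ-+ r 7800 10000) ⟩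
      17800 * r ≡⟨ sym p-eq ⟩
      p + 7403 * n ∎)
      where
      open ≡-Reasoning
      id₁ : ∀ x y z → x + y + z ≡ x + z + y
      id₁ = solve-∀

    w-eq : 2 * p ≡ 3 * x₀ + w
    w-eq = begin
      2 * p ≡⟨ cong (2 *_) (sym x₀-p) ⟩
      2 * (x₀ + 10000 * r) ≡⟨ id₁ x₀ 10000 r ⟩
      2 * x₀ + 2 * 10000 * r ≡⟨ cong (λ z → 2 * x₀ + z * r) c₁ ⟩
      2 * x₀ + (7800 + 12200) * r ≡⟨ id₂ x₀ 7800 12200 r ⟩
      2 * x₀ + (7800 * r + 12200 * r) ≡⟨ cong (λ z → 2 * x₀ + (z + 12200 * r)) (sym x₀-eq) ⟩
      2 * x₀ + (x₀ + 7403 * n + 12200 * r) ≡⟨ id₃ x₀ (7403 * n) (12200 * r) ⟩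
      3 * x₀ + w ∎
      where
      open ≡-Reasoning
      c₁ : 2 * 10000 ≡ 7800 + 12200
      c₁ = refl
      id₁ : ∀ x c r → 2 * (x + c * r) ≡ 2 * x + 2 * c * r
      id₁ = solve-∀
      id₂ : ∀ x c d r → 2 * x + (c + d) * r ≡ 2 * x + (c * r + d * r)
      id₂ = solve-∀
      id₃ : ∀ x y z → 2 * x + (x + y + z) ≡ 3 * x + (z + y)
      id₃ = solve-∀

    -- Essentially g(r) ≤ λ², tightest at the largest r. The constants 39160000, 32413200 and
    -- 94764409 are, up to sign, the coefficients of p² + 4 K - 4 F.
    four-F : 4 * F ≤ p * p + 4 * K
    four-F = begin
      4 * F ≡⟨ sym (*-assoc 4 89000000 (r * r)) ⟩
      4 * 89000000 * (r * r) ≤⟨ p-square {17800} {7403} {4 * 89000000} {4 * 73990000} {4 * 9990000} {39160000} {32413200} {94764409} {r} {n} {p} p-eq refl refl refl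
         (quad-high 39160000 32413200 94764409 45945960000 r n refl (num {45945960000 * 2001} {1000 * 1000 * 94764409} {refl}) r-high) ⟩
      p * p + (4 * 73990000 * (r * n) + 4 * 9990000 * (n * n)) ≡⟨ cong (p * p +_) (id₁ 4 73990000 9990000 (r * n) (n * n)) ⟩
      p * p + 4 * K ∎
      where
      open ≤-Reasoning
      id₁ : ∀ c d e x y → c * d * x + c * e * y ≡ c * (d * x + e * y)
      id₁ = solve-∀

    -- Essentially g(r) ≤ (2 λ - r) (3 r - 2 λ), tightest at r = 0.98 n.
    F-x₀ : F ≤ x₀ * w + K
    F-x₀ = x-product {7800} {7403} {12200} {89000000} {73990000} {9990000} {6160000} {41416800} {44814409} {r} {n} {x₀} x₀-eq refl refl refl
      (quad-low 98 100 6160000 41416800 44814409 r n (s≤s z≤n) (num {100 * 100 * 44814409} {98 * (98 * 6160000 + 100 * 41416800)} {refl}) r-low)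

    p≤ : p ≤ X + Y
    p≤ = +-cancelʳ-≤ (7403 * n) _ _ (≤-trans (≤-reflexive p-eq) XY-low)

    F-bound : F + X * X ≤ 2 * (X * Y) + K
    F-bound = minimise {X} {Y} {p} {10000 * r} {x₀} {w} {F} {K} (*-monoˡ-≤ n I≤J) p≤ (<⇒≤ J-deg) x₀-p w-eq four-F F-x₀

    E-bound : F ≤ 10000 * 10000 * E + 10000 * (r * n) + K
    E-bound = +-cancelʳ-≤ (X * X) _ _ (begin
      F + X * X ≤⟨ F-bound ⟩
      2 * (X * Y) + K ≡⟨ cong (_+ K) (id₁ n I J) ⟩
      n * n * (2 * (I * J)) + K ≤⟨ +-monoˡ-≤ K (degree-sum 2≤I) ⟩
      10000 * 10000 * E + n * n * (I * I + J) + K ≡⟨ id₂ (10000 * 10000 * E) n I J K ⟩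
      10000 * 10000 * E + X * X + n * Y + K ≤⟨ +-monoˡ-≤ K (+-monoʳ-≤ (10000 * 10000 * E + X * X) (*-monoʳ-≤ n (<⇒≤ J-deg))) ⟩
      10000 * 10000 * E + X * X + n * (10000 * r) + K ≡⟨ id₃ (10000 * 10000 * E) (X * X) n 10000 r K ⟩
      10000 * 10000 * E + 10000 * (r * n) + K + X * X ∎)
      where
      open ≤-Reasoning
      id₁ : ∀ n I J → 2 * (I * n * (J * n)) ≡ n * n * (2 * (I * J))
      id₁ = solve-∀
      id₂ : ∀ e n I J K → e + n * n * (I * I + J) + K ≡ e + I * n * (I * n) + n * (J * n) + K
      id₂ = solve-∀
      id₃ : ∀ e x n c r K → e + x + n * (c * r) + K ≡ e + c * (r * n) + K + x
      id₃ = solve-∀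

  heavy : 89 * (r * r) + 600 * (M * n) ≤ 100 * E + (74 * (r * n) + 10 * (n * n))
  heavy = cancel 1000000 (begin
    1000000 * (89 * (r * r) + 600 * (M * n)) ≡⟨ id₁ 1000000 89 600 (r * r) M n ⟩
    1000000 * 89 * (r * r) + 600 * (1000000 * M) * n ≡⟨ cong (λ z → z * (r * r) + 600 * (1000000 * M) * n) c₁ ⟩
    F + 600 * (1000000 * M) * n ≤⟨ +-mono-≤ E-bound (*-monoˡ-≤ n (*-monoʳ-≤ 600 M-small)) ⟩
    10000 * 10000 * E + 10000 * (r * n) + K + 600 * n * n ≡⟨ id₂ (10000 * 10000 * E) 10000 73990000 9990000 600 (r * n) n ⟩
    10000 * 10000 * E + ((10000 + 73990000) * (r * n) + (9990000 + 600) * (n * n)) ≤⟨ +-mono-≤ (≤-reflexive (scale-≡ (10000 * 10000) (1000000 * 100) E c₂)) (+-mono-≤ (num* (10000 + 73990000) (1000000 * 74) (r * n) refl) (num* (9990000 + 600) (1000000 * 10) (n * n) refl)) ⟩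
    1000000 * 100 * E + (1000000 * 74 * (r * n) + 1000000 * 10 * (n * n)) ≡⟨ id₃ 1000000 100 74 10 E (r * n) (n * n) ⟩
    1000000 * (100 * E + (74 * (r * n) + 10 * (n * n))) ∎) (s≤s z≤n)
    where
    open ≤-Reasoning
    c₁ : 1000000 * 89 ≡ 89000000
    c₁ = refl
    c₂ : 10000 * 10000 ≡ 1000000 * 100
    c₂ = refl
    id₁ : ∀ c d e x M n → c * (d * x + e * (M * n)) ≡ c * d * x + e * (c * M) * n
    id₁ = solve-∀
    id₂ : ∀ e c d f g x n → e + c * x + (d * x + f * (n * n)) + g * n * n ≡ e + ((c + d) * x + (f + g) * (n * n))
    id₂ = solve-∀
    id₃ : ∀ c d e f E x y → c * d * E + (c * e * x + c * f * y) ≡ c * (d * E + (e * x + f * y))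
    id₃ = solve-∀

-- Placing vertices

count-∖-≡ : ∀ {N} (S : Sub N) y → S ∋ y → count (S ∖ y) + 1 ≡ count S
count-∖-≡ S y h = ≤-antisym (≤-trans (≤-reflexive (+-comm _ 1)) (count-∖-∈ S y h)) (count-∖ S y)

pick : ∀ {N} (S T : Sub N) → count (λ y → S y ∧ not (T y)) < count S → ∃ λ y → S ∋ y × T ∋ y
pick S T h with count-∃ (λ y → S y ∧ T y) (+-cancelʳ-< _ 0 _ (<-≤-trans h (≤-reflexive (count-split S T))))
... | y , p = y , ∧-split p

-- Cutting a tree preserves the weight for every w. Indicators then show that each vertex occurs
-- exactly once, and w = 1 gives the length.
weight : {A : Set} → (A → ℕ) → List A → ℕ
weight w [] = 0
weight w (x ∷ xs) = w x + weight w xs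

weight-++ : {A : Set} (w : A → ℕ) (xs ys : List A) → weight w (xs ++ ys) ≡ weight w xs + weight w ys
weight-++ w [] ys = refl
weight-++ w (x ∷ xs) ys = trans (cong (w x +_) (weight-++ w xs ys)) (sym (+-assoc (w x) _ _))

weight-one : {A : Set} (xs : List A) → weight (λ _ → 1) xs ≡ length xs
weight-one [] = refl
weight-one (x ∷ xs) = cong suc (weight-one xs)

occ : ∀ {k} → Fin k → List (Fin k) → ℕ
occ v = weight (λ x → [ does (v ≟ x) ])

occ-∈ : ∀ {k} {v : Fin k} {xs} → v ∈ xs → 1 ≤ occ v xs
occ-∈ {v = v} (here refl) rewrite does-refl v = s≤s z≤n
occ-∈ (there p) = ≤-trans (occ-∈ p) (m≤n+m _ _)

∈-occ : ∀ {k} (v : Fin k) xs → 1 ≤ occ v xs → v ∈ xs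
∈-occ v (x ∷ xs) h with v ≟ x
... | yes refl = here refl
... | no _ = there (∈-occ v xs h)

occ-ʳ++ : ∀ {k} (v : Fin k) xs ys → occ v (xs ʳ++ ys) ≡ occ v xs + occ v ys
occ-ʳ++ v [] ys = refl
occ-ʳ++ v (x ∷ xs) ys = trans (occ-ʳ++ v xs (x ∷ ys)) (swap (occ v xs) [ does (v ≟ x) ] (occ v ys))
  where
  swap : ∀ a b c → a + (b + c) ≡ b + a + c
  swap = solve-∀

fresh : ∀ {k} (v : Fin k) vs pl → occ v (v ∷ vs) + occ v pl ≤ 1 → v ∉ pl
fresh v vs pl h p = <⇒≱ (s≤s (s≤s z≤n)) (≤-trans (+-mono-≤ {1} {_} {1} (occ-∈ {v = v} {v ∷ vs} (here refl)) (occ-∈ p)) h)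

∈-single : ∀ {A : Set} (P : A → Set) {x} → P x → ∀ u → u ∈ x ∷ [] → P u
∈-single P p u (here refl) = p

count-colour : ∀ {k} → (Fin k → Bool) → List (Fin k) → ℕ
count-colour c [] = 0
count-colour c (v ∷ vs) = [ c v ] + count-colour c vs

module Order {k : ℕ} (root : Fin k) (par : Fin k → Fin k) where

  -- pc holds only what is placed of the same piece: the greedy step needs the parent's image to lie
  -- in the current core.
  data Seq (pc : List (Fin k)) : List (Fin k) → Set where
    [] : Seq pc []
    _∷_ : ∀ {v vs} → v ≢ root × par v ∈ pc → Seq (v ∷ pc) vs → Seq pc (v ∷ vs)

  data Block : Set where
    single : Fin k → Block
    piece : Fin k → List (Fin k) → Block

  vertices : List Block → List (Fin k)
  vertices [] = []
  vertices (single v ∷ bs) = v ∷ vertices bs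
  vertices (piece h vs ∷ bs) = (h ∷ vs) ++ vertices bs

  singles : List Block → ℕ
  singles [] = 0
  singles (single v ∷ bs) = suc (singles bs)
  singles (piece h vs ∷ bs) = singles bs

  -- Blocks that can be placed in turn once pl has been placed, gl being the single vertices among pl.
  data Valid (M : ℕ) (pl gl : List (Fin k)) : List Block → Set where
    [] : Valid M pl gl []
    single : ∀ {v bs} → v ≡ root ⊎ par v ∈ pl → Valid M (v ∷ pl) (v ∷ gl) bs → Valid M pl gl (single v ∷ bs)
    piece : ∀ {h vs bs} → h ≢ root → par h ∈ gl → Seq (h ∷ []) vs → length (h ∷ vs) ≤ M →
      Valid M ((h ∷ vs) ʳ++ pl) gl bs → Valid M pl gl (piece h vs ∷ bs)

choose : {A : Set} → A → A → Bool → A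
choose a b true = a
choose a b false = b

module Placing {k N : ℕ} (root : Fin k) (par : Fin k → Fin k) (H : Fin N → Fin N → Bool) (H-sym : ∀ x y → H x y ≡ H y x)
  (R₀ Z₀ : Sub N) (disjoint : ∀ y → R₀ ∋ y → Z₀ ∋ y → ⊥) where

  open Host H H-sym
  open Order root par

  V W : Set
  V = Fin k
  W = Fin N

  -- R and Q are what is still free of R₀ and Z₀. `zone` later bounds the edges used at the reserved
  -- set, since only vertices of `gl` can have their image outside R₀.
  record State (pl gl : List V) (R Q : Sub N) : Set where
    field
      f : V → W
      inj : ∀ u v → u ∈ pl → v ∈ pl → f u ≡ f v → u ≡ v
      edge : ∀ v → v ∈ pl → v ≡ root ⊎ (par v ∈ pl × H (f (par v)) (f v) ≡ true)
      freeR : ∀ v → v ∈ pl → ¬ (R ∋ f v)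
      freeQ : ∀ v → v ∈ pl → ¬ (Q ∋ f v)
      zone : ∀ v → v ∈ pl → v ∈ gl ⊎ R₀ ∋ f v
      glue : ∀ v → v ∈ gl → v ∈ pl × Z₀ ∋ f v
      R⊆ : ∀ y → R ∋ y → R₀ ∋ y
      Q⊆ : ∀ y → Q ∋ y → Z₀ ∋ y

  update : (V → W) → V → W → V → W
  update f v y u with u ≟ v
  ... | yes _ = y
  ... | no _ = f u

  update-new : ∀ f v y → update f v y v ≡ y
  update-new f v y with v ≟ v
  ... | yes _ = refl
  ... | no q = ⊥-elim (q refl)

  update-old : ∀ f v y u → u ≢ v → update f v y u ≡ f u
  update-old f v y u h with u ≟ v
  ... | yes p = ⊥-elim (h p)
  ... | no _ = refl

  module Step {pl gl R Q} (S : State pl gl R Q) (v : V) (v∉ : v ∉ pl) (y : W)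
    (unused : ∀ u → u ∈ pl → State.f S u ≢ y)
    (att : v ≡ root ⊎ (par v ∈ pl × H (State.f S (par v)) y ≡ true)) where
    open State S

    g : V → W
    g = update f v y

    old : ∀ u → u ∈ pl → g u ≡ f u
    old u p = update-old f v y u (λ q → v∉ (subst (_∈ pl) q p))

    new : g v ≡ y
    new = update-new f v y

    inj′ : ∀ u w → u ∈ v ∷ pl → w ∈ v ∷ pl → g u ≡ g w → u ≡ w
    inj′ u w (here refl) (here refl) e = refl
    inj′ u w (here refl) (there q) e = ⊥-elim (unused w q (trans (sym (old w q)) (trans (sym e) new)))
    inj′ u w (there p) (here refl) e = ⊥-elim (unused u p (trans (sym (old u p)) (trans e new)))
    inj′ u w (there p) (there q) e = inj u w p q (trans (sym (old u p)) (trans e (old w q)))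

    edge′ : ∀ u → u ∈ v ∷ pl → u ≡ root ⊎ (par u ∈ v ∷ pl × H (g (par u)) (g u) ≡ true)
    edge′ u (here refl) = attach att
      where
      attach : v ≡ root ⊎ (par v ∈ pl × H (f (par v)) y ≡ true) → v ≡ root ⊎ (par v ∈ v ∷ pl × H (g (par v)) (g v) ≡ true)
      attach (inj₁ r) = inj₁ r
      attach (inj₂ (p , h)) = inj₂ (there p , subst₂ (λ a b → H a b ≡ true) (sym (old (par v) p)) (sym new) h)
    edge′ u (there p) with edge u p
    ... | inj₁ r = inj₁ r
    ... | inj₂ (q , h) = inj₂ (there q , subst₂ (λ a b → H a b ≡ true) (sym (old (par u) q)) (sym (old u p)) h)

  placeR : ∀ {pl gl R Q} (S : State pl gl R Q) v y → v ∉ pl → R ∋ y →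
    v ≡ root ⊎ (par v ∈ pl × H (State.f S (par v)) y ≡ true) →
    Σ (State (v ∷ pl) gl (R ∖ y) Q) λ S′ → State.f S′ v ≡ y × (∀ u → u ∈ pl → State.f S′ u ≡ State.f S u)
  placeR {pl} {gl} {R} {Q} S v y v∉ Ry att = record
      { f = g ; inj = inj′ ; edge = edge′
      ; freeR = fR ; freeQ = fQ ; zone = zn ; glue = gz
      ; R⊆ = λ x p → R⊆ x (∖-⊆ R y x p) ; Q⊆ = Q⊆ } , new , old
    where
    open State S
    open Step S v v∉ y (λ u p q → freeR u p (subst (R ∋_) (sym q) Ry)) att
    fR : ∀ u → u ∈ v ∷ pl → ¬ ((R ∖ y) ∋ g u)
    fR u (here refl) h = ∖-≢ R y _ h new
    fR u (there p) h = freeR u p (subst (R ∋_) (old u p) (∖-⊆ R y _ h))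
    fQ : ∀ u → u ∈ v ∷ pl → ¬ (Q ∋ g u)
    fQ u (here refl) h = disjoint y (R⊆ y Ry) (Q⊆ y (subst (Q ∋_) new h))
    fQ u (there p) h = freeQ u p (subst (Q ∋_) (old u p) h)
    zn : ∀ u → u ∈ v ∷ pl → u ∈ gl ⊎ R₀ ∋ g u
    zn u (here refl) = inj₂ (subst (R₀ ∋_) (sym new) (R⊆ y Ry))
    zn u (there p) with zone u p
    ... | inj₁ q = inj₁ q
    ... | inj₂ q = inj₂ (subst (R₀ ∋_) (sym (old u p)) q)
    gz : ∀ u → u ∈ gl → u ∈ v ∷ pl × Z₀ ∋ g u
    gz u p with glue u p
    ... | q , z = there q , subst (Z₀ ∋_) (sym (old u q)) z

  placeQ : ∀ {pl gl R Q} (S : State pl gl R Q) v y → v ∉ pl → Q ∋ y →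
    v ≡ root ⊎ (par v ∈ pl × H (State.f S (par v)) y ≡ true) → State (v ∷ pl) (v ∷ gl) R (Q ∖ y)
  placeQ {pl} {gl} {R} {Q} S v y v∉ Qy att = record
      { f = g ; inj = inj′ ; edge = edge′
      ; freeR = fR ; freeQ = fQ ; zone = zn ; glue = gz
      ; R⊆ = R⊆ ; Q⊆ = λ x p → Q⊆ x (∖-⊆ Q y x p) }
    where
    open State S
    open Step S v v∉ y (λ u p q → freeQ u p (subst (Q ∋_) (sym q) Qy)) att
    fR : ∀ u → u ∈ v ∷ pl → ¬ (R ∋ g u)
    fR u (here refl) h = disjoint y (R⊆ y (subst (R ∋_) new h)) (Q⊆ y Qy)
    fR u (there p) h = freeR u p (subst (R ∋_) (old u p) h)
    fQ : ∀ u → u ∈ v ∷ pl → ¬ ((Q ∖ y) ∋ g u)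
    fQ u (here refl) h = ∖-≢ Q y _ h new
    fQ u (there p) h = freeQ u p (subst (Q ∋_) (old u p) (∖-⊆ Q y _ h))
    zn : ∀ u → u ∈ v ∷ pl → u ∈ v ∷ gl ⊎ R₀ ∋ g u
    zn u (here refl) = inj₁ (here refl)
    zn u (there p) with zone u p
    ... | inj₁ q = inj₁ (there q)
    ... | inj₂ q = inj₂ (subst (R₀ ∋_) (sym (old u p)) q)
    gz : ∀ u → u ∈ v ∷ gl → u ∈ v ∷ pl × Z₀ ∋ g u
    gz u (here refl) = here refl , subst (Z₀ ∋_) (sym new) (Q⊆ y Qy)
    gz u (there p) with glue u p
    ... | q , z = there q , subst (Z₀ ∋_) (sym (old u q)) z

  module Piece (side : V → Bool) (alternating : ∀ v → v ≢ root → side v ≡ not (side (par v)))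
    (Rs A B : Sub N) (c₁ c₂ c₃ L M t : ℕ) (M≤t : M ≤ t)
    (A⊆ : ∀ y → A ∋ y → Rs ∋ y) (B⊆ : ∀ y → B ∋ y → Rs ∋ y)
    (A-deg : ∀ y → A ∋ y → t < dg B y) (B-deg : ∀ y → B ∋ y → t < dg A y)
    (A-cost : ∀ y → A ∋ y → L * dg Rs y ≤ c₁) (B-cost : ∀ y → B ∋ y → L * dg Rs y ≤ c₂)
    (all-cost : ∀ y → dg Rs y ≤ c₃) where

    cost : Bool → ℕ
    cost = choose c₁ c₂

    costs : List V → ℕ
    costs [] = 0
    costs (v ∷ vs) = cost (side v) + costs vs

    Side : Bool → Sub N
    Side true = A
    Side false = B

    Side⊆ : ∀ b y → Side b ∋ y → Rs ∋ y
    Side⊆ true = A⊆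
    Side⊆ false = B⊆

    Side-cost : ∀ b y → Side b ∋ y → L * dg Rs y ≤ cost b
    Side-cost true = A-cost
    Side-cost false = B-cost

    Side-deg : ∀ b y → Side b ∋ y → t < dg (Side (not b)) y
    Side-deg true = A-deg
    Side-deg false = B-deg

    -- The account after m vertices of total cost s, with degrees charged as they were in `Rs`
    -- before the piece. `loss` is the sharp bound for the light case, `loss′` the crude one for the
    -- heavy case.
    record Used (R : Sub N) (m s : ℕ) : Set where
      field
        R⊆Rs : ∀ y → R ∋ y → Rs ∋ y
        size : count R + m ≡ count Rs
        loss : L * e Rs Rs ≤ L * e R R + 2 * s
        loss′ : e Rs Rs ≤ e R R + m * (2 * c₃)

    used-step : ∀ {R m s} b y → Used R m s → R ∋ y → Side b ∋ y → Used (R ∖ y) (suc m) (cost b + s)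
    used-step {R} {m} {s} b y U Ry Sy = record
      { R⊆Rs = λ x p → R⊆Rs x (∖-⊆ R y x p)
      ; size = trans (trans (+-suc _ m) (cong (_+ m) (trans (+-comm 1 _) (count-∖-≡ R y Ry)))) size
      ; loss = begin
          L * e Rs Rs ≤⟨ loss ⟩
          L * e R R + 2 * s ≤⟨ +-monoˡ-≤ (2 * s) (*-monoʳ-≤ L (e-∖-both R y)) ⟩
          L * (e (R ∖ y) (R ∖ y) + 2 * dg R y) + 2 * s ≡⟨ id₁ L (e (R ∖ y) (R ∖ y)) (dg R y) s ⟩
          L * e (R ∖ y) (R ∖ y) + 2 * (L * dg R y + s) ≤⟨ +-monoʳ-≤ (L * e (R ∖ y) (R ∖ y)) (*-monoʳ-≤ 2 (+-monoˡ-≤ s (≤-trans (*-monoʳ-≤ L (dg-mono R⊆Rs y)) (Side-cost b y Sy)))) ⟩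
          L * e (R ∖ y) (R ∖ y) + 2 * (cost b + s) ∎
      ; loss′ = begin
          e Rs Rs ≤⟨ loss′ ⟩
          e R R + m * (2 * c₃) ≤⟨ +-monoˡ-≤ (m * (2 * c₃)) (e-∖-both R y) ⟩
          e (R ∖ y) (R ∖ y) + 2 * dg R y + m * (2 * c₃) ≤⟨ +-monoˡ-≤ (m * (2 * c₃)) (+-monoʳ-≤ (e (R ∖ y) (R ∖ y)) (*-monoʳ-≤ 2 (≤-trans (dg-mono R⊆Rs y) (all-cost y)))) ⟩
          e (R ∖ y) (R ∖ y) + 2 * c₃ + m * (2 * c₃) ≡⟨ +-assoc (e (R ∖ y) (R ∖ y)) _ _ ⟩
          e (R ∖ y) (R ∖ y) + suc m * (2 * c₃) ∎ }
      where
      open Used U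
      open ≤-Reasoning
      id₁ : ∀ L E d s → L * (E + 2 * d) + 2 * s ≡ L * E + 2 * (L * d + s)
      id₁ = solve-∀

    available : ∀ {R m s} → Used R m s → ∀ T → (∀ y → T ∋ y → Rs ∋ y) → m < count T → ∃ λ y → T ∋ y × R ∋ y
    available {R} {m} U T T⊆ h = pick T R (≤-<-trans (+-cancelˡ-≤ (count R) _ _ (begin
        count R + count (λ y → T y ∧ not (R y)) ≤⟨ ≤-trans (≤-reflexive (sym (∑-distrib-+ (λ y → [ R y ]) (λ y → [ T y ∧ not (R y) ])))) (sum-mono pt) ⟩
        count Rs ≡⟨ sym size ⟩
        count R + m ∎)) h)
      where
      open Used U
      open ≤-Reasoning
      pt : ∀ y → [ R y ] + [ T y ∧ not (R y) ] ≤ [ Rs y ]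
      pt y with R y in eR | T y in eT
      ... | false | false = z≤n
      ... | false | true rewrite T⊆ y eT = ≤-refl
      ... | true | false rewrite R⊆Rs y eR = ≤-refl
      ... | true | true rewrite R⊆Rs y eR = ≤-refl

    -- The parent's image has more than t ≥ M neighbours on the opposite side of the core, and fewer
    -- than M vertices have been taken since the core was formed.
    placeSeq : ∀ vs {pl gl R Q m s} pc (S : State pl gl R Q) → Seq pc vs →
      (∀ u → u ∈ pc → u ∈ pl × Side (side u) ∋ State.f S u) →
      (∀ u → occ u vs + occ u pl ≤ 1) → Used R m s → length vs + m ≤ M →
      ∃ λ R′ → State (vs ʳ++ pl) gl R′ Q × Used R′ (length vs + m) (costs vs + s)
    placeSeq [] pc S sq on uniq U len = _ , S , U
    placeSeq (v ∷ vs) {pl} {gl} {R} {Q} {m} {s} pc S ((v≢r , p∈) ∷ sq) on uniq U len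
      with available U (λ y → Side (side v) y ∧ H (State.f S (par v)) y) (λ y p → Side⊆ (side v) y (proj₁ (∧-split p)))
             (≤-<-trans (≤-trans (m≤n+m m (length vs)) (≤-trans (n≤1+n _) (≤-trans len M≤t)))
               (subst (λ b → t < dg (Side b) (State.f S (par v))) (sym (alternating v v≢r)) (Side-deg (side (par v)) _ (proj₂ (on (par v) p∈)))))
    ... | y , Ty , Ry with placeR S v y (fresh v vs pl (uniq v)) Ry (inj₂ (proj₁ (on (par v) p∈) , proj₂ (∧-split Ty)))
    ... | S′ , new , old with placeSeq vs (v ∷ pc) S′ sq on′ (λ u → subst (_≤ 1) (swap [ does (u ≟ v) ] (occ u vs) (occ u pl)) (uniq u))
            (used-step (side v) y U Ry (proj₁ (∧-split Ty))) (subst (_≤ M) (sym (+-suc (length vs) m)) len)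
      where
      swap : ∀ a b c → a + b + c ≡ b + (a + c)
      swap = solve-∀
      on′ : ∀ u → u ∈ v ∷ pc → u ∈ v ∷ pl × Side (side u) ∋ State.f S′ u
      on′ u (here refl) = here refl , subst (Side (side u) ∋_) (sym new) (proj₁ (∧-split Ty))
      on′ u (there p) = there (proj₁ (on u p)) , subst (Side (side u) ∋_) (sym (old u (proj₁ (on u p)))) (proj₂ (on u p))
    ... | R′ , S″ , U′ = R′ , S″ , subst₂ (Used R′) (+-suc (length vs) m) (swap (costs vs) (cost (side v)) s) U′
      where
      swap : ∀ a b c → a + (b + c) ≡ b + a + c
      swap = solve-∀

-- Placing a piece

-- The invariant E ≥ g(r) for the number E of ordered unused pairs among r free vertices, with g(r) = 0.89 r² - 0.74 r n - 0.1 n².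
-- Any g would do that is below r² - 2 n² at r = 2 n, positive at r = n, and, with λ = g′(r) / 2, below both λ² and
-- (2 λ - r) (3 r - 2 λ) in between; the last two are the minima of the degree sum δ (2 s - 3 δ) for s = 2 λ.
Good : (n r E : ℕ) → Set
Good n r E = 89 * (r * r) ≤ 100 * E + (74 * (r * n) + 10 * (n * n))

-- g(r) > n² / 100 from r = 0.98 n on. The constant 1322 below is 89 * 98 - 74 * 100.
good-dense : ∀ n r E → 0 < n → 98 * n ≤ 100 * r → Good n r E → n * n < 100 * E
good-dense n r E n>0 h g = +-cancelʳ-< (74 * (r * n) + 10 * (n * n)) _ _ (<-≤-trans (*-cancelˡ-< 10000 _ _ (begin-strict
  10000 * (n * n + (74 * (r * n) + 10 * (n * n))) ≡⟨ id₁ 10000 74 10 r n ⟩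
  (10000 + 10000 * 10) * (n * n) + 10000 * 74 * (r * n) <⟨ +-monoˡ-< (10000 * 74 * (r * n)) (*-monoˡ-< (n * n) ⦃ >-nonZero (*-mono-≤ n>0 n>0) ⦄ (num {suc (10000 + 10000 * 10)} {1322 * 98} {refl})) ⟩
  1322 * 98 * (n * n) + 10000 * 74 * (r * n) ≡⟨ id₂ 1322 98 n (10000 * 74 * (r * n)) ⟩
  1322 * (n * (98 * n)) + 10000 * 74 * (r * n) ≤⟨ +-monoˡ-≤ _ (*-monoʳ-≤ 1322 (*-monoʳ-≤ n h)) ⟩
  1322 * (n * (100 * r)) + 10000 * 74 * (r * n) ≡⟨ id₃ 1322 100 (10000 * 74) n r ⟩
  (1322 * 100 + 10000 * 74) * (r * n) ≡⟨ scale-≡ (1322 * 100 + 10000 * 74) (89 * 100 * 98) (r * n) c₁ ⟩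
  89 * 100 * 98 * (r * n) ≡⟨ id₄ 89 100 98 r n ⟩
  89 * 100 * (r * (98 * n)) ≤⟨ *-monoʳ-≤ (89 * 100) (*-monoʳ-≤ r h) ⟩
  89 * 100 * (r * (100 * r)) ≡⟨ id₅ 89 100 r ⟩
  100 * 100 * (89 * (r * r)) ≡⟨ scale-≡ (100 * 100) 10000 (89 * (r * r)) c₂ ⟩
  10000 * (89 * (r * r)) ∎)) g)
  where
  open ≤-Reasoning
  c₁ : 1322 * 100 + 10000 * 74 ≡ 89 * 100 * 98
  c₁ = refl
  c₂ : 100 * 100 ≡ 10000
  c₂ = refl
  id₁ : ∀ c d e r n → c * (n * n + (d * (r * n) + e * (n * n))) ≡ (c + c * e) * (n * n) + c * d * (r * n)
  id₁ = solve-∀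
  id₂ : ∀ c d n x → c * d * (n * n) + x ≡ c * (n * (d * n)) + x
  id₂ = solve-∀
  id₃ : ∀ c d e n r → c * (n * (d * r)) + e * (r * n) ≡ (c * d + e) * (r * n)
  id₃ = solve-∀
  id₄ : ∀ c d e r n → c * d * e * (r * n) ≡ c * d * (r * (e * n))
  id₄ = solve-∀
  id₅ : ∀ c d r → c * d * (r * (d * r)) ≡ d * d * (c * (r * r))
  id₅ = solve-∀

-- g(r + m) - g(r) = m (g′(r + m) - 0.89 m), while `light` bounds the price per vertex by g′(r + m)
-- - 0.89 M.
good-light-generic : ∀ c h d e f g n r m M E E′ I J s → 0 < c → 2 * d ≡ e → m ≤ M →
  d * ((r + m) * (r + m)) ≤ h * E + (f * ((r + m) * n) + g * (n * n)) → c * E ≤ c * E′ + 2 * s →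
  2 * s ≤ m * (suc I * n + suc J * n) → h * ((2 + I + J) * n) + c * (f * n + d * M) ≤ c * (e * (r + m)) →
  d * (r * r) ≤ h * E′ + (f * (r * n) + g * (n * n))
good-light-generic c h d _ f g n r m M E E′ I J s c>0 refl m≤M good hE hs light = cancel c (+-cancelʳ-≤ slack _ _ (begin
  c * (d * (r * r)) + slack ≤⟨ +-monoʳ-≤ (c * (d * (r * r))) (+-monoʳ-≤ (c * (2 * d * (r * m)) + c * (d * (m * m))) (*-monoʳ-≤ c (*-monoʳ-≤ d (*-monoʳ-≤ m m≤M)))) ⟩
  c * (d * (r * r)) + (c * (2 * d * (r * m)) + c * (d * (m * m)) + c * (d * (m * M))) ≡⟨ id₁ c d r m M ⟩
  c * (d * ((r + m) * (r + m))) + c * (d * (m * M)) ≤⟨ +-monoˡ-≤ (c * (d * (m * M))) (*-monoʳ-≤ c good) ⟩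
  c * (h * E + (f * ((r + m) * n) + g * (n * n))) + c * (d * (m * M)) ≡⟨ id₂ c h f g d E r m n M ⟩
  h * (c * E) + c * (f * (r * n) + g * (n * n)) + m * (c * (f * n + d * M)) ≤⟨ +-monoˡ-≤ (m * (c * (f * n + d * M))) (+-monoˡ-≤ (c * (f * (r * n) + g * (n * n))) (*-monoʳ-≤ h (≤-trans hE (+-monoʳ-≤ (c * E′) hs)))) ⟩
  h * (c * E′ + m * (suc I * n + suc J * n)) + c * (f * (r * n) + g * (n * n)) + m * (c * (f * n + d * M)) ≡⟨ id₃ h c E′ m I J n (f * (r * n) + g * (n * n)) (c * (f * n + d * M)) ⟩
  c * (h * E′ + (f * (r * n) + g * (n * n))) + m * (h * ((2 + I + J) * n) + c * (f * n + d * M)) ≤⟨ +-monoʳ-≤ (c * (h * E′ + (f * (r * n) + g * (n * n)))) (*-monoʳ-≤ m light) ⟩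
  c * (h * E′ + (f * (r * n) + g * (n * n))) + m * (c * (2 * d * (r + m))) ≡⟨ cong (c * (h * E′ + (f * (r * n) + g * (n * n))) +_) (id₄ c d r m) ⟩
  c * (h * E′ + (f * (r * n) + g * (n * n))) + slack ∎)) c>0
  where
  open ≤-Reasoning
  slack : ℕ
  slack = c * (2 * d * (r * m)) + c * (d * (m * m)) + c * (d * (m * m))
  id₁ : ∀ c d r m M → c * (d * (r * r)) + (c * (2 * d * (r * m)) + c * (d * (m * m)) + c * (d * (m * M))) ≡ c * (d * ((r + m) * (r + m))) + c * (d * (m * M))
  id₁ = solve-∀
  id₂ : ∀ c h d e f E r m n M → c * (h * E + (d * ((r + m) * n) + e * (n * n))) + c * (f * (m * M)) ≡ h * (c * E) + c * (d * (r * n) + e * (n * n)) + m * (c * (d * n + f * M))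
  id₂ = solve-∀
  id₃ : ∀ h c E m I J n x y → h * (c * E + m * (suc I * n + suc J * n)) + c * x + m * y ≡ c * (h * E + x) + m * (h * ((2 + I + J) * n) + y)
  id₃ = solve-∀
  id₄ : ∀ c d r m → m * (c * (2 * d * (r + m))) ≡ c * (2 * d * (r * m)) + c * (d * (m * m)) + c * (d * (m * m))
  id₄ = solve-∀

good-light : ∀ n r m M E E′ I J s → m ≤ M → Good n (r + m) E → 10000 * E ≤ 10000 * E′ + 2 * s →
  2 * s ≤ m * (suc I * n + suc J * n) →
  100 * ((2 + I + J) * n) + 10000 * (74 * n + 89 * M) ≤ 10000 * (178 * (r + m)) → Good n r E′
good-light n r m M E E′ I J s = good-light-generic 10000 100 89 178 74 10 n r m M E E′ I J s (s≤s z≤n) refl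

-- Each of the m ≤ M vertices costs at most 6 n pairs, which the surplus 600 M n covers; and g(r) ≤
-- g(r + m) because g′ is positive from 0.98 n on.
good-heavy : ∀ n r m M E E′ → m ≤ M → 98 * n ≤ 100 * r → E ≤ E′ + m * (2 * (3 * n)) →
  89 * ((r + m) * (r + m)) + 600 * (M * n) ≤ 100 * E + (74 * ((r + m) * n) + 10 * (n * n)) → Good n r E′
good-heavy n r m M E E′ m≤M hr hE h = +-cancelʳ-≤ (178 * (r * m) + 600 * (M * n)) _ _ (begin
  89 * (r * r) + (178 * (r * m) + 600 * (M * n)) ≤⟨ m≤m+n _ (89 * (m * m)) ⟩
  89 * (r * r) + (178 * (r * m) + 600 * (M * n)) + 89 * (m * m) ≡⟨ id₁ 89 178 r m (600 * (M * n)) refl ⟩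
  89 * ((r + m) * (r + m)) + 600 * (M * n) ≤⟨ h ⟩
  100 * E + (74 * ((r + m) * n) + 10 * (n * n)) ≤⟨ +-monoˡ-≤ _ (*-monoʳ-≤ 100 hE) ⟩
  100 * (E′ + m * (2 * (3 * n))) + (74 * ((r + m) * n) + 10 * (n * n)) ≡⟨ id₂ 100 600 E′ m n 74 10 r refl ⟩
  100 * E′ + (74 * (r * n) + 10 * (n * n)) + (m * (74 * n) + 600 * (m * n)) ≤⟨ +-monoʳ-≤ (100 * E′ + (74 * (r * n) + 10 * (n * n))) (+-mono-≤ (*-monoʳ-≤ m small) (*-monoʳ-≤ 600 (*-monoˡ-≤ n m≤M))) ⟩
  100 * E′ + (74 * (r * n) + 10 * (n * n)) + (m * (178 * r) + 600 * (M * n)) ≡⟨ cong (λ z → 100 * E′ + (74 * (r * n) + 10 * (n * n)) + (z + 600 * (M * n))) (id₃ m 178 r) ⟩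
  100 * E′ + (74 * (r * n) + 10 * (n * n)) + (178 * (r * m) + 600 * (M * n)) ∎)
  where
  open ≤-Reasoning
  small : 74 * n ≤ 178 * r
  small = ≤-trans (num* 74 98 n refl) (≤-trans hr (num* 100 178 r refl))
  id₁′ : ∀ d r m x → d * (r * r) + (2 * d * (r * m) + x) + d * (m * m) ≡ d * ((r + m) * (r + m)) + x
  id₁′ = solve-∀
  id₁ : ∀ d e r m x → 2 * d ≡ e → d * (r * r) + (e * (r * m) + x) + d * (m * m) ≡ d * ((r + m) * (r + m)) + x
  id₁ d e r m x refl = id₁′ d r m x
  id₂′ : ∀ h E m n d e r → h * (E + m * (2 * (3 * n))) + (d * ((r + m) * n) + e * (n * n)) ≡ h * E + (d * (r * n) + e * (n * n)) + (m * (d * n) + h * 6 * (m * n))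
  id₂′ = solve-∀
  id₂ : ∀ h g E m n d e r → h * 6 ≡ g → h * (E + m * (2 * (3 * n))) + (d * ((r + m) * n) + e * (n * n)) ≡ h * E + (d * (r * n) + e * (n * n)) + (m * (d * n) + g * (m * n))
  id₂ h g E m n d e r refl = id₂′ h E m n d e r
  id₃ : ∀ m c r → m * (c * r) ≡ c * (r * m)
  id₃ = solve-∀

-- The letters h, t, c, l, d, f stand for 100, T, 3, L, 12, 1 + 3 L; the conclusion is `E-big` for τ
-- = 3 L T τ′ and τ′ = 12 M n.
E-big-generic : ∀ h t c l d f C M n E → h * (t * (c * (l * (t * d)))) * f ≤ C → C * M ≤ n → n * n < h * E →
  t * (c * (l * (t * (d * (M * n))))) * f < E
E-big-generic h t c l d f C M n E hC hM hE = *-cancelˡ-< h _ _ (begin-strict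
  h * (t * (c * (l * (t * (d * (M * n))))) * f) ≡⟨ id₁ h t c l d f M n ⟩
  h * (t * (c * (l * (t * d)))) * f * M * n ≤⟨ *-monoˡ-≤ n (≤-trans (*-monoˡ-≤ M hC) hM) ⟩
  n * n <⟨ hE ⟩
  h * E ∎)
  where
  open ≤-Reasoning
  id₁ : ∀ h t c l d f M n → h * (t * (c * (l * (t * (d * (M * n))))) * f) ≡ h * (t * (c * (l * (t * d)))) * f * M * n
  id₁ = solve-∀

τ-small-generic : ∀ l t c d C M n → l * (l * (t * (c * (l * (t * d))))) ≤ C → C * M ≤ n →
  l * (l * (t * (c * (l * (t * (d * (M * n))))))) ≤ n * n
τ-small-generic l t c d C M n hC hM = ≤-trans (≤-reflexive (id₁ l t c d M n)) (*-monoˡ-≤ n (≤-trans (*-monoˡ-≤ M hC) hM))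
  where
  id₁ : ∀ l t c d M n → l * (l * (t * (c * (l * (t * (d * (M * n))))))) ≡ l * (l * (t * (c * (l * (t * d))))) * M * n
  id₁ = solve-∀

module Embed {k N : ℕ} (root : Fin k) (par : Fin k → Fin k) (H : Fin N → Fin N → Bool) (H-sym : ∀ x y → H x y ≡ H y x)
  (R₀ Z₀ : Sub N) (disjoint : ∀ y → R₀ ∋ y → Z₀ ∋ y → ⊥)
  (n M : ℕ) (n>0 : 0 < n) (N≤3n : N ≤ 3 * n) (N-T : 10000 * N ≤ 20001 * n) (N-high : 1000 * N ≤ 2001 * n)
  (C : ℕ) (C-big : 1000000 ≤ C) (C-big₁ : 100 * (20001 * (3 * (10000 * (20001 * 12)))) * (1 + 3 * 10000) ≤ C)
  (C-big₂ : 10000 * (10000 * (20001 * (3 * (10000 * (20001 * 12))))) ≤ C) (M-small : C * M ≤ n)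
  (Z-deg : ∀ z → Z₀ ∋ z → count (λ y → not (H z y)) ≤ M)
  (colour : Fin k → Bool) (proper : ∀ v → v ≢ root → colour v ≡ not (colour (par v))) where

  open Host H H-sym
  open Order root par
  open Placing root par H H-sym R₀ Z₀ disjoint

  majority : List V → V → Bool
  majority vs with count-colour (λ v → not (colour v)) vs ≤? count-colour colour vs
  ... | yes _ = colour
  ... | no _ = λ v → not (colour v)

  majority-alt : ∀ vs v → v ≢ root → majority vs v ≡ not (majority vs (par v))
  majority-alt vs v h with count-colour (λ v → not (colour v)) vs ≤? count-colour colour vs
  ... | yes _ = proper v h
  ... | no _ = cong not (proper v h)

  majority-≤ : ∀ vs → count-colour (λ v → not (majority vs v)) vs ≤ count-colour (majority vs) vs
  majority-≤ vs with count-colour (λ v → not (colour v)) vs ≤? count-colour colour vs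
  ... | yes p = p
  ... | no p = ≤-trans (≤-reflexive (not-not vs)) (<⇒≤ (≰⇒> p))
    where
    not-not : ∀ vs → count-colour (λ v → not (not (colour v))) vs ≡ count-colour colour vs
    not-not [] = refl
    not-not (v ∷ vs) = cong₂ _+_ (cong [_] (Bool.not-involutive (colour v))) (not-not vs)

  module _ (c₁ c₂ : ℕ) (c₁≤c₂ : c₁ ≤ c₂) (side : V → Bool) where
    -- The larger class pays the lower price c₁, so the mean price is at most (c₁ + c₂) / 2.
    balance : ∀ vs (total : List V → ℕ) → total [] ≡ 0 → (∀ v vs → total (v ∷ vs) ≡ choose c₁ c₂ (side v) + total vs) →
      count-colour (λ v → not (side v)) vs ≤ count-colour side vs → 2 * total vs ≤ length vs * (c₁ + c₂)
    balance vs total t[] t∷ h with m≤n⇒∃[o]m+o≡n h | m≤n⇒∃[o]m+o≡n c₁≤c₂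
    ... | c , hc | d , refl = begin
      2 * total vs ≡⟨ cong (2 *_) (eq vs) ⟩
      2 * (count-colour side vs * c₁ + count-colour (λ v → not (side v)) vs * (c₁ + d)) ≡⟨ cong (λ z → 2 * (z * c₁ + fl * (c₁ + d))) (sym hc) ⟩
      2 * ((fl + c) * c₁ + fl * (c₁ + d)) ≤⟨ m≤m+n _ (c * d) ⟩
      2 * ((fl + c) * c₁ + fl * (c₁ + d)) + c * d ≡⟨ id₁ fl c c₁ d ⟩
      (fl + c + fl) * (c₁ + (c₁ + d)) ≡⟨ cong (λ z → (z + fl) * (c₁ + (c₁ + d))) hc ⟩
      (count-colour side vs + fl) * (c₁ + (c₁ + d)) ≡⟨ cong (_* (c₁ + (c₁ + d))) (len vs) ⟩
      length vs * (c₁ + (c₁ + d)) ∎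
      where
      open ≤-Reasoning
      fl : ℕ
      fl = count-colour (λ v → not (side v)) vs
      id₁ : ∀ f c a d → 2 * ((f + c) * a + f * (a + d)) + c * d ≡ (f + c + f) * (a + (a + d))
      id₁ = solve-∀
      len : ∀ vs → count-colour side vs + count-colour (λ v → not (side v)) vs ≡ length vs
      len [] = refl
      len (v ∷ vs) with side v
      ... | true = cong suc (len vs)
      ... | false = trans (+-suc _ _) (cong suc (len vs))
      eq : ∀ vs → total vs ≡ count-colour side vs * c₁ + count-colour (λ v → not (side v)) vs * c₂
      eq [] = t[]
      eq (v ∷ vs) rewrite t∷ v vs | eq vs with side v
      ... | true = sym (+-assoc c₁ _ _)
      ... | false = id₂ c₂ (count-colour side vs * c₁) _
        where
        id₂ : ∀ a b c → a + (b + c) ≡ b + (a + c)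
        id₂ = solve-∀

  -- The head h hangs from a single vertex, whose image misses at most M host vertices; each side of
  -- the core has more than 2 M, so h can enter any core on the side its colour demands.
  place-piece-at : ∀ τ τ′ {pl gl R Q} (S : State pl gl R Q) h vs → par h ∈ gl → h ≢ root → Seq (h ∷ []) vs →
    (∀ u → occ u (h ∷ vs) + occ u pl ≤ 1) → length (h ∷ vs) ≤ M → 98 * n + 100 * length (h ∷ vs) ≤ 100 * count R →
    Good n (count R) (e R R) →
    20001 * τ * (1 + 3 * 10000) < e R R → 3 * (10000 * (20001 * τ′)) ≤ τ → 10000 * (10000 * (20001 * τ)) ≤ n * n →
    2 * M * (3 * n + 3 * n) ≤ τ′ →
    ∃ λ R′ → State ((h ∷ vs) ʳ++ pl) gl R′ Q × count R′ + length (h ∷ vs) ≡ count R × Good n (count R′) (e R′ R′)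
  place-piece-at τ τ′ {pl} {gl} {R} {Q} S h vs g∈ h≢r sq uniq len r-low good E-big τ-big τ-small τ′-big = with-levels levels
    where
    m : ℕ
    m = length (h ∷ vs)
    r-low′ : 98 * n ≤ 100 * count R
    r-low′ = ≤-trans (m≤m+n _ _) r-low
    open Buckets H H-sym R n 10000
    open ≤-Reasoning
    deg≤N : ∀ B x → dg B x ≤ N
    deg≤N B x = count-≤ (λ y → B y ∧ H x y)
    open Search 20001 τ τ′ (s≤s z≤n) n>0 N≤3n (λ x _ → ≤-trans (*-monoʳ-≤ 10000 (deg≤N R x)) N-T) E-big τ-big τ-small
    with-core : (lv : Levels) → Core (2 * M) (slice (Levels.I lv)) (low (suc (Levels.J lv))) → ∃ λ R′ → State ((h ∷ vs) ʳ++ pl) gl R′ Q × count R′ + m ≡ count R × Good n (count R′) (e R′ R′)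
    with-core lv cr = result
      where
      open Levels lv
      open Core cr
      open Piece (majority (h ∷ vs)) (majority-alt (h ∷ vs)) R A′ B′ (suc I * n) (suc J * n) (3 * n) 10000 M (2 * M) (m≤m+n M _)
        (λ y p → low⊆ (suc I) y (slice⊆low I y (A⊆ y p))) (λ y p → low⊆ (suc J) y (B⊆ y p)) A-deg B-deg
        (λ y p → low-deg (suc I) y (slice⊆low I y (A⊆ y p))) (λ y p → low-deg (suc J) y (B⊆ y p)) (λ y → ≤-trans (deg≤N R y) N≤3n)
      big-side : ∀ b → M < count (Side b)
      big-side b = ≤-<-trans (m≤m+n M _) (big b)
        where
        B-∃ : ∃ (B′ ∋_)
        B-∃ with count-∃ (λ y → B′ y ∧ H (proj₁ A-∃) y) (≤-<-trans z≤n (A-deg _ (proj₂ A-∃)))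
        ... | y , p = y , proj₁ (∧-split p)
        big : ∀ b → 2 * M < count (Side b)
        big true = <-≤-trans (B-deg _ (proj₂ B-∃)) (dg≤count A′ _)
        big false = <-≤-trans (A-deg _ (proj₂ A-∃)) (dg≤count B′ _)
      used₀ : Used R 0 0
      used₀ = record { R⊆Rs = λ _ p → p ; size = +-identityʳ (count R) ; loss = m≤m+n (10000 * e R R) (2 * 0) ; loss′ = m≤m+n (e R R) (0 * (2 * (3 * n))) }
      finish : ∀ {R′} → Used R′ (length vs + 1) (costs vs + (cost (majority (h ∷ vs) h) + 0)) → count R′ + m ≡ count R × Good n (count R′) (e R′ R′)
      finish {R′} U = size′ , good′
        where
        open Used U
        size′ : count R′ + m ≡ count R
        size′ = trans (cong (count R′ +_) (+-comm 1 (length vs))) size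
        goodᵣ : Good n (count R′ + m) (e R R)
        goodᵣ = subst (λ r → Good n r (e R R)) (sym size′) good
        total : costs vs + (cost (majority (h ∷ vs) h) + 0) ≡ costs (h ∷ vs)
        total = trans (cong (costs vs +_) (+-identityʳ _)) (+-comm (costs vs) _)
        half : 2 * costs (h ∷ vs) ≤ m * (suc I * n + suc J * n)
        half = balance (suc I * n) (suc J * n) (*-monoˡ-≤ n (s≤s I≤J)) (majority (h ∷ vs)) (h ∷ vs) costs refl (λ _ _ → refl) (majority-≤ (h ∷ vs))
        r-after : 98 * n ≤ 100 * count R′
        r-after = +-cancelʳ-≤ (100 * m) _ _ (≤-trans r-low (≤-reflexive (trans (cong (100 *_) (sym size′)) (*-distribˡ-+ 100 (count R′) m))))
        good′ : Good n (count R′) (e R′ R′)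
        good′ = cases (100 * ((2 + I + J) * n) + 10000 * (74 * n + 89 * M) ≤? 10000 * (178 * (count R′ + m)))
          where
          cases : Dec (100 * ((2 + I + J) * n) + 10000 * (74 * n + 89 * M) ≤ 10000 * (178 * (count R′ + m))) → Good n (count R′) (e R′ R′)
          cases (yes light) = good-light n (count R′) m M (e R R) (e R′ R′) I J (costs (h ∷ vs)) len goodᵣ (subst (λ s → 10000 * e R R ≤ 10000 * e R′ R′ + 2 * s) total loss) half light
          cases (no dark) = good-heavy n (count R′) m M (e R R) (e R′ R′) len r-after
            (subst (λ x → e R R ≤ e R′ R′ + x * (2 * (3 * n))) (+-comm (length vs) 1) loss′)
            (subst (λ r → 89 * (r * r) + 600 * (M * n) ≤ 100 * e R R + (74 * (r * n) + 10 * (n * n))) (sym size′)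
              (Heavy.heavy n (count R) M I J (e R R) n>0 r-low′ (≤-trans (*-monoʳ-≤ 1000 (count-≤ R)) N-high)
                (≤-trans (*-monoˡ-≤ M C-big) M-small) I≤J (J-deg lv)
                (subst (λ r → 10000 * (178 * r) < 100 * ((2 + I + J) * n) + 10000 * (74 * n + 89 * M)) size′ (≰⇒> dark)) (degree-sum lv)))
      b₀ : Bool
      b₀ = majority (h ∷ vs) h
      z₀ : W
      z₀ = State.f S (par h)
      grow : ∀ y → Side b₀ ∋ y →
        (Σ (State (h ∷ pl) gl (R ∖ y) Q) λ S′ → State.f S′ h ≡ y × (∀ u → u ∈ pl → State.f S′ u ≡ State.f S u)) →
        ∃ λ R′ → State ((h ∷ vs) ʳ++ pl) gl R′ Q × Used R′ (length vs + 1) (costs vs + (cost b₀ + 0))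
      grow y Sy (S′ , new , _) = placeSeq vs (h ∷ []) S′ sq on (λ u → subst (_≤ 1) (swap [ does (u ≟ h) ] (occ u vs) (occ u pl)) (uniq u))
          (used-step b₀ y used₀ (Side⊆ b₀ y Sy) Sy) (subst (_≤ M) (+-comm 1 (length vs)) len)
        where
        swap : ∀ a b c → a + b + c ≡ b + (a + c)
        swap = solve-∀
        on : ∀ u → u ∈ h ∷ [] → u ∈ h ∷ pl × Side (majority (h ∷ vs) u) ∋ State.f S′ u
        on = ∈-single (λ u → u ∈ h ∷ pl × Side (majority (h ∷ vs) u) ∋ State.f S′ u) (here refl , subst (Side b₀ ∋_) (sym new) Sy)
      plant : (∃ λ y → Side b₀ ∋ y × H z₀ y ≡ true) → ∃ λ R′ → State ((h ∷ vs) ʳ++ pl) gl R′ Q × Used R′ (length vs + 1) (costs vs + (cost b₀ + 0))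
      plant (y , Sy , Hy) = grow y Sy (placeR S h y (fresh h vs pl (uniq h)) (Side⊆ b₀ y Sy) (inj₂ (proj₁ (State.glue S (par h) g∈) , Hy)))
      conclude : (∃ λ R′ → State ((h ∷ vs) ʳ++ pl) gl R′ Q × Used R′ (length vs + 1) (costs vs + (cost b₀ + 0))) → ∃ λ R′ → State ((h ∷ vs) ʳ++ pl) gl R′ Q × count R′ + m ≡ count R × Good n (count R′) (e R′ R′)
      conclude (R′ , S″ , U) = R′ , S″ , finish U
      result : ∃ λ R′ → State ((h ∷ vs) ʳ++ pl) gl R′ Q × count R′ + m ≡ count R × Good n (count R′) (e R′ R′)
      result = conclude (plant (pick (Side b₀) (H z₀)
        (≤-<-trans (≤-trans (count-mono {S = λ y → Side b₀ y ∧ not (H z₀ y)} {T = λ y → not (H z₀ y)} (λ y p → proj₂ (∧-split {Side b₀ y} p))) (Z-deg z₀ (proj₂ (State.glue S (par h) g∈)))) (big-side b₀))))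

    with-levels : Levels → ∃ λ R′ → State ((h ∷ vs) ʳ++ pl) gl R′ Q × count R′ + m ≡ count R × Good n (count R′) (e R′ R′)
    with-levels lv = with-core lv (core (2 * M) (slice I) (low (suc J)) core-cond)
      where
      open Levels lv
      core-cond : 2 * M * (count (slice I) + count (low (suc J))) < e (slice I) (low (suc J))
      core-cond = ≤-<-trans (begin
        2 * M * (count (slice I) + count (low (suc J))) ≤⟨ *-monoʳ-≤ (2 * M) (+-mono-≤ (≤-trans (count-≤ (slice I)) N≤3n) (≤-trans (count-≤ (low (suc J))) N≤3n)) ⟩
        2 * M * (3 * n + 3 * n) ≤⟨ τ′-big ⟩
        τ′ ≤⟨ m≤m+n τ′ (J * τ′) ⟩
        suc J * τ′ ∎) dense

  place-piece : ∀ {pl gl R Q} (S : State pl gl R Q) h vs → par h ∈ gl → h ≢ root → Seq (h ∷ []) vs →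
    (∀ u → occ u (h ∷ vs) + occ u pl ≤ 1) → length (h ∷ vs) ≤ M → 98 * n + 100 * length (h ∷ vs) ≤ 100 * count R →
    Good n (count R) (e R R) →
    ∃ λ R′ → State ((h ∷ vs) ʳ++ pl) gl R′ Q × count R′ + length (h ∷ vs) ≡ count R × Good n (count R′) (e R′ R′)
  place-piece {R = R} S h vs g∈ h≢r sq uniq len r-low good =
    -- 2 M (3 n + 3 n) = 12 M n pairs force a core of minimum degree above 2 M; τ is the least value
    -- allowed by `τ-big`.
    place-piece-at (3 * (10000 * (20001 * (12 * (M * n))))) (12 * (M * n)) S h vs g∈ h≢r sq uniq len r-low good
      (E-big-generic 100 20001 3 10000 12 (1 + 3 * 10000) C M n (e R R) C-big₁ M-small
        (good-dense n (count R) (e R R) n>0 (≤-trans (m≤m+n _ _) r-low) good))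
      ≤-refl
      (τ-small-generic 10000 20001 3 12 C M n C-big₂ M-small)
      (≤-reflexive (id₁ M n))
    where
    id₁ : ∀ M n → 2 * M * (3 * n + 3 * n) ≡ 12 * (M * n)
    id₁ = solve-∀

  module Process (K : ℕ) (R-deg : ∀ y → R₀ ∋ y → count (λ z → Z₀ z ∧ not (H y z)) ≤ 2 * M)
    (r-start : 98 * n + 100 * suc n ≤ 100 * count R₀) (q-start : suc (2 * M + K) ≤ count Z₀) where

    record Result : Set where
      field
        pl gl : List V
        R Q : Sub N
        state : State pl gl R Q
        all : ∀ u → occ u pl ≡ 1
        few-glue : length gl ≤ K

    -- At most n + 1 vertices are placed in all, so r stays above 0.98 n even after the present
    -- piece.
    room : ∀ r p m l → 98 * n + 100 * suc n ≤ 100 * count R₀ → count R₀ ≤ r + p → p + (m + l) ≤ suc n → 98 * n + 100 * m ≤ 100 * r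
    room r p m l h h₁ h₂ = +-cancelʳ-≤ (100 * p) _ _ (begin
      98 * n + 100 * m + 100 * p ≡⟨ id₁ (98 * n) 100 m p ⟩
      98 * n + 100 * (p + m) ≤⟨ +-monoʳ-≤ (98 * n) (*-monoʳ-≤ 100 (≤-trans (+-monoʳ-≤ p (m≤m+n m l)) h₂)) ⟩
      98 * n + 100 * suc n ≤⟨ h ⟩
      100 * count R₀ ≤⟨ *-monoʳ-≤ 100 h₁ ⟩
      100 * (r + p) ≡⟨ *-distribˡ-+ 100 r p ⟩
      100 * r + 100 * p ∎)
      where
      open ≤-Reasoning
      id₁ : ∀ x c m p → x + c * m + c * p ≡ x + c * (p + m)
      id₁ = solve-∀

    -- The parent may lie in Z₀ or, as a vertex of a piece, in R₀; in both cases its image misses at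
    -- most 2 M vertices of Z₀.
    site : ∀ {pl gl R Q} (S : State pl gl R Q) v → v ≡ root ⊎ par v ∈ pl → 2 * M < count Q →
      ∃ λ y → Q ∋ y × (v ≡ root ⊎ (par v ∈ pl × H (State.f S (par v)) y ≡ true))
    site {Q = Q} S v (inj₁ r) q with count-∃ Q (≤-<-trans z≤n q)
    ... | y , p = y , p , inj₁ r
    site {gl = gl} {Q = Q} S v (inj₂ p) q = found (pick Q (H x) (≤-<-trans (blocked (State.zone S (par v) p)) q))
      where
      x : W
      x = State.f S (par v)
      blocked : par v ∈ gl ⊎ R₀ ∋ x → count (λ y → Q y ∧ not (H x y)) ≤ 2 * M
      blocked (inj₁ g) = ≤-trans (count-mono {S = λ y → Q y ∧ not (H x y)} {T = λ y → not (H x y)} (λ y r → proj₂ (∧-split {Q y} r))) (≤-trans (Z-deg x (proj₂ (State.glue S (par v) g))) (m≤m+n M _))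
      blocked (inj₂ r) = ≤-trans (count-mono {S = λ y → Q y ∧ not (H x y)} {T = λ y → Z₀ y ∧ not (H x y)} (λ y t → ∧-intro (State.Q⊆ S y (proj₁ (∧-split t))) (proj₂ (∧-split {Q y} t)))) (R-deg x r)
      found : (∃ λ y → Q ∋ y × H x y ≡ true) → ∃ λ y → Q ∋ y × (v ≡ root ⊎ (par v ∈ _ × H x y ≡ true))
      found (y , Qy , Hy) = y , Qy , inj₂ (p , Hy)

    -- A single vertex moves one unit from `count Q` to `length gl`. As at most K of them occur, a
    -- sum above 2 M + K always leaves more than 2 M free sites.
    process : ∀ bs {pl gl R Q} → State pl gl R Q → Valid M pl gl bs → (∀ u → occ u (vertices bs) + occ u pl ≡ 1) →
      Good n (count R) (e R R) → count R₀ ≤ count R + length pl → length pl + length (vertices bs) ≤ suc n →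
      suc (2 * M + K) ≤ count Q + length gl → length gl + singles bs ≤ K → Result
    process [] S val uniq good hr hl hq hg = record { state = S ; all = uniq ; few-glue = ≤-trans (m≤m+n _ _) hg }
    process (single v ∷ bs) {pl} {gl} {R} {Q} S (single att val) uniq good hr hl hq hg = next (site S v att Q-big)
      where
      Q-big : 2 * M < count Q
      Q-big = +-cancelʳ-≤ (length gl) _ _ (≤-trans (s≤s (+-monoʳ-≤ (2 * M) (≤-trans (m≤m+n (length gl) _) hg))) hq)
      swap : ∀ a b c → a + b + c ≡ b + (a + c)
      swap = solve-∀
      next : (∃ λ y → Q ∋ y × (v ≡ root ⊎ (par v ∈ pl × H (State.f S (par v)) y ≡ true))) → Result
      next (y , Qy , at) = process bs (placeQ S v y (fresh v (vertices bs) pl (≤-reflexive (uniq v))) Qy at) val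
        (λ u → trans (sym (swap [ does (u ≟ v) ] (occ u (vertices bs)) (occ u pl))) (uniq u)) good
        (≤-trans hr (+-monoʳ-≤ (count R) (n≤1+n _)))
        (subst (_≤ suc n) (+-suc (length pl) _) hl)
        (≤-trans hq (subst (count Q + length gl ≤_) (+-assoc (count (Q ∖ y)) 1 (length gl)) (+-monoˡ-≤ (length gl) (count-∖ Q y))))
        (subst (_≤ K) (+-suc (length gl) _) hg)
    process (piece h vs ∷ bs) {pl} {gl} {R} {Q} S (piece h≢r g∈ sq len val) uniq good hr hl hq hg =
      next (place-piece S h vs g∈ h≢r sq uniq′ len (room (count R) (length pl) (length (h ∷ vs)) (length (vertices bs)) r-start hr (subst (λ z → length pl + z ≤ suc n) (length-++ (h ∷ vs) {vertices bs}) hl)) good)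
      where
      uniq′ : ∀ u → occ u (h ∷ vs) + occ u pl ≤ 1
      uniq′ u = ≤-trans (+-monoˡ-≤ (occ u pl) (≤-trans (m≤m+n _ (occ u (vertices bs))) (≤-reflexive (sym (weight-++ (λ x → [ does (u ≟ x) ]) (h ∷ vs) (vertices bs)))))) (≤-reflexive (uniq u))
      swap : ∀ a b c → a + b + c ≡ b + (a + c)
      swap = solve-∀
      next : (∃ λ R′ → State ((h ∷ vs) ʳ++ pl) gl R′ Q × count R′ + length (h ∷ vs) ≡ count R × Good n (count R′) (e R′ R′)) → Result
      next (R′ , S′ , size , good′) = process bs S′ val
        (λ u → trans (trans (cong (occ u (vertices bs) +_) (occ-ʳ++ u (h ∷ vs) pl)) (trans (sym (swap (occ u (h ∷ vs)) (occ u (vertices bs)) (occ u pl))) (cong (_+ occ u pl) (sym (weight-++ (λ x → [ does (u ≟ x) ]) (h ∷ vs) (vertices bs)))))) (uniq u))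
        good′
        (≤-trans hr (≤-reflexive (trans (cong (_+ length pl) (sym size)) (trans (+-assoc (count R′) _ _) (cong (count R′ +_) (sym (length-ʳ++ (h ∷ vs) {pl})))))))
        (≤-trans (≤-reflexive (trans (cong (_+ length (vertices bs)) (trans (length-ʳ++ (h ∷ vs) {pl}) (+-comm _ (length pl)))) (trans (+-assoc (length pl) _ _) (cong (length pl +_) (sym (length-++ (h ∷ vs) {vertices bs})))))) hl)
        hq hg

    embed : ∀ bs → Valid M [] [] bs → (∀ u → occ u (vertices bs) ≡ 1) → length (vertices bs) ≤ suc n → singles bs ≤ K →
      Good n (count R₀) (e R₀ R₀) → Result
    embed bs val uniq len gl good = process bs start-state val (λ u → trans (+-identityʳ _) (uniq u)) good
      (≤-reflexive (sym (+-identityʳ _))) len (≤-trans q-start (≤-reflexive (sym (+-identityʳ _)))) gl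
      where
      start-state : State [] [] R₀ Z₀
      start-state = record
        -- A default value: nothing is placed yet, and the map must be total.
        { f = λ _ → proj₁ (count-∃ Z₀ (≤-<-trans z≤n q-start)) ; inj = λ _ _ () ; edge = λ _ () ; freeR = λ _ () ; freeQ = λ _ ()
        ; zone = λ _ () ; glue = λ _ () ; R⊆ = λ _ p → p ; Q⊆ = λ _ p → p }

-- Cutting a rooted forest

-- First-child / next-sibling representation: node v c s has the children c and is followed by the siblings s.
data Forest (k : ℕ) : Set where
  nil : Forest k
  node : Fin k → Forest k → Forest k → Forest k

labels : ∀ {k} → Forest k → List (Fin k)
labels nil = []
labels (node v c s) = v ∷ labels c ++ labels s

module Cut {k : ℕ} (root : Fin k) (par : Fin k → Fin k) where

  open Order root par

  Rooted : Fin k → Forest k → Set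
  Rooted p nil = ⊤
  Rooted p (node v c s) = (v ≢ root × par v ≡ p) × Rooted v c × Rooted p s

  Component : Set
  Component = Fin k × List (Fin k)

  flat : List Component → List (Fin k)
  flat [] = []
  flat ((h , vs) ∷ cs) = h ∷ vs ++ flat cs

  pieces : List Component → List Block → List Block
  pieces [] bs = bs
  pieces ((h , vs) ∷ cs) bs = piece h vs ∷ pieces cs bs

  -- cut M f bs: the components hanging from the parent of the forest f, and the remaining blocks of f followed by bs.
  cut : ℕ → Forest k → List Block → List Component × List Block
  cut M nil bs = [] , bs
  cut M (node v c s) bs with cut M s bs
  ... | sc , sb with cut M c sb
  ... | cc , cb with M ≤? suc (length (flat cc))
  -- The pieces at v come before `cb`, whose single vertices may have their parents in these pieces.
  ... | yes _ = sc , single v ∷ pieces cc cb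
  ... | no _ = (v , flat cc) ∷ sc , cb

  Hanging : ℕ → Fin k → List Component → Set
  Hanging M p [] = ⊤
  Hanging M p ((h , vs) ∷ cs) = (h ≢ root × par h ≡ p × Seq (h ∷ []) vs × length (h ∷ vs) ≤ M) × Hanging M p cs

  seq-++ : ∀ vs {pc pc′} ws → Seq pc vs → (∀ u → u ∈ pc → u ∈ pc′) → (∀ pc″ → (∀ u → u ∈ pc′ → u ∈ pc″) → Seq pc″ ws) → Seq pc′ (vs ++ ws)
  seq-++ [] ws [] sub h = h _ (λ _ p → p)
  seq-++ (v ∷ vs) ws ((r , p) ∷ sq) sub h = (r , sub _ p) ∷ seq-++ vs ws sq ext (λ pc″ s → h pc″ (λ u q → s u (there q)))
    where
    ext : ∀ u → u ∈ v ∷ _ → u ∈ v ∷ _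
    ext u (here e) = here e
    ext u (there q) = there (sub u q)

  seq-flat : ∀ M p cs pc → Hanging M p cs → p ∈ pc → Seq pc (flat cs)
  seq-flat M p [] pc _ _ = []
  seq-flat M p ((h , vs) ∷ cs) pc ((r , e , sq , _) , hs) p∈ = (r , subst (_∈ pc) (sym e) p∈) ∷ seq-++ vs (flat cs) sq one
      (λ pc″ s → seq-flat M p cs pc″ hs (s p (there p∈)))
    where
    one : ∀ u → u ∈ h ∷ [] → u ∈ h ∷ pc
    one u (here e) = here e

  cut-hanging : ∀ M p f bs → Rooted p f → Hanging M p (proj₁ (cut M f bs))
  cut-hanging M p nil bs _ = tt
  cut-hanging M p (node v c s) bs ((v≢r , e) , rc , rs) with cut M s bs | cut-hanging M p s bs rs
  ... | sc , sb | hs with cut M c sb | cut-hanging M v c sb rc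
  ... | cc , cb | hc with M ≤? suc (length (flat cc))
  ... | yes _ = hs
  ... | no q = (v≢r , e , seq-flat M v cc (v ∷ []) hc (here refl) , <⇒≤ (≰⇒> q)) , hs

  pieces-valid : ∀ M p cs bs pl gl → Hanging M p cs → p ∈ gl →
    (∀ pl′ → (∀ u → u ∈ pl → u ∈ pl′) → (∀ u → u ∈ flat cs → u ∈ pl′) → Valid M pl′ gl bs) → Valid M pl gl (pieces cs bs)
  pieces-valid M p [] bs pl gl _ _ h = h pl (λ _ q → q) (λ _ ())
  pieces-valid M p ((a , vs) ∷ cs) bs pl gl ((r , e , sq , len) , hs) p∈ h = piece r (subst (_∈ gl) (sym e) p∈) sq len
    (pieces-valid M p cs bs ((a ∷ vs) ʳ++ pl) gl hs p∈ (λ pl′ s₁ s₂ → h pl′ (λ u q → s₁ u (old (a ∷ vs) pl u q)) (mem pl′ s₁ s₂)))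
    where
    old : ∀ xs ys u → u ∈ ys → u ∈ xs ʳ++ ys
    old [] ys u q = q
    old (x ∷ xs) ys u q = old xs (x ∷ ys) u (there q)
    new : ∀ xs ys u → u ∈ xs → u ∈ xs ʳ++ ys
    new (x ∷ xs) ys u (here e) = old xs (x ∷ ys) u (here e)
    new (x ∷ xs) ys u (there q) = new xs (x ∷ ys) u q
    mem : ∀ pl′ → (∀ u → u ∈ (a ∷ vs) ʳ++ pl → u ∈ pl′) → (∀ u → u ∈ flat cs → u ∈ pl′) → ∀ u → u ∈ a ∷ vs ++ flat cs → u ∈ pl′
    mem pl′ s₁ s₂ u q with ∈-++⁻ (a ∷ vs) q
    ... | inj₁ x = s₁ u (new (a ∷ vs) pl u x)
    ... | inj₂ y = s₂ u y

  -- The hanging components are placed only by a later cut at an ancestor, whose blocks come earlier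
  -- in the list; hence they are assumed to lie in pl. What else is placed by then is unknown, so bs
  -- has to be valid for every larger pl and every gl.
  cut-valid : ∀ M p f bs pl gl → Rooted p f → p ∈ pl → (∀ u → u ∈ flat (proj₁ (cut M f bs)) → u ∈ pl) →
    (∀ pl′ gl′ → (∀ u → u ∈ pl → u ∈ pl′) → Valid M pl′ gl′ bs) → Valid M pl gl (proj₂ (cut M f bs))
  cut-valid M p nil bs pl gl _ _ _ h = h pl gl (λ _ q → q)
  cut-valid M p (node v c s) bs pl gl ((v≢r , e) , rc , rs) p∈ sub h
    with cut M s bs | (λ pl gl → cut-valid M p s bs pl gl rs)
  ... | sc , sb | vs with cut M c sb | cut-hanging M v c sb rc | (λ pl gl → cut-valid M v c sb pl gl rc)
  ... | cc , cb | hc | vc with M ≤? suc (length (flat cc))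
  ... | yes _ = single (inj₂ (subst (_∈ pl) (sym e) p∈)) (pieces-valid M v cc cb (v ∷ pl) (v ∷ gl) hc (here refl)
        (λ pl₁ s₁ s₂ → vc pl₁ (v ∷ gl) (s₁ v (here refl)) s₂
          (λ pl₂ gl₂ t → vs pl₂ gl₂ (t p (s₁ p (there p∈))) (λ u q → t u (s₁ u (there (sub u q))))
            (λ pl₃ gl₃ w → h pl₃ gl₃ (λ u q → w u (t u (s₁ u (there q))))))))
  ... | no _ = vc pl gl (sub v (here refl)) (λ u q → sub u (there (∈-++⁺ˡ q)))
        (λ pl₁ gl₁ s₁ → vs pl₁ gl₁ (s₁ p p∈) (λ u q → s₁ u (sub u (there (∈-++⁺ʳ (flat cc) q))))
          (λ pl₂ gl₂ t → h pl₂ gl₂ (λ u q → t u (s₁ u q))))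

  weight-pieces : ∀ (w : Fin k → ℕ) cs bs → weight w (vertices (pieces cs bs)) ≡ weight w (flat cs) + weight w (vertices bs)
  weight-pieces w [] bs = refl
  weight-pieces w ((a , vs) ∷ cs) bs = begin
    weight w ((a ∷ vs) ++ vertices (pieces cs bs)) ≡⟨ weight-++ w (a ∷ vs) _ ⟩
    weight w (a ∷ vs) + weight w (vertices (pieces cs bs)) ≡⟨ cong (weight w (a ∷ vs) +_) (weight-pieces w cs bs) ⟩
    weight w (a ∷ vs) + (weight w (flat cs) + weight w (vertices bs)) ≡⟨ sym (+-assoc (weight w (a ∷ vs)) _ _) ⟩
    weight w (a ∷ vs) + weight w (flat cs) + weight w (vertices bs) ≡⟨ cong (_+ weight w (vertices bs)) (sym (weight-++ w (a ∷ vs) (flat cs))) ⟩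
    weight w (a ∷ vs ++ flat cs) + weight w (vertices bs) ∎
    where open ≡-Reasoning

  cut-weight : ∀ (w : Fin k → ℕ) M f bs → weight w (flat (proj₁ (cut M f bs))) + weight w (vertices (proj₂ (cut M f bs))) ≡ weight w (labels f) + weight w (vertices bs)
  cut-weight w M nil bs = refl
  cut-weight w M (node v c s) bs with cut M s bs | cut-weight w M s bs
  ... | sc , sb | es with cut M c sb | cut-weight w M c sb
  ... | cc , cb | ec with M ≤? suc (length (flat cc))
  ... | yes _ = begin
    weight w (flat sc) + (w v + weight w (vertices (pieces cc cb))) ≡⟨ cong (λ z → weight w (flat sc) + (w v + z)) (trans (weight-pieces w cc cb) ec) ⟩
    weight w (flat sc) + (w v + (weight w (labels c) + weight w (vertices sb))) ≡⟨ id₁ (weight w (flat sc)) (w v) (weight w (labels c)) (weight w (vertices sb)) ⟩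
    w v + (weight w (labels c) + (weight w (flat sc) + weight w (vertices sb))) ≡⟨ cong (λ z → w v + (weight w (labels c) + z)) es ⟩
    w v + (weight w (labels c) + (weight w (labels s) + weight w (vertices bs))) ≡⟨ id₂ (w v) (weight w (labels c)) (weight w (labels s)) (weight w (vertices bs)) ⟩
    w v + (weight w (labels c) + weight w (labels s)) + weight w (vertices bs) ≡⟨ cong (λ z → w v + z + weight w (vertices bs)) (sym (weight-++ w (labels c) (labels s))) ⟩
    w v + weight w (labels c ++ labels s) + weight w (vertices bs) ∎
    where
    open ≡-Reasoning
    id₁ : ∀ a b c d → a + (b + (c + d)) ≡ b + (c + (a + d))
    id₁ = solve-∀
    id₂ : ∀ a b c d → a + (b + (c + d)) ≡ a + (b + c) + d
    id₂ = solve-∀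
  ... | no _ = begin
    w v + weight w (flat cc ++ flat sc) + weight w (vertices cb) ≡⟨ cong (λ z → w v + z + weight w (vertices cb)) (weight-++ w (flat cc) (flat sc)) ⟩
    w v + (weight w (flat cc) + weight w (flat sc)) + weight w (vertices cb) ≡⟨ id₁ (w v) (weight w (flat cc)) (weight w (flat sc)) (weight w (vertices cb)) ⟩
    w v + (weight w (flat cc) + weight w (vertices cb)) + weight w (flat sc) ≡⟨ cong (λ z → w v + z + weight w (flat sc)) ec ⟩
    w v + (weight w (labels c) + weight w (vertices sb)) + weight w (flat sc) ≡⟨ id₂ (w v) (weight w (labels c)) (weight w (vertices sb)) (weight w (flat sc)) ⟩
    w v + (weight w (labels c) + (weight w (flat sc) + weight w (vertices sb))) ≡⟨ cong (λ z → w v + (weight w (labels c) + z)) es ⟩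
    w v + (weight w (labels c) + (weight w (labels s) + weight w (vertices bs))) ≡⟨ id₃ (w v) (weight w (labels c)) (weight w (labels s)) (weight w (vertices bs)) ⟩
    w v + (weight w (labels c) + weight w (labels s)) + weight w (vertices bs) ≡⟨ cong (λ z → w v + z + weight w (vertices bs)) (sym (weight-++ w (labels c) (labels s))) ⟩
    w v + weight w (labels c ++ labels s) + weight w (vertices bs) ∎
    where
    open ≡-Reasoning
    id₁ : ∀ a b c d → a + (b + c) + d ≡ a + (b + d) + c
    id₁ = solve-∀
    id₂ : ∀ a b c d → a + (b + c) + d ≡ a + (b + (d + c))
    id₂ = solve-∀
    id₃ : ∀ a b c d → a + (b + (c + d)) ≡ a + (b + c) + d
    id₃ = solve-∀

  singles-pieces : ∀ cs bs → singles (pieces cs bs) ≡ singles bs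
  singles-pieces [] bs = refl
  singles-pieces (_ ∷ cs) bs = singles-pieces cs bs

  -- Each single vertex is charged to itself and the components it closes off, at least M vertices
  -- together; the hanging components are not charged yet.
  cut-singles : ∀ M f bs → M * singles (proj₂ (cut M f bs)) + length (flat (proj₁ (cut M f bs))) ≤ length (labels f) + M * singles bs
  cut-singles M nil bs = ≤-reflexive (+-identityʳ _)
  cut-singles M (node v c s) bs with cut M s bs | cut-singles M s bs
  ... | sc , sb | hs with cut M c sb | cut-singles M c sb
  ... | cc , cb | hc with M ≤? suc (length (flat cc))
  ... | yes q rewrite singles-pieces cc cb | length-++ (labels c) {labels s} = begin
    M * suc (singles cb) + length (flat sc) ≡⟨ cong (_+ length (flat sc)) (trans (*-suc M (singles cb)) (+-comm M _)) ⟩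
    M * singles cb + M + length (flat sc) ≤⟨ +-monoˡ-≤ (length (flat sc)) (+-monoʳ-≤ (M * singles cb) q) ⟩
    M * singles cb + suc (length (flat cc)) + length (flat sc) ≡⟨ id₁ (M * singles cb) (length (flat cc)) (length (flat sc)) ⟩
    suc (M * singles cb + length (flat cc) + length (flat sc)) ≤⟨ s≤s (+-monoˡ-≤ (length (flat sc)) hc) ⟩
    suc (length (labels c) + M * singles sb + length (flat sc)) ≡⟨ id₂ (length (labels c)) (M * singles sb) (length (flat sc)) ⟩
    suc (length (labels c) + (M * singles sb + length (flat sc))) ≤⟨ s≤s (+-monoʳ-≤ (length (labels c)) hs) ⟩
    suc (length (labels c) + (length (labels s) + M * singles bs)) ≡⟨ id₃ (length (labels c)) (length (labels s)) (M * singles bs) ⟩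
    suc (length (labels c) + length (labels s)) + M * singles bs ∎
    where
    open ≤-Reasoning
    id₁ : ∀ a b c → a + (1 + b) + c ≡ 1 + (a + b + c)
    id₁ = solve-∀
    id₂ : ∀ a b c → 1 + (a + b + c) ≡ 1 + (a + (b + c))
    id₂ = solve-∀
    id₃ : ∀ a b c → 1 + (a + (b + c)) ≡ (1 + (a + b)) + c
    id₃ = solve-∀
  ... | no q rewrite length-++ (labels c) {labels s} | length-++ (flat cc) {flat sc} = begin
    M * singles cb + suc (length (flat cc) + length (flat sc)) ≡⟨ id₁ (M * singles cb) (length (flat cc)) (length (flat sc)) ⟩
    suc (M * singles cb + length (flat cc) + length (flat sc)) ≤⟨ s≤s (+-monoˡ-≤ (length (flat sc)) hc) ⟩
    suc (length (labels c) + M * singles sb + length (flat sc)) ≡⟨ id₂ (length (labels c)) (M * singles sb) (length (flat sc)) ⟩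
    suc (length (labels c) + (M * singles sb + length (flat sc))) ≤⟨ s≤s (+-monoʳ-≤ (length (labels c)) hs) ⟩
    suc (length (labels c) + (length (labels s) + M * singles bs)) ≡⟨ id₃ (length (labels c)) (length (labels s)) (M * singles bs) ⟩
    suc (length (labels c) + length (labels s)) + M * singles bs ∎
    where
    open ≤-Reasoning
    id₁ : ∀ a b c → a + (1 + (b + c)) ≡ 1 + (a + b + c)
    id₁ = solve-∀
    id₂ : ∀ a b c → 1 + (a + b + c) ≡ 1 + (a + (b + c))
    id₂ = solve-∀
    id₃ : ∀ a b c → 1 + (a + (b + c)) ≡ (1 + (a + b)) + c
    id₃ = solve-∀

  record Blocks (M : ℕ) (vs : List (Fin k)) : Set where
    field
      blocks : List Block
      valid : Valid M [] [] blocks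
      same : ∀ w → weight w (vertices blocks) ≡ weight w vs
      few : M * singles blocks ≤ length vs + M

  -- The root becomes a single vertex however little hangs from it, which is the extra M in `few`.
  cut-tree : ∀ M f → Rooted root f → Blocks M (root ∷ labels f)
  cut-tree M f rf with cut M f [] | cut-hanging M root f [] rf | (λ pl gl → cut-valid M root f [] pl gl rf) | (λ w → cut-weight w M f []) | cut-singles M f []
  ... | cc , cb | hc | vc | wt | fw = record
    { blocks = single root ∷ pieces cc cb
    ; valid = single (inj₁ refl) (pieces-valid M root cc cb (root ∷ []) (root ∷ []) hc (here refl)
        (λ pl s₁ s₂ → vc pl (root ∷ []) (s₁ root (here refl)) s₂ (λ _ _ _ → [])))
    ; same = λ w → cong (w root +_) (trans (weight-pieces w cc cb) (trans (wt w) (+-identityʳ _)))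
    ; few = few′ }
    where
    few′ : M * suc (singles (pieces cc cb)) ≤ suc (length (labels f)) + M
    few′ rewrite singles-pieces cc cb = begin
      M * suc (singles cb) ≡⟨ trans (*-suc M (singles cb)) (+-comm M _) ⟩
      M * singles cb + M ≤⟨ +-monoˡ-≤ M (≤-trans (m≤m+n _ _) (≤-trans fw (≤-reflexive (trans (cong (length (labels f) +_) (*-zeroʳ M)) (+-identityʳ _))))) ⟩
      length (labels f) + M ≤⟨ n≤1+n _ ⟩
      suc (length (labels f)) + M ∎
      where open ≤-Reasoning

-- Rooting a tree

module Grow {n : ℕ} (G : Graph (suc n)) where

  private
    V : Set
    V = Fin (suc n)

  Edge-sym : ∀ {u v} → Edge G u v → Edge G v u
  Edge-sym {u} {v} e = trans (Defs.sym G v u) e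

  data WalkIn (P : V → Set) : V → V → Set where
    [] : ∀ {v} → P v → WalkIn P v v
    step : ∀ {u v w} → P u → Edge G u v → WalkIn P v w → WalkIn P u w

  snoc : ∀ {P u v w} → WalkIn P u v → Edge G v w → P w → WalkIn P u w
  snoc ([] p) e q = step p e ([] q)
  snoc (step p e w) e′ q = step p e (snoc w e′ q)

  weaken : ∀ {P Q : V → Set} → (∀ v → P v → Q v) → ∀ {u v} → WalkIn P u v → WalkIn Q u v
  weaken h ([] p) = [] (h _ p)
  weaken h (step p e w) = step (h _ p) e (weaken h w)

  data Path : V → V → List V → Set where
    [] : ∀ {v} → Path v v (v ∷ [])
    step : ∀ {u v w xs} → Edge G u v → u ∉ v ∷ xs → Path v w (v ∷ xs) → Path u w (u ∷ v ∷ xs)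

  suffix : ∀ {a b c xs} → Path a b xs → c ∈ xs → ∃ λ ys → Path c b (c ∷ ys) × (∀ v → v ∈ c ∷ ys → v ∈ xs)
  suffix [] (here refl) = [] , [] , λ _ p → p
  suffix (step e q p) (here refl) = _ , step e q p , λ _ r → r
  suffix (step e q p) (there c∈) with suffix p c∈
  ... | ys , p′ , sub = ys , p′ , λ v r → there (sub v r)

  -- Loop erasure: if the new first vertex already lies on the path, the path is cut back to it.
  erase : ∀ {P : V → Set} {a b} → WalkIn P a b → ∃ λ xs → Path a b (a ∷ xs) × (∀ v → v ∈ a ∷ xs → P v)
  erase {P} {a} ([] p) = [] , [] , λ { v (here refl) → p }
  erase {P} {a} (step {v = c} p e w) with erase w
  ... | xs , path , all with _∈?_ _≟_ a (c ∷ xs)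
  ... | yes q with suffix path q
  ... | ys , path′ , sub = ys , path′ , λ v r → all v (sub v r)
  erase {P} {a} (step {v = c} p e w) | xs , path , all | no q = c ∷ xs , step e q path , λ { v (here refl) → p ; v (there r) → all v r }

  path-injective : ∀ {a b xs} → Path a b xs → ∀ i j → lookup xs i ≡ lookup xs j → i ≡ j
  path-injective [] zero zero e = refl
  path-injective (step _ _ _) zero zero e = refl
  path-injective (step {v = v} {xs = xs} _ q p) zero (suc j) e = ⊥-elim (q (subst (_∈ v ∷ xs) (sym e) (∈-lookup j)))
  path-injective (step {v = v} {xs = xs} _ q p) (suc i) zero e = ⊥-elim (q (subst (_∈ v ∷ xs) e (∈-lookup i)))
  path-injective (step _ _ p) (suc i) (suc j) e = cong suc (path-injective p i j e)

  path-step : ∀ {a b x xs} → Path a b (x ∷ xs) → ∀ (i : Fin (length xs)) → Edge G (lookup (x ∷ xs) (inject₁ i)) (lookup (x ∷ xs) (suc i))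
  path-step (step e _ _) zero = e
  path-step (step _ _ p) (suc i) = path-step p i

  path-last : ∀ {a b x xs} → Path a b (x ∷ xs) → lookup (x ∷ xs) (fromℕ (length xs)) ≡ b
  path-last [] = refl
  path-last (step _ _ p) = path-last p

  -- As a and a′ differ, the path has at least two vertices, and b, which avoids it, is the third
  -- that a `Cycle` demands.
  cycle : ∀ {P : V → Set} {a a′ b} → WalkIn P a a′ → ¬ P b → a ≢ a′ → Edge G b a → Edge G a′ b → Cycle G
  cycle {P} {a} {a′} {b} w ¬Pb a≢ e e′ with erase w
  ... | [] , [] , _ = ⊥-elim (a≢ refl)
  ... | c ∷ ys , path , all = record
    { m = length ys ; c = lookup (b ∷ a ∷ c ∷ ys) ; inj = λ {i} {j} → path-injective whole i j ; step = path-step whole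
    ; close = subst (λ v → Edge G v b) (sym (path-last whole)) e′ }
    where
    whole : Path b a′ (b ∷ a ∷ c ∷ ys)
    whole = step e (λ q → ¬Pb (all b q)) path

  root : V
  root = zero

  data At (a : V) : Forest (suc n) → Set where
    here : ∀ {c s} → At a (node a c s)
    child : ∀ {v c s} → At a c → At a (node v c s)
    sibling : ∀ {v c s} → At a s → At a (node v c s)

  at : ∀ {a} f → a ∈ labels f → At a f
  at (node v c s) (here refl) = here
  at (node v c s) (there p) with ∈-++⁻ (labels c) p
  ... | inj₁ q = child (at c q)
  ... | inj₂ q = sibling (at s q)

  graft : ∀ {a} (b : V) {f} → At a f → Forest (suc n)
  graft {a} b (here {c} {s}) = node a (node b nil c) s
  graft b (child {v} {c} {s} p) = node v (graft b p) s
  graft b (sibling {v} {c} {s} p) = node v c (graft b p)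

  graft-weight : ∀ {a} b {f} (p : At a f) (w : V → ℕ) → weight w (labels (graft b p)) ≡ w b + weight w (labels f)
  graft-weight {a} b (here {c} {s}) w = id₁ (w a) (w b) (weight w (labels c ++ labels s))
    where
    id₁ : ∀ x y z → x + (y + z) ≡ y + (x + z)
    id₁ = solve-∀
  graft-weight b (child {v} {c} {s} p) w rewrite weight-++ w (labels (graft b p)) (labels s) | weight-++ w (labels c) (labels s) | graft-weight b p w = id₁ (w v) (w b) (weight w (labels c)) (weight w (labels s))
    where
    id₁ : ∀ x y z u → x + (y + z + u) ≡ y + (x + (z + u))
    id₁ = solve-∀
  graft-weight b (sibling {v} {c} {s} p) w rewrite weight-++ w (labels c) (labels (graft b p)) | weight-++ w (labels c) (labels s) | graft-weight b p w = id₁ (w v) (w b) (weight w (labels c)) (weight w (labels s))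
    where
    id₁ : ∀ x y z u → x + (z + (y + u)) ≡ y + (x + (z + u))
    id₁ = solve-∀

  Rooted-cong : ∀ {par par′ : V → V} p f → (∀ v → v ∈ labels f → par v ≡ par′ v) → Cut.Rooted root par p f → Cut.Rooted root par′ p f
  Rooted-cong p nil h r = tt
  Rooted-cong p (node v c s) h ((v≢ , e) , rc , rs) = (v≢ , trans (sym (h v (here refl))) e) ,
    Rooted-cong v c (λ u q → h u (there (∈-++⁺ˡ q))) rc , Rooted-cong p s (λ u q → h u (there (∈-++⁺ʳ (labels c) q))) rs

  graft-rooted : ∀ {par : V → V} {a} b p {f} (x : At a f) → b ≢ root → par b ≡ a → Cut.Rooted root par p f → Cut.Rooted root par p (graft b x)
  graft-rooted b p here b≢ e (h , rc , rs) = h , ((b≢ , e) , tt , rc) , rs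
  graft-rooted b p (child {v} x) b≢ e (h , rc , rs) = h , graft-rooted b v x b≢ e rc , rs
  graft-rooted b p (sibling x) b≢ e (h , rc , rs) = h , rc , graft-rooted b p x b≢ e rs

  -- A rooted subtree of G on L. `walks` serves to close a cycle when a new vertex has two
  -- neighbours in L; excluding this is what preserves `covers`.
  record Tree (L : List V) : Set where
    field
      forest : Forest (suc n)
      is-labels : L ≡ root ∷ labels forest
      par : V → V
      colour : V → Bool
      rooted : Cut.Rooted root par root forest
      simple : ∀ u → occ u L ≤ 1
      par-edge : ∀ v → v ∈ L → v ≢ root → Edge G (par v) v
      covers : ∀ u v → u ∈ L → v ∈ L → Edge G u v → (v ≢ root × u ≡ par v) ⊎ (u ≢ root × v ≡ par u)
      proper : ∀ v → v ∈ L → v ≢ root → colour v ≡ not (colour (par v))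
      walks : ∀ u v → u ∈ L → v ∈ L → WalkIn (_∈ L) u v

  singleton : Tree (root ∷ [])
  singleton = record
    { forest = nil ; is-labels = refl ; par = λ _ → root ; colour = λ _ → true ; rooted = tt
    ; simple = λ u → ≤-trans (≤-reflexive (+-identityʳ _)) ([]≤1 (does (u ≟ root)))
    ; par-edge = λ { v (here e) h → ⊥-elim (h e) }
    ; covers = λ { u v (here refl) (here refl) e → ⊥-elim (no-loop (trans (sym e) (irref G root))) }
    ; proper = λ { v (here e) h → ⊥-elim (h e) }
    ; walks = λ { u v (here refl) (here refl) → [] (here refl) } }
    where
    no-loop : true ≢ false
    no-loop ()

  module Extend (acyclic : Acyclic G) {L} (T : Tree L) (a b : V) (a∈ : a ∈ L) (b∉ : b ∉ L) (e : Edge G a b) where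
    open Tree T

    par′ : V → V
    par′ v with v ≟ b
    ... | yes _ = a
    ... | no _ = par v

    par′-new : par′ b ≡ a
    par′-new with b ≟ b
    ... | yes _ = refl
    ... | no q = ⊥-elim (q refl)

    par′-old : ∀ v → v ∈ L → par v ≡ par′ v
    par′-old v p with v ≟ b
    ... | yes refl = ⊥-elim (b∉ p)
    ... | no _ = refl

    colour′ : V → Bool
    colour′ v with v ≟ b
    ... | yes _ = not (colour a)
    ... | no _ = colour v

    colour′-new : colour′ b ≡ not (colour a)
    colour′-new with b ≟ b
    ... | yes _ = refl
    ... | no q = ⊥-elim (q refl)

    colour′-old : ∀ v → v ∈ L → colour v ≡ colour′ v
    colour′-old v p with v ≟ b
    ... | yes refl = ⊥-elim (b∉ p)
    ... | no _ = refl

    root∈ : root ∈ L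
    root∈ = subst (root ∈_) (sym is-labels) (here refl)

    b≢ : b ≢ root
    b≢ refl = b∉ root∈

    par-in : ∀ p f → Cut.Rooted root par p f → ∀ v → v ∈ labels f → par v ≡ p ⊎ par v ∈ labels f
    par-in p (node v c s) ((_ , q) , rc , rs) u (here refl) = inj₁ q
    par-in p (node v c s) ((_ , q) , rc , rs) u (there x) with ∈-++⁻ (labels c) x
    ... | inj₁ y with par-in v c rc u y
    ... | inj₁ refl = inj₂ (here refl)
    ... | inj₂ z = inj₂ (there (∈-++⁺ˡ z))
    par-in p (node v c s) ((_ , q) , rc , rs) u (there x) | inj₂ y with par-in p s rs u y
    ... | inj₁ refl = inj₁ refl
    ... | inj₂ z = inj₂ (there (∈-++⁺ʳ (labels c) z))

    par∈ : ∀ v → v ∈ L → v ≢ root → par v ∈ L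
    par∈ v p h = subst (par v ∈_) (sym is-labels) (go (subst (v ∈_) is-labels p))
      where
      go : v ∈ root ∷ labels forest → par v ∈ root ∷ labels forest
      go (here q) = ⊥-elim (h q)
      go (there q) with par-in root forest rooted v q
      ... | inj₁ r = here r
      ... | inj₂ r = there r

    only-neighbour : ∀ u → u ∈ L → Edge G u b → u ≡ a
    only-neighbour u u∈ eu with u ≟ a
    ... | yes q = q
    ... | no q = ⊥-elim (acyclic (cycle (walks a u a∈ u∈) b∉ (λ r → q (sym r)) (Edge-sym e) eu))

    extend : ∀ L′ f → L′ ≡ root ∷ labels f → (∀ v → v ∈ L′ → v ≡ b ⊎ v ∈ L) → (∀ v → v ≡ b ⊎ v ∈ L → v ∈ L′) →
      Cut.Rooted root par′ root f → (∀ u → occ u L′ ≤ 1) → Tree L′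
    extend L′ f isL split join rt simple′ = record
      { forest = f ; is-labels = isL ; par = par′ ; colour = colour′ ; rooted = rt ; simple = simple′
      ; par-edge = λ v p h → par-edge′ v (split v p) h
      ; covers = λ u v p q → covers′ u v (split u p) (split v q)
      ; proper = λ v p h → proper′ v (split v p) h
      ; walks = λ u v p q → walks′ u v (split u p) (split v q) }
      where
      par-edge′ : ∀ v → v ≡ b ⊎ v ∈ L → v ≢ root → Edge G (par′ v) v
      par-edge′ v (inj₁ refl) h = subst (λ u → Edge G u b) (sym par′-new) e
      par-edge′ v (inj₂ p) h = subst (λ u → Edge G u v) (par′-old v p) (par-edge v p h)
      proper′ : ∀ v → v ≡ b ⊎ v ∈ L → v ≢ root → colour′ v ≡ not (colour′ (par′ v))
      proper′ v (inj₁ refl) h = trans colour′-new (cong not (trans (colour′-old a a∈) (cong colour′ (sym par′-new))))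
      proper′ v (inj₂ p) h = trans (sym (colour′-old v p)) (trans (proper v p h) (cong not (trans (colour′-old (par v) (par∈ v p h)) (cong colour′ (par′-old v p)))))
      covers′ : ∀ u v → u ≡ b ⊎ u ∈ L → v ≡ b ⊎ v ∈ L → Edge G u v → (v ≢ root × u ≡ par′ v) ⊎ (u ≢ root × v ≡ par′ u)
      covers′ u v (inj₁ refl) (inj₁ refl) eu = ⊥-elim (no-loop (trans (sym eu) (irref G u)))
        where
        no-loop : true ≢ false
        no-loop ()
      covers′ u v (inj₁ refl) (inj₂ q) eu = inj₂ (b≢ , trans (only-neighbour v q (Edge-sym eu)) (sym par′-new))
      covers′ u v (inj₂ p) (inj₁ refl) eu = inj₁ (b≢ , trans (only-neighbour u p eu) (sym par′-new))
      covers′ u v (inj₂ p) (inj₂ q) eu with covers u v p q eu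
      ... | inj₁ (h , r) = inj₁ (h , trans r (par′-old v q))
      ... | inj₂ (h , r) = inj₂ (h , trans r (par′-old u p))
      lift : ∀ {u v} → WalkIn (_∈ L) u v → WalkIn (_∈ L′) u v
      lift = weaken (λ v p → join v (inj₂ p))
      b∈ : b ∈ L′
      b∈ = join b (inj₁ refl)
      walks′ : ∀ u v → u ≡ b ⊎ u ∈ L → v ≡ b ⊎ v ∈ L → WalkIn (_∈ L′) u v
      walks′ u v (inj₁ refl) (inj₁ refl) = [] b∈
      walks′ u v (inj₁ refl) (inj₂ q) = step b∈ (Edge-sym e) (lift (walks a v a∈ q))
      walks′ u v (inj₂ p) (inj₁ refl) = snoc (lift (walks u a p a∈)) e b∈
      walks′ u v (inj₂ p) (inj₂ q) = lift (walks u v p q)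

    occ-∉ : occ b L ≡ 0
    occ-∉ with occ b L in eq
    ... | zero = refl
    ... | suc _ = ⊥-elim (b∉ (∈-occ b L (subst (1 ≤_) (sym eq) (s≤s z≤n))))

    grown : ∀ f → (∀ w → weight w (root ∷ labels f) ≡ w b + weight w L) → Cut.Rooted root par′ root f → Σ (List V) λ L′ → Tree L′ × (∀ v → v ∈ L → v ∈ L′) × b ∈ L′
    grown f wt rt = L′ , extend L′ f refl split join rt simple′ , (λ v p → join v (inj₂ p)) , join b (inj₁ refl)
      where
      L′ : List V
      L′ = root ∷ labels f
      split : ∀ v → v ∈ L′ → v ≡ b ⊎ v ∈ L
      split v p with v ≟ b | subst (1 ≤_) (wt (λ x → [ does (v ≟ x) ])) (occ-∈ p)
      ... | yes q | _ = inj₁ q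
      ... | no q | r = inj₂ (∈-occ v L r)
      join : ∀ v → v ≡ b ⊎ v ∈ L → v ∈ L′
      join v (inj₁ refl) = ∈-occ v L′ (subst (1 ≤_) (sym (wt (λ x → [ does (v ≟ x) ]))) (≤-trans (≤-reflexive (cong [_] (sym (does-refl v)))) (m≤m+n _ _)))
      join v (inj₂ p) = ∈-occ v L′ (subst (1 ≤_) (sym (wt (λ x → [ does (v ≟ x) ]))) (≤-trans (occ-∈ p) (m≤n+m _ _)))
      simple′ : ∀ u → occ u L′ ≤ 1
      simple′ u = subst (_≤ 1) (sym (wt (λ x → [ does (u ≟ x) ]))) (bound u)
        where
        bound : ∀ u → [ does (u ≟ b) ] + occ u L ≤ 1
        bound u with u ≟ b
        ... | yes refl = ≤-reflexive (cong suc occ-∉)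
        ... | no _ = simple u

    add : Σ (List V) λ L′ → Tree L′ × (∀ v → v ∈ L → v ∈ L′) × b ∈ L′
    add = go (subst (a ∈_) is-labels a∈)
      where
      old : ∀ v → v ∈ labels forest → par v ≡ par′ v
      old v q = par′-old v (subst (v ∈_) (sym is-labels) (there q))
      wtL : ∀ w → weight w (root ∷ labels forest) ≡ weight w L
      wtL w = cong (weight w) (sym is-labels)
      swap : ∀ x y z → x + (y + z) ≡ y + (x + z)
      swap = solve-∀
      go : a ∈ root ∷ labels forest → Σ (List V) λ L′ → Tree L′ × (∀ v → v ∈ L → v ∈ L′) × b ∈ L′
      go (here q) = grown (node b nil forest) (λ w → trans (swap (w root) (w b) _) (cong (w b +_) (wtL w)))
        ((b≢ , trans par′-new q) , tt , Rooted-cong root forest old rooted)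
      go (there q) = grown (graft b (at forest q)) (λ w → trans (cong (w root +_) (graft-weight b (at forest q) w)) (trans (swap (w root) (w b) _) (cong (w b +_) (wtL w))))
        (graft-rooted b root (at forest q) b≢ par′-new (Rooted-cong root forest old rooted))

  along : Acyclic G → ∀ {L a b} → Tree L → a ∈ L → Walk G a b → Σ (List V) λ L′ → Tree L′ × (∀ v → v ∈ L → v ∈ L′) × b ∈ L′
  along ac T a∈ [] = _ , T , (λ _ p → p) , a∈
  along ac {L} {a} T a∈ (_∷_ {v = c} e w) with _∈?_ _≟_ c L
  ... | yes q = along ac T q w
  ... | no q with Extend.add ac T a c a∈ q e
  ... | L₁ , T₁ , sub₁ , c∈ with along ac T₁ c∈ w
  ... | L₂ , T₂ , sub₂ , b∈ = L₂ , T₂ , (λ v p → sub₂ v (sub₁ v p)) , b∈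

  all-of : IsTree G → ∀ (ws : List V) {L} → Tree L → root ∈ L → Σ (List V) λ L′ → Tree L′ × (∀ v → v ∈ L → v ∈ L′) × (∀ w → w ∈ ws → w ∈ L′)
  all-of t [] T r∈ = _ , T , (λ _ p → p) , λ _ ()
  all-of (con , ac) (w ∷ ws) T r∈ with along ac T r∈ (con root w)
  ... | L₁ , T₁ , sub₁ , w∈ with all-of (con , ac) ws T₁ (sub₁ root r∈)
  ... | L₂ , T₂ , sub₂ , ws∈ = L₂ , T₂ , (λ v p → sub₂ v (sub₁ v p)) , λ { u (here refl) → sub₂ u w∈ ; u (there p) → ws∈ u p }

  spanning : IsTree G → Σ (List V) λ L → Tree L × (∀ v → v ∈ L)
  spanning t with all-of t (allFin (suc n)) singleton (here refl)
  ... | L , T , _ , all = L , T , λ v → all v (∈-allFin v)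

-- Packing the family

sum-tabulate : ∀ {k} (g : Fin k → ℕ) → ListAction.sum (tabulate g) ≡ sum g
sum-tabulate {zero} g = refl
sum-tabulate {suc k} g = cong (g zero +_) (sum-tabulate (λ i → g (suc i)))

degree-sum : ∀ {k} (G : Graph k) u → degree G u ≡ sum (λ v → [ adj G u v ])
degree-sum {k} G u = trans (cong ListAction.sum (map-tabulate (λ v → v) (λ v → if adj G u v then 1 else 0)))
  (trans (sum-tabulate (λ v → if adj G u v then 1 else 0)) (sum-cong-≗ (λ v → if-[] (adj G u v))))
  where
  if-[] : ∀ b → (if b then 1 else 0) ≡ [ b ]
  if-[] true = refl
  if-[] false = refl

occ-sum : ∀ {k} (xs : List (Fin k)) → sum (λ u → occ u xs) ≡ length xs
occ-sum {k} [] = sum-0 k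
occ-sum (x ∷ xs) = trans (∑-distrib-+ (λ u → [ does (u ≟ x) ]) (λ u → occ u xs))
  (cong₂ _+_ (trans (sum-cong-≗ (λ u → sym (*-identityʳ [ does (u ≟ x) ]))) (sum-δ x (λ _ → 1))) (occ-sum xs))

initial : ∀ {N} → ℕ → Sub N
initial zero _ = false
initial (suc m) zero = true
initial (suc m) (suc i) = initial m i

count-initial : ∀ {N} m → m ≤ N → count (initial {N} m) ≡ m
count-initial {N} zero _ = sum-0 N
count-initial {suc N} (suc m) (s≤s h) = cong suc (count-initial m h)

isZero : ℕ → Bool
isZero zero = true
isZero (suc _) = false

isZero-≡ : ∀ {m} → isZero m ≡ true → m ≡ 0
isZero-≡ {zero} _ = refl

nonzero-≤ : ∀ m → [ not (isZero m) ] ≤ m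
nonzero-≤ zero = z≤n
nonzero-≤ (suc m) = s≤s z≤n

1≤isZero : ∀ m → 1 ≤ [ isZero m ] + m
1≤isZero zero = ≤-refl
1≤isZero (suc m) = s≤s z≤n

module Usage {k N : ℕ} (G : Graph k) (φ : Fin k → Fin N) where

  private
    δ : Fin N → Fin k → ℕ
    δ x u = [ does (x ≟ φ u) ]
    A : Fin k → Fin k → ℕ
    A u v = [ adj G u v ]

  -- A multiplicity rather than a Boolean, so that the loads of several trees add up.
  use : Fin N → Fin N → ℕ
  use x y = sum (λ u → δ x u * sum (λ v → δ y v * A u v))

  -- A tree vertex v is counted only at y = φ v, which turns a sum over host vertices into one over
  -- tree vertices.
  push : ∀ (S : Fin N → ℕ) (g : Fin k → ℕ) → sum (λ y → S y * sum (λ v → δ y v * g v)) ≡ sum (λ v → S (φ v) * g v)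
  push S g = trans (sum-cong-≗ (λ y → sum-scaleˡ (S y) (λ v → δ y v * g v)))
    (trans (∑-comm (λ y v → S y * (δ y v * g v)))
    (sum-cong-≗ (λ v → trans (sum-cong-≗ (λ y → swap (S y) (δ y v) (g v))) (sum-δ (φ v) (λ y → S y * g v)))))
    where
    swap : ∀ a b c → a * (b * c) ≡ b * (a * c)
    swap = solve-∀

  push-one : ∀ (g : Fin k → ℕ) → sum (λ y → sum (λ v → δ y v * g v)) ≡ sum g
  push-one g = trans (sum-cong-≗ (λ y → sym (*-identityˡ (sum (λ v → δ y v * g v))))) (trans (push (λ _ → 1) g) (sum-cong-≗ (λ v → *-identityˡ (g v))))

  row : ∀ x → sum (use x) ≡ sum (λ u → δ x u * sum (A u))
  row x = trans (∑-comm (λ y u → δ x u * sum (λ v → δ y v * A u v)))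
    (sum-cong-≗ (λ u → trans (sym (sum-scaleˡ (δ x u) (λ y → sum (λ v → δ y v * A u v)))) (cong (δ x u *_) (push-one (A u)))))

  weighted : ∀ (S : Fin N → ℕ) → sum (λ x → S x * sum (use x)) ≡ sum (λ u → S (φ u) * sum (A u))
  weighted S = trans (sum-cong-≗ (λ x → cong (S x *_) (row x))) (push S (λ u → sum (A u)))

  total : sum (λ x → sum (use x)) ≡ sum (λ u → sum (A u))
  total = trans (sum-cong-≗ row) (push-one (λ u → sum (A u)))

  use-sym : ∀ x y → use x y ≡ use y x
  use-sym x y = trans (expand x y) (trans (∑-comm (λ u v → δ x u * (δ y v * A u v))) (trans (sum-cong-≗ (λ v → sum-cong-≗ (λ u → pt u v))) (sym (expand y x))))
    where
    expand : ∀ x y → use x y ≡ sum (λ u → sum (λ v → δ x u * (δ y v * A u v)))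
    expand x y = sum-cong-≗ (λ u → sum-scaleˡ (δ x u) (λ v → δ y v * A u v))
    swap : ∀ a b c → a * (b * c) ≡ b * (a * c)
    swap = solve-∀
    pt : ∀ u v → δ x u * (δ y v * A u v) ≡ δ y v * (δ x u * A v u)
    pt u v = trans (swap (δ x u) (δ y v) (A u v)) (cong (λ b → δ y v * (δ x u * [ b ])) (Defs.sym G u v))

  hit : ∀ u v → Edge G u v → 1 ≤ use (φ u) (φ v)
  hit u v e = begin
    1 ≡⟨ sym (cong₂ (λ a b → [ a ] * [ b ]) (does-refl (φ v)) e) ⟩
    δ (φ v) v * A u v ≤⟨ sum-≥ (λ w → δ (φ v) w * A u w) v ⟩
    sum (λ w → δ (φ v) w * A u w) ≡⟨ sym (trans (cong (λ a → [ a ] * sum (λ w → δ (φ v) w * A u w)) (does-refl (φ u))) (*-identityˡ _)) ⟩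
    δ (φ u) u * sum (λ w → δ (φ v) w * A u w) ≤⟨ sum-≥ (λ z → δ (φ u) z * sum (λ w → δ (φ v) w * A z w)) u ⟩
    use (φ u) (φ v) ∎
    where open ≤-Reasoning

-- M = n / C bounds the size of a piece, and q is a lower bound for n / Δ.  The two long numbers in C are
-- 36 L T² (1 + 3 L) 100 and 36 L³ T², where degrees are rounded to multiples of n / L, L = 10000 and T = 2 L + 1.
record Scale (n M C q : ℕ) : Set where
  field
    C-big : 1000000 ≤ C
    C-big₁ : 100 * (20001 * (3 * (10000 * (20001 * 12)))) * (1 + 3 * 10000) ≤ C
    C-big₂ : 10000 * (10000 * (20001 * (3 * (10000 * (20001 * 12))))) ≤ C
    M-small : C * M ≤ n
    M-large : n ≤ 2 * C * M
    M-C : 4 * C ≤ M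
    q-big : 16 * (C * C * C) ≤ q

module _ {n M C q : ℕ} (sc : Scale n M C q) where
  open Scale sc

  C>0 : 0 < C
  C>0 = ≤-trans (s≤s z≤n) C-big

  M>0 : 0 < M
  M>0 = ≤-trans C>0 (≤-trans (m≤n*m C 4) M-C)

  n-big : 1000000 ≤ n
  n-big = ≤-trans C-big (≤-trans (m≤m*n C M ⦃ >-nonZero M>0 ⦄) M-small)

  n>0 : 0 < n
  n>0 = ≤-trans (s≤s z≤n) n-big

  million-M : 1000000 * M ≤ n
  million-M = ≤-trans (*-monoˡ-≤ M C-big) M-small

  odd : ∀ a b → a ≤ 1000000 → 1 + 2 * a ≡ b → a * suc (2 * n) ≤ b * n
  odd a _ h refl = begin
    a * suc (2 * n) ≡⟨ id₁ a n ⟩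
    a + 2 * a * n ≤⟨ +-monoˡ-≤ (2 * a * n) (≤-trans h n-big) ⟩
    n + 2 * a * n ∎
    where
    open ≤-Reasoning
    id₁ : ∀ a n → a * (1 + 2 * n) ≡ a + 2 * a * n
    id₁ = solve-∀

  N≤3n : suc (2 * n) ≤ 3 * n
  N≤3n = +-monoˡ-≤ (2 * n) n>0

  N-T : 10000 * suc (2 * n) ≤ 20001 * n
  N-T = odd 10000 20001 (num {10000} {1000000} {refl}) refl

  N-high : 1000 * suc (2 * n) ≤ 2001 * n
  N-high = odd 1000 2001 (num {1000} {1000000} {refl}) refl

  few-pieces : ∀ s → M * s ≤ suc n + M → s ≤ M
  few-pieces s h = *-cancelˡ-≤ M ⦃ >-nonZero M>0 ⦄ (≤-trans h (begin
    suc n + M ≤⟨ +-mono-≤ (+-mono-≤ M>0 M-large) (m≤n*m M C ⦃ >-nonZero C>0 ⦄) ⟩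
    M + 2 * C * M + C * M ≤⟨ +-monoˡ-≤ (C * M) (+-monoˡ-≤ (2 * C * M) (m≤n*m M C ⦃ >-nonZero C>0 ⦄)) ⟩
    C * M + 2 * C * M + C * M ≡⟨ id₁ C M ⟩
    4 * C * M ≤⟨ *-monoˡ-≤ M M-C ⟩
    M * M ∎))
    where
    open ≤-Reasoning
    id₁ : ∀ C M → C * M + 2 * C * M + C * M ≡ 4 * C * M
    id₁ = solve-∀

  glue-total : ∀ s → M * s ≤ suc n + M → M * s ≤ 2 * n
  glue-total s h = ≤-trans h (begin
    suc n + M ≡⟨ cong suc (+-comm n M) ⟩
    suc (M + n) ≤⟨ s≤s (+-monoˡ-≤ n (≤-refl {M})) ⟩
    1 + M + n ≤⟨ +-monoˡ-≤ n 1+M≤n ⟩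
    n + n ≡⟨ cong (n +_) (sym (+-identityʳ n)) ⟩
    2 * n ∎)
    where
    open ≤-Reasoning
    1+M≤n : 1 + M ≤ n
    1+M≤n = ≤-trans (+-monoˡ-≤ M M>0) (≤-trans (≤-reflexive (cong (M +_) (sym (+-identityʳ M)))) (≤-trans (*-monoˡ-≤ M (num {2} {1000000} {refl})) million-M))

  -- Each tree has at most 2 n / M single vertices, of degree at most n / q. Over n trees this is 2
  -- n³ / (M q), at most M² by n ≤ 2 C M and q ≥ 16 C³.
  few-retired : ∀ t S → t ≤ n → M * (q * S) ≤ t * (2 * (n * n)) → S ≤ M * M
  few-retired t S t≤n h = *-cancelˡ-≤ (M * q) ⦃ >-nonZero (*-mono-≤ M>0 q>0) ⦄ (begin
    M * q * S ≡⟨ *-assoc M q S ⟩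
    M * (q * S) ≤⟨ h ⟩
    t * (2 * (n * n)) ≤⟨ *-monoˡ-≤ (2 * (n * n)) t≤n ⟩
    n * (2 * (n * n)) ≤⟨ *-mono-≤ M-large (*-monoʳ-≤ 2 (*-mono-≤ M-large M-large)) ⟩
    2 * C * M * (2 * (2 * C * M * (2 * C * M))) ≡⟨ id₁ C M ⟩
    M * (16 * (C * C * C)) * (M * M) ≤⟨ *-monoˡ-≤ (M * M) (*-monoʳ-≤ M q-big) ⟩
    M * q * (M * M) ∎)
    where
    open ≤-Reasoning
    q>0 : 0 < q
    q>0 = ≤-trans (*-mono-≤ {1} {16} (s≤s z≤n) (*-mono-≤ (*-mono-≤ C>0 C>0) C>0)) q-big
    id₁ : ∀ C M → 2 * C * M * (2 * (2 * C * M * (2 * C * M))) ≡ M * (16 * (C * C * C)) * (M * M)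
    id₁ = solve-∀

  module Start (r : ℕ) (hr : suc (2 * n) ≤ r + 9 * M) where

    r-low : 1995 * n ≤ 1000 * r
    r-low = +-cancelʳ-≤ (5 * n) _ _ (begin
      1995 * n + 5 * n ≡⟨ sym (*-distribʳ-+ n 1995 5) ⟩
      2000 * n ≡⟨ *-assoc 1000 2 n ⟩
      1000 * (2 * n) ≤⟨ *-monoʳ-≤ 1000 (≤-trans (n≤1+n (2 * n)) hr) ⟩
      1000 * (r + 9 * M) ≡⟨ *-distribˡ-+ 1000 r (9 * M) ⟩
      1000 * r + 1000 * (9 * M) ≡⟨ cong (1000 * r +_) (sym (*-assoc 1000 9 M)) ⟩
      1000 * r + 1000 * 9 * M ≤⟨ +-monoʳ-≤ (1000 * r) (≤-trans (num* (1000 * 9) 1000000 M refl) (≤-trans million-M (m≤n*m n 5))) ⟩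
      1000 * r + 5 * n ∎)
      where open ≤-Reasoning

    r-start : 98 * n + 100 * suc n ≤ 100 * r
    r-start = cancel 10 (begin
      10 * (98 * n + 100 * suc n) ≡⟨ id₁ 10 98 100 n ⟩
      10 * (98 + 100) * n + 10 * 100 ≤⟨ +-monoʳ-≤ (10 * (98 + 100) * n) (≤-trans (num {10 * 100} {1000000} {refl}) n-big) ⟩
      10 * (98 + 100) * n + n ≡⟨ id₂ (10 * (98 + 100)) n ⟩
      (1 + 10 * (98 + 100)) * n ≤⟨ num* (1 + 10 * (98 + 100)) 1995 n refl ⟩
      1995 * n ≤⟨ r-low ⟩
      1000 * r ≡⟨ *-assoc 10 100 r ⟩
      10 * (100 * r) ∎) (s≤s z≤n)
      where
      open ≤-Reasoning
      id₁ : ∀ a b c n → a * (b * n + c * (1 + n)) ≡ a * (b + c) * n + a * c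
      id₁ = solve-∀
      id₂ : ∀ c n → c * n + n ≡ (1 + c) * n
      id₂ = solve-∀

    -- The used pairs are at most 2.01 n². What remains is 11 r² + 74 r n ≥ 191 n², where 191 = 201
    -- - 10, and r = 1.995 n decides it.
    good-start : ∀ t E → t ≤ n → r * r ≤ E + t * (2 * suc n) → Good n r E
    good-start t E t≤n h = +-cancelʳ-≤ (11 * (r * r)) _ _ (begin
      89 * (r * r) + 11 * (r * r) ≡⟨ sym (*-distribʳ-+ (r * r) 89 11) ⟩
      100 * (r * r) ≤⟨ *-monoʳ-≤ 100 (≤-trans h (+-monoʳ-≤ E (*-monoˡ-≤ (2 * suc n) t≤n))) ⟩
      100 * (E + n * (2 * suc n)) ≡⟨ id₁ 100 E n ⟩
      100 * E + (100 * 2 * (n * n) + 100 * 2 * n) ≤⟨ +-monoʳ-≤ (100 * E) (+-monoʳ-≤ (100 * 2 * (n * n)) (*-monoˡ-≤ n (≤-trans (num {100 * 2} {1000000} {refl}) n-big))) ⟩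
      100 * E + (100 * 2 * (n * n) + n * n) ≡⟨ id₂ (100 * E) (100 * 2) (n * n) ⟩
      100 * E + (1 + 100 * 2) * (n * n) ≡⟨ cong (100 * E +_) (scale-≡ (1 + 100 * 2) (191 + 10) (n * n) refl) ⟩
      100 * E + (191 + 10) * (n * n) ≡⟨ cong (100 * E +_) (*-distribʳ-+ (n * n) 191 10) ⟩
      100 * E + (191 * (n * n) + 10 * (n * n)) ≤⟨ +-monoʳ-≤ (100 * E) (+-monoˡ-≤ (10 * (n * n)) (quad-low 1995 1000 11 74 191 r n (s≤s z≤n) (num {1000 * 1000 * 191} {1995 * (1995 * 11 + 1000 * 74)} {refl}) r-low)) ⟩
      100 * E + (11 * (r * r) + 74 * (r * n) + 10 * (n * n)) ≡⟨ id₃ (100 * E) (11 * (r * r)) (74 * (r * n)) (10 * (n * n)) ⟩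
      100 * E + (74 * (r * n) + 10 * (n * n)) + 11 * (r * r) ∎)
      where
      open ≤-Reasoning
      id₁ : ∀ c E n → c * (E + n * (2 * (1 + n))) ≡ c * E + (c * 2 * (n * n) + c * 2 * n)
      id₁ = solve-∀
      id₂ : ∀ e c x → e + (c * x + x) ≡ e + (1 + c) * x
      id₂ = solve-∀
      id₃ : ∀ e x y z → e + (x + y + z) ≡ e + (y + z) + x
      id₃ = solve-∀

-- Embedding one tree beside the used edges

module OneTree {n M C q : ℕ} (sc : Scale n M C q) where
  open Scale sc

  N : ℕ
  N = suc (2 * n)

  Z : Sub N
  Z = initial (8 * M)

  Z-count : count Z ≡ 8 * M
  Z-count = count-initial (8 * M) (≤-trans (num* 8 1000000 M refl) (≤-trans (million-M sc) (≤-trans (m≤n*m n 2) (n≤1+n (2 * n)))))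

  record Load (U : Fin N → Fin N → ℕ) (t : ℕ) : Set where
    field
      U-sym : ∀ x y → U x y ≡ U y x
      total : sum (λ x → sum (U x)) ≤ t * (2 * suc n)
      Z-total : M * (q * sum (λ x → [ Z x ] * sum (U x))) ≤ t * (2 * (n * n))

  module _ {U : Fin N → Fin N → ℕ} {t : ℕ} (t≤n : t ≤ n) (load : Load U t) where
    open Load load

    -- Pairs (x, x) are not excluded; they do no harm, the embeddings being injective.
    H : Fin N → Fin N → Bool
    H x y = isZero (U x y)

    H-sym : ∀ x y → H x y ≡ H y x
    H-sym x y = cong isZero (U-sym x y)

    Z-load : Fin N → ℕ
    Z-load y = sum (λ z → [ Z z ] * U y z)

    fresh? : Fin N → Bool
    fresh? z = does (sum (U z) ≤? M)

    light? : Fin N → Bool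
    light? y = does (Z-load y ≤? 2 * M)

    -- Vertices with too many used edges at Z are set aside. Since S ≤ M², Markov's inequality
    -- leaves at most M of them inside Z and at most M outside.
    Z₀ R₀ : Sub N
    Z₀ z = Z z ∧ fresh? z
    R₀ y = not (Z y) ∧ light? y

    S : ℕ
    S = sum (λ x → [ Z x ] * sum (U x))

    S≤ : S ≤ M * M
    S≤ = few-retired sc t S t≤n Z-total

    disjoint : ∀ y → R₀ ∋ y → Z₀ ∋ y → ⊥
    disjoint y p r = not-true (proj₁ (∧-split {not (Z y)} p)) (proj₁ (∧-split {Z y} r))

    retired-Z : count (λ z → Z z ∧ not (fresh? z)) ≤ M
    retired-Z = *-cancelˡ-≤ M ⦃ >-nonZero (M>0 sc) ⦄ (≤-trans (markov _ (λ x → [ Z x ] * sum (U x)) M heavy-z) S≤)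
      where
      heavy-z : ∀ z → Z z ∧ not (fresh? z) ≡ true → M ≤ [ Z z ] * sum (U z)
      heavy-z z p = ≤-trans (<⇒≤ (≰⇒> (not-does (sum (U z) ≤? M) (proj₂ (∧-split {Z z} p)))))
        (≤-reflexive (trans (sym (*-identityˡ _)) (cong (λ b → [ b ] * sum (U z)) (sym (proj₁ (∧-split {Z z} p))))))

    retired-R : count (λ y → not (Z y) ∧ not (light? y)) ≤ M
    retired-R = *-cancelˡ-≤ M ⦃ >-nonZero (M>0 sc) ⦄ (≤-trans (markov _ Z-load M heavy-y) (≤-trans (≤-reflexive swap) S≤))
      where
      heavy-y : ∀ y → not (Z y) ∧ not (light? y) ≡ true → M ≤ Z-load y
      heavy-y y p = ≤-trans (m≤m+n M _) (<⇒≤ (≰⇒> (not-does (Z-load y ≤? 2 * M) (proj₂ (∧-split {not (Z y)} p)))))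
      swap : sum Z-load ≡ S
      swap = trans (∑-comm (λ y z → [ Z z ] * U y z)) (sum-cong-≗ (λ z → trans (sum-cong-≗ (λ y → cong ([ Z z ] *_) (U-sym y z))) (sym (sum-scaleˡ [ Z z ] (U z)))))

    Z₀-count : 7 * M ≤ count Z₀
    Z₀-count = +-cancelʳ-≤ M _ _ (begin
      7 * M + M ≡⟨ +-comm (7 * M) M ⟩
      8 * M ≡⟨ sym Z-count ⟩
      count Z ≡⟨ count-split Z fresh? ⟩
      count Z₀ + count (λ z → Z z ∧ not (fresh? z)) ≤⟨ +-monoʳ-≤ (count Z₀) retired-Z ⟩
      count Z₀ + M ∎)
      where open ≤-Reasoning

    R₀-count : N ≤ count R₀ + 9 * M
    R₀-count = begin
      N ≡⟨ sym (sum-one N) ⟩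
      sum {N} (λ _ → 1) ≤⟨ sum-mono pt ⟩
      sum (λ y → [ R₀ y ] + ([ not (Z y) ∧ not (light? y) ] + [ Z y ])) ≡⟨ trans (∑-distrib-+ (λ y → [ R₀ y ]) (λ y → [ not (Z y) ∧ not (light? y) ] + [ Z y ])) (cong (count R₀ +_) (∑-distrib-+ (λ y → [ not (Z y) ∧ not (light? y) ]) (λ y → [ Z y ]))) ⟩
      count R₀ + (count (λ y → not (Z y) ∧ not (light? y)) + count Z) ≤⟨ +-monoʳ-≤ (count R₀) (+-mono-≤ retired-R (≤-reflexive Z-count)) ⟩
      count R₀ + 9 * M ∎
      where
      open ≤-Reasoning
      pt : ∀ y → 1 ≤ [ R₀ y ] + ([ not (Z y) ∧ not (light? y) ] + [ Z y ])
      pt y = cover (Z y) (light? y)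
        where
        cover : ∀ a b → 1 ≤ [ not a ∧ b ] + ([ not a ∧ not b ] + [ a ])
        cover true _ = ≤-refl
        cover false true = ≤-refl
        cover false false = ≤-refl

    Z-deg : ∀ z → Z₀ ∋ z → count (λ y → not (H z y)) ≤ M
    Z-deg z p = ≤-trans (sum-mono (λ y → nonzero-≤ (U z y))) (does-true (sum (U z) ≤? M) (proj₂ (∧-split {Z z} p)))

    R-deg : ∀ y → R₀ ∋ y → count (λ z → Z₀ z ∧ not (H y z)) ≤ 2 * M
    R-deg y p = ≤-trans (sum-mono pt) (does-true (Z-load y ≤? 2 * M) (proj₂ (∧-split {not (Z y)} p)))
      where
      pt : ∀ z → [ Z₀ z ∧ not (H y z) ] ≤ [ Z z ] * U y z
      pt z = bound (Z z) (fresh? z) (U y z)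
        where
        bound : ∀ a b m → [ (a ∧ b) ∧ not (isZero m) ] ≤ [ a ] * m
        bound true true zero = z≤n
        bound true true (suc m) = s≤s z≤n
        bound true false m = z≤n
        bound false b m = z≤n

    open Host H H-sym

    edges : count R₀ * count R₀ ≤ e R₀ R₀ + t * (2 * suc n)
    edges = begin
      count R₀ * count R₀ ≡⟨ *-distribʳ-sum (count R₀) (λ x → [ R₀ x ]) ⟩
      sum (λ x → [ R₀ x ] * count R₀) ≤⟨ sum-mono row ⟩
      sum (λ x → [ R₀ x ] * dg R₀ x + sum (U x)) ≡⟨ ∑-distrib-+ (λ x → [ R₀ x ] * dg R₀ x) (λ x → sum (U x)) ⟩
      e R₀ R₀ + sum (λ x → sum (U x)) ≤⟨ +-monoʳ-≤ (e R₀ R₀) total ⟩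
      e R₀ R₀ + t * (2 * suc n) ∎
      where
      open ≤-Reasoning
      entry : ∀ x → count R₀ ≤ dg R₀ x + sum (U x)
      entry x = ≤-trans (sum-mono pt) (≤-reflexive (∑-distrib-+ (λ y → [ R₀ y ∧ H x y ]) (U x)))
        where
        bound : ∀ a m → [ a ] ≤ [ a ∧ isZero m ] + m
        bound false m = z≤n
        bound true m = 1≤isZero m
        pt : ∀ y → [ R₀ y ] ≤ [ R₀ y ∧ H x y ] + U x y
        pt y = bound (R₀ y) (U x y)
      row : ∀ x → [ R₀ x ] * count R₀ ≤ [ R₀ x ] * dg R₀ x + sum (U x)
      row x = bound (R₀ x)
        where
        bound : ∀ b → [ b ] * count R₀ ≤ [ b ] * dg R₀ x + sum (U x)
        bound false = z≤n
        bound true = ≤-trans (≤-reflexive (+-identityʳ (count R₀))) (≤-trans (entry x) (≤-reflexive (cong (_+ sum (U x)) (sym (+-identityʳ (dg R₀ x))))))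

    record Placed (G : Graph (suc n)) : Set where
      field
        φ : Fin (suc n) → Fin N
        injective : ∀ {u v} → φ u ≡ φ v → u ≡ v
        unused : ∀ u v → Edge G u v → U (φ u) (φ v) ≡ 0
        few-edges : sum (λ u → sum (λ v → [ adj G u v ])) ≤ 2 * suc n
        few-Z-edges : M * (q * sum (λ u → [ Z (φ u) ] * sum (λ v → [ adj G u v ]))) ≤ 2 * (n * n)

    place : ∀ G → IsTree G → (∀ v → q * degree G v ≤ n) → Placed G
    place G isTree degree≤ = from-tree (spanning isTree)
      where
      open Grow G
      open Start sc (count R₀) R₀-count
      V : Set
      V = Fin (suc n)
      from-tree : (Σ (List V) λ L → Tree L × (∀ v → v ∈ L)) → Placed G
      from-tree (L , T , all∈) = from-blocks (cut-tree M forest rooted)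
        where
        open Tree T
        open Cut root par
        occ-one : ∀ u → occ u L ≡ 1
        occ-one u = ≤-antisym (simple u) (occ-∈ (all∈ u))
        L-length : length L ≡ suc n
        L-length = trans (sym (occ-sum L)) (trans (sum-cong-≗ occ-one) (sum-one (suc n)))
        from-blocks : Blocks M (root ∷ labels forest) → Placed G
        from-blocks B = from-result (embed blocks valid occ-blocks (≤-reflexive length-blocks) ≤-refl (good-start t (e R₀ R₀) t≤n edges))
          where
          open Blocks B
          open Order root par using (vertices; singles)
          singles≤ : M * singles blocks ≤ suc n + M
          singles≤ = ≤-trans few (≤-reflexive (cong (_+ M) (trans (cong length (sym is-labels)) L-length)))
          same′ : ∀ w → weight w (vertices blocks) ≡ weight w L
          same′ w = trans (same w) (cong (weight w) (sym is-labels))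
          occ-blocks : ∀ u → occ u (vertices blocks) ≡ 1
          occ-blocks u = trans (same′ _) (occ-one u)
          length-blocks : length (vertices blocks) ≡ suc n
          length-blocks = trans (sym (weight-one (vertices blocks))) (trans (same′ (λ _ → 1)) (trans (weight-one L) L-length))
          q-start : suc (2 * M + singles blocks) ≤ count Z₀
          q-start = ≤-trans (s≤s (+-monoʳ-≤ (2 * M) (few-pieces sc (singles blocks) singles≤)))
            (≤-trans (+-mono-≤ (M>0 sc) (≤-refl {2 * M + M})) (≤-trans (≤-reflexive (id₁ M)) (≤-trans (*-monoˡ-≤ M (num {4} {7} {refl})) Z₀-count)))
            where
            id₁ : ∀ M → M + (2 * M + M) ≡ 4 * M
            id₁ = solve-∀
          open Embed root par H H-sym R₀ Z₀ disjoint n M (n>0 sc) (N≤3n sc) (N-T sc) (N-high sc) C C-big C-big₁ C-big₂ M-small Z-deg colour (λ v → proper v (all∈ v))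
          open Process (singles blocks) R-deg r-start q-start
          open Placing root par H H-sym R₀ Z₀ disjoint using (module State)
          from-result : Result → Placed G
          from-result res = record
            { φ = φ
            ; injective = λ {u} {v} → State.inj st u v (in-pl u) (in-pl v)
            ; unused = unused
            ; few-edges = few-edges
            ; few-Z-edges = few-Z-edges }
            where
            open Result res using (pl; gl; all; few-glue) renaming (state to st)
            φ : V → Fin N
            φ = State.f st
            in-pl : ∀ u → u ∈ pl
            in-pl u = ∈-occ u pl (≤-reflexive (sym (all u)))
            A : V → V → ℕ
            A u v = [ adj G u v ]
            par-unused : ∀ v → v ≢ root → U (φ (par v)) (φ v) ≡ 0
            par-unused v h = go (State.edge st v (in-pl v))
              where
              go : v ≡ root ⊎ (par v ∈ pl × H (φ (par v)) (φ v) ≡ true) → U (φ (par v)) (φ v) ≡ 0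
              go (inj₁ r) = ⊥-elim (h r)
              go (inj₂ (_ , p)) = isZero-≡ p
            unused : ∀ u v → Edge G u v → U (φ u) (φ v) ≡ 0
            unused u v ed = go (covers u v (all∈ u) (all∈ v) ed)
              where
              go : (v ≢ root × u ≡ par v) ⊎ (u ≢ root × v ≡ par u) → U (φ u) (φ v) ≡ 0
              go (inj₁ (h , p)) = trans (cong (λ w → U (φ w) (φ v)) p) (par-unused v h)
              go (inj₂ (h , p)) = trans (U-sym (φ u) (φ v)) (trans (cong (λ w → U (φ w) (φ u)) p) (par-unused u h))
            -- Every edge joins a vertex to its parent; the root is counted along with its value
            -- under `par`, hence n + 1.
            few-edges : sum (λ u → sum (A u)) ≤ 2 * suc n
            few-edges = begin
              sum (λ u → sum (A u)) ≤⟨ sum-mono (λ u → sum-mono (pt u)) ⟩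
              sum (λ u → sum (λ v → down u v + up u v)) ≡⟨ trans (sum-cong-≗ (λ u → ∑-distrib-+ (down u) (up u))) (∑-distrib-+ (λ u → sum (down u)) (λ u → sum (up u))) ⟩
              sum (λ u → sum (down u)) + sum (λ u → sum (up u)) ≡⟨ cong₂ _+_ (trans (∑-comm down) (trans (sum-cong-≗ (λ v → sum-δ (par v) (λ _ → 1))) (sum-one (suc n)))) (trans (sum-cong-≗ (λ u → sum-δ (par u) (λ _ → 1))) (sum-one (suc n))) ⟩
              suc n + suc n ≡⟨ cong (suc n +_) (sym (+-identityʳ (suc n))) ⟩
              2 * suc n ∎
              where
              open ≤-Reasoning
              down up : V → V → ℕ
              down u v = [ does (u ≟ par v) ] * 1
              up u v = [ does (v ≟ par u) ] * 1
              pt : ∀ u v → A u v ≤ down u v + up u v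
              pt u v = by-edge (adj G u v) refl
                where
                go : (v ≢ root × u ≡ par v) ⊎ (u ≢ root × v ≡ par u) → 1 ≤ down u v + up u v
                go (inj₁ (_ , p)) = ≤-trans (≤-reflexive (cong (λ b → [ b ] * 1) (sym (true-does (u ≟ par v) p)))) (m≤m+n (down u v) (up u v))
                go (inj₂ (_ , p)) = ≤-trans (≤-reflexive (cong (λ b → [ b ] * 1) (sym (true-does (v ≟ par u) p)))) (m≤n+m (up u v) (down u v))
                by-edge : ∀ b → adj G u v ≡ b → [ b ] ≤ down u v + up u v
                by-edge false _ = z≤n
                by-edge true ed = go (covers u v (all∈ u) (all∈ v) ed)
            -- By `zone` a vertex placed in Z is a single vertex; there are at most 2 n / M of
            -- these, each of degree at most n / q.
            few-Z-edges : M * (q * sum (λ u → [ Z (φ u) ] * sum (A u))) ≤ 2 * (n * n)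
            few-Z-edges = begin
              M * (q * sum (λ u → [ Z (φ u) ] * sum (A u))) ≡⟨ cong (M *_) (sum-scaleˡ q (λ u → [ Z (φ u) ] * sum (A u))) ⟩
              M * sum (λ u → q * ([ Z (φ u) ] * sum (A u))) ≤⟨ *-monoʳ-≤ M (sum-mono pt) ⟩
              M * sum (λ u → occ u gl * n) ≡⟨ cong (M *_) (trans (sym (*-distribʳ-sum n (λ u → occ u gl))) (cong (_* n) (occ-sum gl))) ⟩
              M * (length gl * n) ≡⟨ sym (*-assoc M (length gl) n) ⟩
              M * length gl * n ≤⟨ *-monoˡ-≤ n (≤-trans (*-monoʳ-≤ M few-glue) (glue-total sc (singles blocks) singles≤)) ⟩
              2 * n * n ≡⟨ *-assoc 2 n n ⟩
              2 * (n * n) ∎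
              where
              open ≤-Reasoning
              q-degree : ∀ u → q * sum (A u) ≤ n
              q-degree u = subst (λ d → q * d ≤ n) (degree-sum G u) (degree≤ u)
              pt : ∀ u → q * ([ Z (φ u) ] * sum (A u)) ≤ occ u gl * n
              pt u = by-zone (Z (φ u)) refl (State.zone st u (in-pl u))
                where
                by-zone : ∀ b → Z (φ u) ≡ b → u ∈ gl ⊎ R₀ ∋ φ u → q * ([ b ] * sum (A u)) ≤ occ u gl * n
                by-zone false _ _ = ≤-trans (≤-reflexive (*-zeroʳ q)) z≤n
                by-zone true z (inj₂ r) = ⊥-elim (not-true (proj₁ (∧-split {not (Z (φ u))} r)) z)
                by-zone true _ (inj₁ g) = ≤-trans (≤-reflexive (cong (q *_) (*-identityˡ (sum (A u))))) (≤-trans (q-degree u) (≤-trans (≤-reflexive (sym (*-identityˡ n))) (*-monoˡ-≤ n (occ-∈ g))))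

open Defs using (K)

-- Induction over the family

module Family {n M C q : ℕ} (sc : Scale n M C q) where
  open OneTree sc

  record Packed {t : ℕ} (T : Fin t → Graph (suc n)) : Set where
    field
      U : Fin N → Fin N → ℕ
      load : Load U t
      φ : Fin t → Fin (suc n) → Fin N
      injective : ∀ s {u v} → φ s u ≡ φ s v → u ≡ v
      used : ∀ s u v → Edge (T s) u v → 1 ≤ U (φ s u) (φ s v)
      apart : ∀ s s′ → ¬ s ≡ s′ → ∀ u v x y → Edge (T s) u v → Edge (T s′) x y → ¬ (φ s u ≡ φ s′ x × φ s v ≡ φ s′ y)

  -- `T zero` is placed last. Its edges go to pairs of load 0, those of the trees before it have
  -- load at least 1, so no two embeddings need be compared.
  pack : ∀ t → t ≤ n → (T : Fin t → Graph (suc n)) → (∀ s → IsTree (T s)) → (∀ s v → q * degree (T s) v ≤ n) → Packed T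
  pack zero _ T _ _ = record
    { U = λ _ _ → 0
    ; load = record { U-sym = λ _ _ → refl ; total = ≤-reflexive (trans (sum-cong-≗ {N} (λ _ → sum-0 N)) (sum-0 N))
                    ; Z-total = ≤-trans (≤-reflexive (trans (cong (λ z → M * (q * z)) Z-zero) (trans (cong (M *_) (*-zeroʳ q)) (*-zeroʳ M)))) z≤n }
    ; φ = λ () ; injective = λ () ; used = λ () ; apart = λ () }
    where
    Z-zero : sum (λ x → [ Z x ] * sum {N} (λ _ → 0)) ≡ 0
    Z-zero = trans (sum-cong-≗ (λ x → trans (cong ([ Z x ] *_) (sum-0 N)) (*-zeroʳ [ Z x ]))) (sum-0 N)
  pack (suc t) t<n T isTree degree≤ = next (pack t (<⇒≤ t<n) (λ s → T (suc s)) (λ s → isTree (suc s)) (λ s → degree≤ (suc s)))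
    where
    next : Packed (λ s → T (suc s)) → Packed T
    next P = combine (place (<⇒≤ t<n) load (T zero) (isTree zero) (degree≤ zero))
      where
      open Packed P
      open Load load
      combine : Placed (<⇒≤ t<n) load (T zero) → Packed T
      combine Q = record { U = U′ ; load = record { U-sym = sym′ ; total = total′ ; Z-total = Z-total′ } ; φ = φ′ ; injective = inj′ ; used = used′ ; apart = apart′ }
        where
        module Q = Placed Q
        open Usage (T zero) Q.φ using (use; use-sym; hit; weighted) renaming (total to use-total)
        U′ : Fin N → Fin N → ℕ
        U′ x y = use x y + U x y
        sym′ : ∀ x y → U′ x y ≡ U′ y x
        sym′ x y = cong₂ _+_ (use-sym x y) (U-sym x y)
        row : ∀ x → sum (U′ x) ≡ sum (use x) + sum (U x)
        row x = ∑-distrib-+ (use x) (U x)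
        total′ : sum (λ x → sum (U′ x)) ≤ suc t * (2 * suc n)
        total′ = begin
          sum (λ x → sum (U′ x)) ≡⟨ trans (sum-cong-≗ row) (∑-distrib-+ (λ x → sum (use x)) (λ x → sum (U x))) ⟩
          sum (λ x → sum (use x)) + sum (λ x → sum (U x)) ≤⟨ +-mono-≤ (≤-trans (≤-reflexive use-total) Q.few-edges) total ⟩
          suc t * (2 * suc n) ∎
          where open ≤-Reasoning
        Z-total′ : M * (q * sum (λ x → [ Z x ] * sum (U′ x))) ≤ suc t * (2 * (n * n))
        Z-total′ = begin
          M * (q * sum (λ x → [ Z x ] * sum (U′ x))) ≡⟨ cong (λ z → M * (q * z)) (trans (sum-cong-≗ (λ x → trans (cong ([ Z x ] *_) (row x)) (*-distribˡ-+ [ Z x ] (sum (use x)) (sum (U x)))))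
              (trans (∑-distrib-+ (λ x → [ Z x ] * sum (use x)) (λ x → [ Z x ] * sum (U x))) (cong (_+ sum (λ x → [ Z x ] * sum (U x))) (weighted (λ x → [ Z x ]))))) ⟩
          M * (q * (sum (λ u → [ Z (Q.φ u) ] * sum (λ v → [ adj (T zero) u v ])) + sum (λ x → [ Z x ] * sum (U x)))) ≡⟨ id₁ M q (sum (λ u → [ Z (Q.φ u) ] * sum (λ v → [ adj (T zero) u v ]))) (sum (λ x → [ Z x ] * sum (U x))) ⟩
          M * (q * sum (λ u → [ Z (Q.φ u) ] * sum (λ v → [ adj (T zero) u v ]))) + M * (q * sum (λ x → [ Z x ] * sum (U x))) ≤⟨ +-mono-≤ Q.few-Z-edges Z-total ⟩
          suc t * (2 * (n * n)) ∎
          where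
          open ≤-Reasoning
          id₁ : ∀ M q a b → M * (q * (a + b)) ≡ M * (q * a) + M * (q * b)
          id₁ = solve-∀
        φ′ : Fin (suc t) → Fin (suc n) → Fin N
        φ′ zero = Q.φ
        φ′ (suc s) = φ s
        inj′ : ∀ s {u v} → φ′ s u ≡ φ′ s v → u ≡ v
        inj′ zero = Q.injective
        inj′ (suc s) = injective s
        used′ : ∀ s u v → Edge (T s) u v → 1 ≤ U′ (φ′ s u) (φ′ s v)
        used′ zero u v ed = ≤-trans (hit u v ed) (m≤m+n (use (Q.φ u) (Q.φ v)) _)
        used′ (suc s) u v ed = ≤-trans (used s u v ed) (m≤n+m _ (use (φ s u) (φ s v)))
        clash : ∀ s u v x y → Edge (T zero) u v → Edge (T (suc s)) x y → Q.φ u ≡ φ s x → Q.φ v ≡ φ s y → ⊥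
        clash s u v x y e₀ e₁ p r = <⇒≱ (used s x y e₁) (≤-reflexive (subst₂ (λ a b → U a b ≡ 0) p r (Q.unused u v e₀)))
        apart′ : ∀ s s′ → ¬ s ≡ s′ → ∀ u v x y → Edge (T s) u v → Edge (T s′) x y → ¬ (φ′ s u ≡ φ′ s′ x × φ′ s v ≡ φ′ s′ y)
        apart′ zero zero h = ⊥-elim (h refl)
        apart′ zero (suc s′) h u v x y e₀ e₁ (p , r) = clash s′ u v x y e₀ e₁ p r
        apart′ (suc s) zero h u v x y e₀ e₁ (p , r) = clash s x y u v e₁ e₀ (sym p) (sym r)
        apart′ (suc s) (suc s′) h = apart s s′ (λ q → h (cong suc q))

  packs : (T : Fin n → Graph (suc n)) → (∀ s → IsTree (T s)) → (∀ s v → q * degree (T s) v ≤ n) → Packs T (K (suc (2 * n)))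
  packs T isTree degree≤ = φs , λ s s′ h u v x y e₀ e₁ → λ
      { (inj₁ p) → apart s s′ h u v x y e₀ e₁ p
      ; (inj₂ p) → apart s s′ h u v y x e₀ (trans (Defs.sym (T s′) y x) e₁) p }
    where
    open Packed (pack n ≤-refl T isTree degree≤)
    φs : ∀ s → Embedding (T s) (K (suc (2 * n)))
    φs s = record { f = φ s ; inj = injective s ; edgeMap = λ u v ed → does-not (φ s u ≟ φ s v) (λ p → no-loop u v ed (injective s p)) }
      where
      no-loop : ∀ u v → Edge (T s) u v → u ≢ v
      no-loop u .u ed refl with trans (sym ed) (irref (T s) u)
      ... | ()

-- The constant c is 1 / (16 C³ + 1); n > 5 C² gives M = n / C at least 5 C, and the logarithm is at
-- least 1.
packing : ∀ C → 1000000 ≤ C → 100 * (20001 * (3 * (10000 * (20001 * 12)))) * (1 + 3 * 10000) ≤ C →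
  10000 * (10000 * (20001 * (3 * (10000 * (20001 * 12))))) ≤ C →
  Σ ℕ λ p → Σ ℕ λ q → 0 < p × Σ ℕ λ n₀ → ∀ n → n₀ < n → (T : Fin n → Graph (suc n)) → (∀ s → IsTree (T s)) →
  (∀ s v → suc q * degree (T s) v * ⌊log₂ n ⌋ ≤ p * n) → Packs T (K (suc (2 * n)))
packing C C-big C-big₁ C-big₂ = 1 , 16 * (C * C * C) , s≤s z≤n , 5 * C * C , λ n n₀<n T isTree degree≤ →
  Family.packs (scale n n₀<n) T isTree (λ s v → bound n (degree (T s) v) n₀<n (degree≤ s v))
  where
  C-pos : 0 < C
  C-pos = ≤-trans (s≤s z≤n) C-big
  instance
    C≢0 : NonZero C
    C≢0 = >-nonZero C-pos
  division : ∀ n → n < C * suc (n / C)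
  division n = ≤-trans (≤-reflexive (cong suc (m≡m%n+[m/n]*n n C))) (≤-trans (+-monoˡ-≤ (n / C * C) (m%n<n n C)) (≤-reflexive (id₁ C (n / C))))
    where
    id₁ : ∀ C M → C + M * C ≡ C * (1 + M)
    id₁ = solve-∀
  scale : ∀ n → 5 * C * C < n → Scale n (n / C) C (16 * (C * C * C))
  scale n n₀<n = record
    { C-big = C-big ; C-big₁ = C-big₁ ; C-big₂ = C-big₂
    ; M-small = ≤-trans (≤-reflexive (*-comm C (n / C))) (m/n*n≤m n C)
    ; M-large = ≤-trans (<⇒≤ (division n)) (≤-trans (*-monoʳ-≤ C (+-monoˡ-≤ (n / C) M>0′)) (≤-reflexive (id₁ C (n / C))))
    ; M-C = M-C ; q-big = ≤-refl }
    where
    id₁ : ∀ C M → C * (M + M) ≡ 2 * C * M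
    id₁ = solve-∀
    5C≤ : 5 * C ≤ n / C
    5C≤ = ≤-pred (*-cancelˡ-< C (5 * C) (suc (n / C)) (<-trans (subst (_< n) (*-comm (5 * C) C) n₀<n) (division n)))
    M>0′ : 0 < n / C
    M>0′ = ≤-trans C-pos (≤-trans (m≤n*m C 5) 5C≤)
    M-C : 4 * C ≤ n / C
    M-C = ≤-trans (*-monoˡ-≤ C (n≤1+n 4)) 5C≤
  bound : ∀ n d → 5 * C * C < n → suc (16 * (C * C * C)) * d * ⌊log₂ n ⌋ ≤ 1 * n → 16 * (C * C * C) * d ≤ n
  bound n d n₀<n h = begin
    16 * (C * C * C) * d ≤⟨ m≤n+m _ d ⟩
    suc (16 * (C * C * C)) * d ≤⟨ m≤m*n _ ⌊log₂ n ⌋ ⦃ >-nonZero (⌊log₂⌋-mono-≤ {2} {n} 2≤n) ⦄ ⟩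
    suc (16 * (C * C * C)) * d * ⌊log₂ n ⌋ ≤⟨ h ⟩
    1 * n ≡⟨ *-identityˡ n ⟩
    n ∎
    where
    open ≤-Reasoning
    2≤n : 2 ≤ n
    2≤n = ≤-trans (s≤s (*-mono-≤ (*-mono-≤ {1} {5} (s≤s z≤n) C-pos) C-pos)) n₀<n

theorem1p7 : Σ ℕ λ p → Σ ℕ λ q → 0 < p × Σ ℕ λ n₀ →
    ∀ n → n₀ < n →
    (T : Fin n → Graph (suc n)) →
    (∀ s → IsTree (T s)) →
    (∀ s v → suc q * degree (T s) v * ⌊log₂ n ⌋ ≤ p * n) →
    Packs T (K (suc (2 * n)))
-- 36 L³ T² is the largest of the three lower bounds on C.
theorem1p7 = packing (10000 * (10000 * (20001 * (3 * (10000 * (20001 * 12))))))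
  (num {1000000} {10000 * (10000 * (20001 * (3 * (10000 * (20001 * 12)))))} {refl})
  (num {100 * (20001 * (3 * (10000 * (20001 * 12)))) * (1 + 3 * 10000)} {10000 * (10000 * (20001 * (3 * (10000 * (20001 * 12)))))} {refl})
  ≤-refl
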